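{- Consider the Bohman–Frieze process on $n$ vertices and let $\mathrm{BF}(t)$ be the graph after $\lfloor nt/2\rfloor$ rounds. Let $t_c$ and $\bar s_2,\bar s_3,\bar s_4$ be as defined below. Then for any fixed $t\in[0,t_c)$ and $k=2,3,4$, $s_k(\mathrm{BF}(t))\to\bar s_k(t)$ in probability as $n\to\infty$.
   Context: Bohman–Frieze process: start with the empty graph on $n$ vertices; in each round, two edges $e_1=\{v_1,w_1\}$ and $e_2=\{v_2,w_2\}$ are chosen independently and uniformly at random; if both $v_1$ and $w_1$ are isolated vertices in the current graph, $e_1$ is added, otherwise $e_2$ is added. For a graph $G$ with component sizes $C_i$, $s_k(G)=\frac{1}{|G|}\sum_i C_i^k$. Let $\bar x$ solve $\bar x'=-\bar x^2-(1-\bar x^2)\bar x$, $\bar x(0)=1$ (defined and positive on $[0,\infty)$), and let $\bar s_2,\bar s_3,\bar s_4$ solve $\bar s_2'=\bar x^2+(1-\bar x^2)\bar s_2^2$, $\bar s_3'=3\bar x^2+3(1-\bar x^2)\bar s_2\bar s_3$, $\bar s_4'=7\bar x^2+(1-\bar x^2)(4\bar s_2\bar s_4+3\bar s_3^2)$ with $\bar s_2(0)=\bar s_3(0)=\bar s_4(0)=1$; $t_c\in(0,\infty)$ is the explosion time of $\bar s_2$ (so $\bar s_2(t)\to\infty$ as $t\uparrow t_c$), and these functions are defined on $[0,t_c)$. -}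

module Defs where

open import Level using (0ℓ) renaming (suc to lsuc)
open import Data.Nat as ℕ using (ℕ; zero; suc)
open import Data.Fin as Fin using (Fin)
open import Data.Fin.Subset using (Subset; ∣_∣)
open import Data.Bool.Base using (if_then_else_)
import Data.Bool.Properties as Bool
open import Data.List.Base
  using (List; []; _∷_; map; length; filter; allFin; cartesianProduct;
         cartesianProductWith; deduplicate)
open import Data.Nat.ListAction using (sum)
open import Data.List.Membership.Propositional using (_∈_)
open import Data.List.Relation.Unary.All using (All; all?)
open import Data.List.Relation.Unary.Any using (here; there)
open import Data.Vec.Base using (Vec; []; _∷_; tabulate)
open import Data.Vec.Properties using (≡-dec)
open import Data.Product using (∃; ∃-syntax; _×_; _,_; proj₁; proj₂; uncurry)
open import Data.Sum using (_⊎_; inj₁; inj₂)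
open import Relation.Nullary using (¬_; Dec; does; yes; no)
open import Relation.Nullary.Decidable using (¬?; _×-dec_; _⊎-dec_; map′)
open import Relation.Unary using (Pred; Decidable)
open import Relation.Binary.PropositionalEquality using (_≡_; _≢_; refl)
open import Relation.Binary.Structures using (IsStrictTotalOrder)
open import Relation.Binary.Construct.Closure.Equivalence as EqC using (EqClosure)
open import Relation.Binary.Construct.Closure.ReflexiveTransitive using (ε; _◅_; _◅◅_)
open import Relation.Binary.Construct.Closure.Symmetric using (fwd; bwd)
open import Algebra.Bundles using (CommutativeRing; Semiring)
import Algebra.Definitions.RawSemiring as RawSemiringOps
import Relation.Binary.Construct.StrictToNonStrict as NonStrict

-- Dedekind-complete totally ordered fields.  Classically such a structure
-- exists and is unique up to isomorphism, namely ℝ; a statement about ℝ is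
-- therefore rendered by quantifying over this record.

record RealNumbers : Set (lsuc 0ℓ) where
  infix  4 _<_
  infix  9 _⁻¹
  field
    commutativeRing : CommutativeRing 0ℓ 0ℓ

  open CommutativeRing commutativeRing public
    renaming (refl to ≈-refl; sym to ≈-sym; trans to ≈-trans)

  field
    -- The value of 0# ⁻¹ is unspecified.
    _⁻¹                : Carrier → Carrier
    *-inverseʳ         : ∀ x → ¬ (x ≈ 0#) → x * x ⁻¹ ≈ 1#
    _<_                : Carrier → Carrier → Set
    isStrictTotalOrder : IsStrictTotalOrder _≈_ _<_
    0<1                : 0# < 1#
    +-monoˡ-<          : ∀ x y z → x < y → x + z < y + z
    *-pos              : ∀ x y → 0# < x → 0# < y → 0# < x * y

  infix 4 _≤_
  _≤_ : Carrier → Carrier → Set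
  _≤_ = NonStrict._≤_ _≈_ _<_

  _IsUpperBoundOf_ : Carrier → (Carrier → Set) → Set
  b IsUpperBoundOf P = ∀ x → P x → x ≤ b

  field
    supremum : (P : Carrier → Set) → ∃ P → (∃[ b ] b IsUpperBoundOf P) →
               ∃[ s ] s IsUpperBoundOf P × (∀ b → b IsUpperBoundOf P → s ≤ b)

  open IsStrictTotalOrder isStrictTotalOrder public
    using (compare; _<?_; <-resp-≈; irrefl)
    renaming (trans to <-trans)
  open RawSemiringOps (Semiring.rawSemiring semiring) public using (_^_) renaming (_×_ to _·_)

  fromℕ : ℕ → Carrier
  fromℕ n = n · 1#

  abs : Carrier → Carrier
  abs x = if does (x <? 0#) then - x else x

  IsFloorOf : ℕ → Carrier → Set
  IsFloorOf m x = fromℕ m ≤ x × x < fromℕ (suc m)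

  TendsTo : (ℕ → Carrier) → Carrier → Set
  TendsTo a l = ∀ ε → 0# < ε → ∃[ N ] (∀ n → N ℕ.≤ n → abs (a n - l) < ε)

  -- f is differentiable at x relative to the domain D (so one-sidedly at an
  -- end point), with derivative l.  Only values of f on D matter.  Since
  -- y ≈ x is allowed, f automatically respects _≈_ at x.
  HasDerivativeWithin : (Carrier → Set) → (Carrier → Carrier) → Carrier → Carrier → Set
  HasDerivativeWithin D f x l =
    ∀ ε → 0# < ε → ∃[ δ ] 0# < δ ×
      (∀ y → D y → abs (y - x) < δ →
        abs (f y - f x - l * (y - x)) ≤ ε * abs (y - x))

  HasDerivativeOn : (Carrier → Set) → (Carrier → Carrier) → (Carrier → Carrier) → Set
  HasDerivativeOn D f F = ∀ t → D t → HasDerivativeWithin D f t (F t)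

  ExplodesAt : (Carrier → Carrier) → Carrier → Set
  ExplodesAt f c =
    ∀ M → ∃[ t₀ ] 0# ≤ t₀ × t₀ < c × (∀ t → t₀ < t → t < c → M < f t)

  -- Probability of P under the uniform distribution on the entries of a list.
  ℙ : {Ω : Set} (outcomes : List Ω) {P : Pred Ω 0ℓ} → Decidable P → Carrier
  ℙ outcomes P? = fromℕ (length (filter P? outcomes)) * fromℕ (length outcomes) ⁻¹

  -- The n-th variable X n lives on its own finite uniform space.
  ConvergesInProbability : {Ω : ℕ → Set} → (∀ n → List (Ω n)) →
                           (∀ n → Ω n → Carrier) → Carrier → Set
  ConvergesInProbability outcomes X c =
    ∀ ε → 0# < ε → TendsTo (λ n → ℙ (outcomes n) (λ ω → ε <? abs (X n ω - c))) 0#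

-- (v , w) stands for the undirected edge {v , w}.
Edge : ℕ → Set
Edge n = Fin n × Fin n

-- The set of edges; order, orientation and repetitions are immaterial to
-- everything below.
Graph : ℕ → Set
Graph n = List (Edge n)

-- All edges of the complete graph, each listed once (as v < w).
allEdges : ∀ n → List (Edge n)
allEdges n = filter (uncurry Fin._<?_) (cartesianProduct (allFin n) (allFin n))

Isolated : ∀ {n} → Graph n → Fin n → Set
Isolated G v = All (λ e → proj₁ e ≢ v × proj₂ e ≢ v) G

isolated? : ∀ {n} (G : Graph n) → Decidable (Isolated G)
isolated? G v = all? (λ e → ¬? (proj₁ e Fin.≟ v) ×-dec ¬? (proj₂ e Fin.≟ v)) G

Connected : ∀ {n} → Graph n → Fin n → Fin n → Set
Connected G = EqClosure (λ v w → (v , w) ∈ G)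

module _ {n : ℕ} where

  Through : Graph n → Edge n → Fin n → Fin n → Set
  Through G (a , b) v w =
    Connected G v w ⊎ (Connected G v a × Connected G b w) ⊎ (Connected G v b × Connected G a w)

  weaken : ∀ {G : Graph n} {e v w} → Connected G v w → Connected (e ∷ G) v w
  weaken = EqC.map there

  fromThrough : ∀ {G e v w} → Through G e v w → Connected (e ∷ G) v w
  fromThrough (inj₁ p)              = weaken p
  fromThrough (inj₂ (inj₁ (p , q))) = weaken p ◅◅ fwd (here refl) ◅ weaken q
  fromThrough (inj₂ (inj₂ (p , q))) = weaken p ◅◅ bwd (here refl) ◅ weaken q

  prepend : ∀ {G e v u w} → Connected G v u → Through G e u w → Through G e v w
  prepend r (inj₁ p)              = inj₁ (r ◅◅ p)
  prepend r (inj₂ (inj₁ (p , q))) = inj₂ (inj₁ (r ◅◅ p , q))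
  prepend r (inj₂ (inj₂ (p , q))) = inj₂ (inj₂ (r ◅◅ p , q))

  cross : ∀ {G a b w} → Through G (a , b) b w → Through G (a , b) a w
  cross (inj₁ p)              = inj₂ (inj₁ (ε , p))
  cross (inj₂ (inj₁ (_ , q))) = inj₂ (inj₁ (ε , q))
  cross (inj₂ (inj₂ (_ , q))) = inj₁ q

  crossBack : ∀ {G a b w} → Through G (a , b) a w → Through G (a , b) b w
  crossBack (inj₁ p)              = inj₂ (inj₂ (ε , p))
  crossBack (inj₂ (inj₁ (_ , q))) = inj₁ q
  crossBack (inj₂ (inj₂ (_ , q))) = inj₂ (inj₂ (ε , q))

  toThrough : ∀ {G e v w} → Connected (e ∷ G) v w → Through G e v w
  toThrough ε                      = inj₁ ε
  toThrough (fwd (here refl) ◅ ps) = cross (toThrough ps)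
  toThrough (bwd (here refl) ◅ ps) = crossBack (toThrough ps)
  toThrough (fwd (there i) ◅ ps)   = prepend (fwd i ◅ ε) (toThrough ps)
  toThrough (bwd (there i) ◅ ps)   = prepend (bwd i ◅ ε) (toThrough ps)

  connected? : (G : Graph n) (v w : Fin n) → Dec (Connected G v w)
  connected? [] v w = map′ (λ { refl → ε }) (λ { ε → refl ; (fwd () ◅ _) ; (bwd () ◅ _) }) (v Fin.≟ w)
  connected? ((a , b) ∷ G) v w = map′ fromThrough toThrough
    (connected? G v w
      ⊎-dec (connected? G v a ×-dec connected? G b w)
      ⊎-dec (connected? G v b ×-dec connected? G a w))

  componentOf : Graph n → Fin n → Subset n
  componentOf G v = tabulate (λ w → does (connected? G v w))

  -- Each component is listed exactly once.
  components : Graph n → List (Subset n)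
  components G = deduplicate (≡-dec Bool._≟_) (map (componentOf G) (allFin n))

  componentPowerSum : ℕ → Graph n → ℕ
  componentPowerSum k G = sum (map (λ C → ∣ C ∣ ℕ.^ k) (components G))

-- The pair (e₁ , e₂) of edges offered in one round.
Round : ℕ → Set
Round n = Edge n × Edge n

bfStep : ∀ {n} → Round n → Graph n → Graph n
bfStep (e₁@(v₁ , w₁) , e₂) G =
  if does (isolated? G v₁ ×-dec isolated? G w₁) then e₁ ∷ G else e₂ ∷ G

-- The most recent round is at the head of the vector.
bohmanFrieze : ∀ {n m} → Vec (Round n) m → Graph n
bohmanFrieze []      = []
bohmanFrieze (r ∷ ω) = bfStep r (bohmanFrieze ω)

-- All m-round histories.  Independent uniform choices of all offered edges
-- amount to the uniform distribution on this list.
histories : ∀ n m → List (Vec (Round n) m)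
histories n zero    = [] ∷ []
histories n (suc m) =
  cartesianProductWith _∷_ (cartesianProduct (allEdges n) (allEdges n)) (histories n m)

module _ (R : RealNumbers) where
  open RealNumbers R

  -- sₖ(G) = (1/|G|) Σᵢ Cᵢᵏ
  susceptibility : ∀ {n} → ℕ → Graph n → Carrier
  susceptibility {n} k G = fromℕ (componentPowerSum k G) * fromℕ n ⁻¹

  SusceptibilityConverges : (rounds : ℕ → ℕ) → ℕ → Carrier → Set
  SusceptibilityConverges rounds k c =
    ConvergesInProbability (λ n → histories n (rounds n))
                           (λ n ω → susceptibility k (bohmanFrieze ω)) c

  [0,∞⟩ : Carrier → Set
  [0,∞⟩ t = 0# ≤ t

  [0,_⟩ : Carrier → Carrier → Set
  [0, c ⟩ t = 0# ≤ t × t < c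

  -- The functions are total, but are constrained only on [0,∞) (for x̄) and
  -- on [0,t-c) (for s̄₂, s̄₃, s̄₄).
  record BFSystem : Set where
    field
      x̄ s̄₂ s̄₃ s̄₄ : Carrier → Carrier
      t-c        : Carrier

      0<t-c  : 0# < t-c
      x̄-init : x̄ 0# ≈ 1#
      x̄-pos  : ∀ t → [0,∞⟩ t → 0# < x̄ t
      x̄-ode  : HasDerivativeOn [0,∞⟩ x̄ λ t →
                 - (x̄ t ^ 2) - (1# - x̄ t ^ 2) * x̄ t

      s̄₂-init : s̄₂ 0# ≈ 1#
      s̄₂-ode  : HasDerivativeOn [0, t-c ⟩ s̄₂ λ t →
                  x̄ t ^ 2 + (1# - x̄ t ^ 2) * s̄₂ t ^ 2
      s̄₂-explodes : ExplodesAt s̄₂ t-c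

      s̄₃-init : s̄₃ 0# ≈ 1#
      s̄₃-ode  : HasDerivativeOn [0, t-c ⟩ s̄₃ λ t →
                  fromℕ 3 * x̄ t ^ 2 + fromℕ 3 * (1# - x̄ t ^ 2) * s̄₂ t * s̄₃ t

      s̄₄-init : s̄₄ 0# ≈ 1#
      s̄₄-ode  : HasDerivativeOn [0, t-c ⟩ s̄₄ λ t →
                  fromℕ 7 * x̄ t ^ 2
                  + (1# - x̄ t ^ 2) * (fromℕ 4 * s̄₂ t * s̄₄ t + fromℕ 3 * s̄₃ t ^ 2)

{-# OPTIONS --safe #-}
-- Write x for the fraction of isolated vertices and h = 1/n.  The four
-- quantities x, s₂, s₃, s₄ change in one round by 2h times the right-hand
-- sides of the differential equations, in conditional expectation and up to
-- O(h² (1 + s₇)), as long as they stay bounded; there the conditional second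
-- moments of their changes are O(h² (1 + s₇)) as well, and s₇ grows by a factor
-- 1 + O(h).  Hence the Lyapunov function
--
--   D = (x - x̄)² + (s₂ - s̄₂)² + (s₃ - s̄₃)² + (s₄ - s̄₄)² + h s₇
--
-- satisfies E D′ ≤ D + h A (D + h) wherever D < 1.  Since min(D, 1) satisfies
-- this inequality everywhere, no stopping time is needed: E min(D, 1) = O(h)
-- after O(n) rounds, and the theorem follows from Markov's inequality.
--
-- The estimates for s₂, s₃, s₄ come from the merging of the components of a
-- and b, which adds (a + b)ᵏ - aᵏ - bᵏ to the sum of k-th powers; averaged over
-- all ordered pairs of vertices this is a polynomial in the susceptibilities.
module Submission where

open import Defs
open import Level using (0ℓ)
open import Data.Nat.Base as ℕ using (ℕ; zero; suc; z≤n; s≤s)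
import Data.Nat.Properties as ℕ
open import Data.Integer.Base as ℤ using (ℤ; +_; -[1+_]; _⊖_; _◃_; sign)
import Data.Integer.Properties as ℤ
open import Data.Sign.Base as Sign using (Sign)
open import Data.Maybe.Base using (Maybe; just; nothing)
open import Relation.Nullary using (yes; no; ¬_; does; Dec)
open import Relation.Binary.PropositionalEquality as ≡ using (_≡_; refl; _≢_)
open import Algebra.Bundles using (RawRing)
open import Algebra.Solver.Ring.AlmostCommutativeRing
  using (AlmostCommutativeRing; fromCommutativeRing; _-Raw-AlmostCommutative⟶_)
open import Data.Product using (∃-syntax; _×_; _,_; proj₁; proj₂; uncurry)
open import Data.Sum using (_⊎_; inj₁; inj₂)
open import Data.Empty using (⊥-elim)
open import Relation.Binary.Definitions using (tri<; tri≈; tri>)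
open import Relation.Binary.Bundles using (StrictTotalOrder)
open import Axiom.ExcludedMiddle using (ExcludedMiddle)
open import Data.Bool.Base using (Bool; true; false; not; _∨_; _∧_; if_then_else_)
open import Data.List.Base
  using (List; []; _∷_; _++_; map; length; filter; cartesianProductWith; cartesianProduct; allFin; tabulate)
open import Data.List.Membership.Propositional using (_∈_)
open import Data.List.Relation.Unary.Any using (here; there)
open import Data.List.Relation.Unary.All as All using (All; []; _∷_)
open import Data.List.Relation.Unary.AllPairs using ([]; _∷_)
open import Data.List.Relation.Unary.Unique.Propositional using (Unique)
open import Relation.Unary using (Pred; Decidable)
open import Data.Nat.ListAction using (sum)
open import Data.Fin.Base as Fin using (Fin; zero; suc)
import Data.Fin.Properties as Fin
open import Data.Fin.Subset using (Subset; ∣_∣)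
import Data.Bool.Properties as Bool
open import Data.List.Properties using (length-tabulate)
open import Data.List.Membership.Propositional.Properties
  using (∈-allFin; ∈-map⁺; ∈-map⁻; ∈-deduplicate⁺; ∈-deduplicate⁻; ∈-filter⁻; ∈-cartesianProduct⁻)
open import Data.List.Relation.Unary.Unique.Propositional.Properties using (allFin⁺)
import Data.List.Relation.Unary.Unique.DecPropositional.Properties as UniqueDec
open import Data.Vec.Base using (Vec; []; _∷_; lookup)
open import Data.Vec.Properties using (≡-dec; tabulate-cong; lookup∘tabulate)
open import Function.Bundles using (mk⇔)
open import Relation.Nullary.Decidable using (does-⇔; dec-true; dec-false; _×-dec_; _⊎-dec_)
import Relation.Binary.Construct.Closure.Equivalence as EqC
open import Relation.Binary.Construct.Closure.ReflexiveTransitive as Star using (_◅_; _◅◅_)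
open import Relation.Binary.Construct.Closure.Symmetric using (fwd; bwd)

-- The obstacle is closure. The squared increment of s₄ contains terms of order h² a⁶ b², so its
-- mean involves s₇, which the differential equations do not control. Its contribution to E D′ is of
-- order h² s₇ = h · (h s₇); making h s₇ a term of D turns this error into h · D, the form of all
-- the others. The hierarchy stops there, because the expected growth of s₇ in one round is at most
-- a constant times h s₇ s₂, with no higher susceptibility in it, and s₂ is bounded as long as D <
-- 1. Truncation at 1 works for two reasons. Where D ≥ 1 the minimum already has its largest value
-- and cannot increase; where D < 1 every coordinate is within 1 of the bounded limit curve, so that
-- all constants can be taken from one fixed box. The factor 2 in front of the equations is the time
-- scale: about nt/2 rounds lead to time t, so one round lasts 2h.

-- Polynomial identities with integer coefficients over the abstract reals.

module RingSolver (R : RealNumbers) where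

  open RealNumbers R

  import Algebra.Properties.Ring ring as RingP
  import Algebra.Properties.Semiring.Mult semiring as Mult

  fromℕ-+ : ∀ m n → fromℕ (m ℕ.+ n) ≈ fromℕ m + fromℕ n
  fromℕ-+ = Mult.×-homo-+ 1#

  fromℕ-* : ∀ m n → fromℕ (m ℕ.* n) ≈ fromℕ m * fromℕ n
  fromℕ-* = Mult.×1-homo-*

  fromℕ-1 : fromℕ 1 ≈ 1#
  fromℕ-1 = +-identityʳ 1#

  private
    open import Relation.Binary.Reasoning.Setoid setoid

    toR : ℤ → Carrier
    toR (+ n)      = fromℕ n
    toR (-[1+ n ]) = - fromℕ (suc n)

    cancel-suc : ∀ a b → (1# + a) - (1# + b) ≈ a - b
    cancel-suc a b = begin
      (1# + a) + - (1# + b)      ≈⟨ +-cong (+-comm 1# a) (RingP.-‿anti-homo-+ 1# b) ⟩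
      (a + 1#) + (- b + - 1#)    ≈⟨ +-congˡ (+-comm (- b) (- 1#)) ⟩
      (a + 1#) + (- 1# + - b)    ≈⟨ +-assoc a 1# (- 1# + - b) ⟩
      a + (1# + (- 1# + - b))    ≈⟨ +-congˡ (+-assoc 1# (- 1#) (- b)) ⟨
      a + ((1# + - 1#) + - b)    ≈⟨ +-congˡ (+-congʳ (-‿inverseʳ 1#)) ⟩
      a + (0# + - b)             ≈⟨ +-congˡ (+-identityˡ (- b)) ⟩
      a - b                      ∎

    toR-⊖ : ∀ m n → toR (m ⊖ n) ≈ fromℕ m - fromℕ n
    toR-⊖ m       zero    = begin
      toR (m ⊖ 0)      ≡⟨ ≡.cong toR (ℤ.⊖-≥ {m} ℕ.z≤n) ⟩
      fromℕ m          ≈⟨ +-identityʳ (fromℕ m) ⟨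
      fromℕ m + 0#     ≈⟨ +-congˡ RingP.-0#≈0# ⟨
      fromℕ m - 0#     ∎
    toR-⊖ zero    (suc n) = ≈-sym (+-identityˡ (- fromℕ (suc n)))
    toR-⊖ (suc m) (suc n) = begin
      toR (suc m ⊖ suc n)              ≡⟨ ≡.cong toR (ℤ.[1+m]⊖[1+n]≡m⊖n m n) ⟩
      toR (m ⊖ n)                      ≈⟨ toR-⊖ m n ⟩
      fromℕ m - fromℕ n                ≈⟨ cancel-suc (fromℕ m) (fromℕ n) ⟨
      fromℕ (suc m) - fromℕ (suc n)    ∎

    toR-+ : ∀ i j → toR (i ℤ.+ j) ≈ toR i + toR j
    toR-+ (+ m)      (+ n)      = fromℕ-+ m n
    toR-+ (+ m)      (-[1+ n ]) = toR-⊖ m (suc n)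
    toR-+ (-[1+ m ]) (+ n)      = ≈-trans (toR-⊖ n (suc m)) (+-comm (fromℕ n) (- fromℕ (suc m)))
    toR-+ (-[1+ m ]) (-[1+ n ]) = begin
      - fromℕ (suc (suc (m ℕ.+ n)))           ≡⟨ ≡.cong (λ k → - fromℕ (suc k)) (ℕ.+-suc m n) ⟨
      - fromℕ (suc m ℕ.+ suc n)               ≈⟨ -‿cong (fromℕ-+ (suc m) (suc n)) ⟩
      - (fromℕ (suc m) + fromℕ (suc n))       ≈⟨ RingP.-‿anti-homo-+ (fromℕ (suc m)) (fromℕ (suc n)) ⟩
      - fromℕ (suc n) + - fromℕ (suc m)       ≈⟨ +-comm _ _ ⟩
      - fromℕ (suc m) + - fromℕ (suc n)       ∎

    toR-neg : ∀ i → toR (ℤ.- i) ≈ - toR i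
    toR-neg (+ zero)   = ≈-sym RingP.-0#≈0#
    toR-neg (+ suc n)  = ≈-refl
    toR-neg (-[1+ n ]) = ≈-sym (RingP.-‿involutive (fromℕ (suc n)))

    sgn : Sign → Carrier → Carrier
    sgn Sign.+ x = x
    sgn Sign.- x = - x

    toR-◃ : ∀ s n → toR (s ◃ n) ≈ sgn s (fromℕ n)
    toR-◃ Sign.+ zero    = ≈-refl
    toR-◃ Sign.- zero    = ≈-sym RingP.-0#≈0#
    toR-◃ Sign.+ (suc n) = ≈-refl
    toR-◃ Sign.- (suc n) = ≈-refl

    toR-sign : ∀ i → toR i ≈ sgn (sign i) (fromℕ ℤ.∣ i ∣)
    toR-sign (+ n)      = ≈-refl
    toR-sign (-[1+ n ]) = ≈-refl

    sgn-* : ∀ s t x y → sgn (s Sign.* t) (x * y) ≈ sgn s x * sgn t y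
    sgn-* Sign.+ Sign.+ x y = ≈-refl
    sgn-* Sign.+ Sign.- x y = RingP.-‿distribʳ-* x y
    sgn-* Sign.- Sign.+ x y = RingP.-‿distribˡ-* x y
    sgn-* Sign.- Sign.- x y = begin
      x * y            ≈⟨ RingP.-‿involutive (x * y) ⟨
      - - (x * y)      ≈⟨ -‿cong (RingP.-‿distribʳ-* x y) ⟩
      - (x * - y)      ≈⟨ RingP.-‿distribˡ-* x (- y) ⟩
      - x * - y        ∎

    sgn-cong : ∀ s {x y} → x ≈ y → sgn s x ≈ sgn s y
    sgn-cong Sign.+ = λ p → p
    sgn-cong Sign.- = -‿cong

    -- Integer multiplication is given by signs and absolute values, so each factor is first written
    -- as a sign applied to a natural number.
    toR-* : ∀ i j → toR (i ℤ.* j) ≈ toR i * toR j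
    toR-* i j = begin
      toR ((sign i Sign.* sign j) ◃ (ℤ.∣ i ∣ ℕ.* ℤ.∣ j ∣))             ≈⟨ toR-◃ (sign i Sign.* sign j)
          (ℤ.∣ i ∣ ℕ.* ℤ.∣ j ∣) ⟩
      sgn (sign i Sign.* sign j) (fromℕ (ℤ.∣ i ∣ ℕ.* ℤ.∣ j ∣))         ≈⟨ sgn-cong (sign i Sign.* sign j)
          (fromℕ-* ℤ.∣ i ∣ ℤ.∣ j ∣) ⟩
      sgn (sign i Sign.* sign j) (fromℕ ℤ.∣ i ∣ * fromℕ ℤ.∣ j ∣)       ≈⟨ sgn-* (sign i) (sign j) (fromℕ ℤ.∣ i ∣)
          (fromℕ ℤ.∣ j ∣) ⟩
      sgn (sign i) (fromℕ ℤ.∣ i ∣) * sgn (sign j) (fromℕ ℤ.∣ j ∣)      ≈⟨ *-cong (toR-sign i) (toR-sign j) ⟨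
      toR i * toR j                                                ∎

    -- Interpreting 1 as 1# rather than 1# + 0# lets solver goals contain 1#.
    coefficient : ℤ → Carrier
    coefficient (+ 1) = 1#
    coefficient i     = toR i

    coefficient≈toR : ∀ i → coefficient i ≈ toR i
    coefficient≈toR (+ zero)          = ≈-refl
    coefficient≈toR (+ suc zero)      = ≈-sym fromℕ-1
    coefficient≈toR (+ suc (suc n))   = ≈-refl
    coefficient≈toR (-[1+ n ])        = ≈-refl

    ℤ-rawRing : RawRing 0ℓ 0ℓ
    ℤ-rawRing = record
      { Carrier = ℤ ; _≈_ = _≡_ ; _+_ = ℤ._+_ ; _*_ = ℤ._*_ ; -_ = ℤ.-_ ; 0# = + 0 ; 1# = + 1 }

    acr : AlmostCommutativeRing 0ℓ 0ℓ
    acr = fromCommutativeRing commutativeRing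

    ℤ-morphism : ℤ-rawRing -Raw-AlmostCommutative⟶ acr
    ℤ-morphism = record
      { ⟦_⟧    = coefficient
      ; +-homo = λ i j → ≈-trans (coefficient≈toR (i ℤ.+ j)) (≈-trans (toR-+ i j)
                   (≈-sym (+-cong (coefficient≈toR i) (coefficient≈toR j))))
      ; *-homo = λ i j → ≈-trans (coefficient≈toR (i ℤ.* j)) (≈-trans (toR-* i j)
                   (≈-sym (*-cong (coefficient≈toR i) (coefficient≈toR j))))
      ; -‿homo = λ i → ≈-trans (coefficient≈toR (ℤ.- i)) (≈-trans (toR-neg i)
                   (≈-sym (-‿cong (coefficient≈toR i))))
      ; 0-homo = ≈-refl
      ; 1-homo = ≈-refl
      }

    -- Coefficients are compared as integers, where equality computes; this is how sums and products
    -- of numerals are evaluated.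
    ℤ-weakly-decidable : ∀ i j → Maybe (coefficient i ≈ coefficient j)
    ℤ-weakly-decidable i j with i ℤ.≟ j
    ... | yes i≡j = just (reflexive (≡.cong coefficient i≡j))
    ... | no  _   = nothing

  open import Algebra.Solver.Ring ℤ-rawRing acr ℤ-morphism ℤ-weakly-decidable public using
      (solve; _:=_; _:+_; _:*_; _:-_; :-_; _:^_; con; Polynomial)

  infix 10 #_
  #_ : ∀ {n} → ℕ → Polynomial n
  # k = con (+ k)

-- Ordered-field inequalities, inverses and absolute values.

module OrderedField (R : RealNumbers) where

  open RingSolver R public

  open RealNumbers R public hiding (zero)

  infix 8 _²
  _² : Carrier → Carrier
  x ² = x * x

  2# : Carrier
  2# = fromℕ 2

  private
    strictTotalOrder : StrictTotalOrder 0ℓ 0ℓ 0ℓ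
    strictTotalOrder = record { isStrictTotalOrder = isStrictTotalOrder }

  import Relation.Binary.Properties.StrictTotalOrder strictTotalOrder as STO
  open import Relation.Binary.Reasoning.StrictPartialOrder (StrictTotalOrder.strictPartialOrder strictTotalOrder) public

  ≤-refl : ∀ {x} → x ≤ x
  ≤-refl = inj₂ ≈-refl

  ≤-reflexive : ∀ {x y} → x ≈ y → x ≤ y
  ≤-reflexive = inj₂

  <⇒≤ : ∀ {x y} → x < y → x ≤ y
  <⇒≤ = inj₁

  ≤-trans : ∀ {x y z} → x ≤ y → y ≤ z → x ≤ z
  ≤-trans = STO.trans

  ≤-antisym : ∀ {x y} → x ≤ y → y ≤ x → x ≈ y
  ≤-antisym = STO.antisym

  ≤-<-trans : ∀ {x y z} → x ≤ y → y < z → x < z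
  ≤-<-trans p q = begin-strict _ ≤⟨ p ⟩ _ <⟨ q ⟩ _ ∎

  <-≤-trans : ∀ {x y z} → x < y → y ≤ z → x < z
  <-≤-trans p q = begin-strict _ <⟨ p ⟩ _ ≤⟨ q ⟩ _ ∎

  ≤-resp-≈ : ∀ {x x′ y y′} → x ≈ x′ → y ≈ y′ → x ≤ y → x′ ≤ y′
  ≤-resp-≈ p q r = ≤-trans (≤-reflexive (≈-sym p)) (≤-trans r (≤-reflexive q))

  <-resp : ∀ {x x′ y y′} → x ≈ x′ → y ≈ y′ → x < y → x′ < y′
  <-resp p q r = ≤-<-trans (≤-reflexive (≈-sym p)) (<-≤-trans r (≤-reflexive q))

  ≤-or-> : ∀ x y → x ≤ y ⊎ y < x
  ≤-or-> x y with compare x y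
  ... | tri< x<y _ _ = inj₁ (inj₁ x<y)
  ... | tri≈ _ x≈y _ = inj₁ (inj₂ x≈y)
  ... | tri> _ _ y<x = inj₂ y<x

  ≤⇒≯ : ∀ {x y} → x ≤ y → ¬ (y < x)
  ≤⇒≯ x≤y y<x = irrefl ≈-refl (≤-<-trans x≤y y<x)

  ≮⇒≥ : ∀ {x y} → ¬ (x < y) → y ≤ x
  ≮⇒≥ {x} {y} x≮y with ≤-or-> y x
  ... | inj₁ y≤x = y≤x
  ... | inj₂ x<y = ⊥-elim (x≮y x<y)

  <⇒≉ : ∀ {x} → 0# < x → ¬ (x ≈ 0#)
  <⇒≉ 0<x x≈0 = irrefl (≈-sym x≈0) 0<x

  +-mono-< : ∀ {a b c d} → a < b → c ≤ d → a + c < b + d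
  +-mono-< {a} {b} {c} {d} a<b (inj₁ c<d) = begin-strict
    a + c   <⟨ +-monoˡ-< a b c a<b ⟩
    b + c   ≈⟨ +-comm b c ⟩
    c + b   <⟨ +-monoˡ-< c d b c<d ⟩
    d + b   ≈⟨ +-comm d b ⟩
    b + d   ∎
  +-mono-< {a} {b} {c} a<b (inj₂ c≈d) = <-≤-trans (+-monoˡ-< a b c a<b) (≤-reflexive (+-congˡ c≈d))

  +-mono-≤ : ∀ {a b c d} → a ≤ b → c ≤ d → a + c ≤ b + d
  +-mono-≤ (inj₁ a<b) c≤d        = <⇒≤ (+-mono-< a<b c≤d)
  +-mono-≤ (inj₂ a≈b) (inj₂ c≈d) = inj₂ (+-cong a≈b c≈d)
  +-mono-≤ {a} {b} {c} {d} (inj₂ a≈b) (inj₁ c<d) = <⇒≤ (<-resp (+-comm c a) (+-comm d b) (+-mono-< c<d (inj₂ a≈b)))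

  +-monoˡ-≤ : ∀ {a b} c → a ≤ b → a + c ≤ b + c
  +-monoˡ-≤ c p = +-mono-≤ p ≤-refl

  +-monoʳ-≤ : ∀ {a b} c → a ≤ b → c + a ≤ c + b
  +-monoʳ-≤ c p = +-mono-≤ ≤-refl p

  0≤+ : ∀ {a b} → 0# ≤ a → 0# ≤ b → 0# ≤ a + b
  0≤+ p q = ≤-trans (≤-reflexive (≈-sym (+-identityˡ 0#))) (+-mono-≤ p q)

  0<+ : ∀ {a b} → 0# < a → 0# ≤ b → 0# < a + b
  0<+ p q = ≤-<-trans (≤-reflexive (≈-sym (+-identityˡ 0#))) (+-mono-< p q)

  -- The form in which most polynomial inequalities below are checked: a nonnegative slack `c` is
  -- exhibited and the ring solver verifies `b ≈ a + c`.
  ≤-+ : ∀ {a b c} → 0# ≤ c → b ≈ a + c → a ≤ b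
  ≤-+ {a} {b} {c} 0≤c b≈a+c = begin
    a        ≈⟨ +-identityʳ a ⟨
    a + 0#   ≤⟨ +-monoʳ-≤ a 0≤c ⟩
    a + c    ≈⟨ b≈a+c ⟨
    b        ∎

  a≤a+b : ∀ {a b} → 0# ≤ b → a ≤ a + b
  a≤a+b 0≤b = ≤-+ 0≤b ≈-refl

  b≤a+b : ∀ {a b} → 0# ≤ a → b ≤ a + b
  b≤a+b {a} {b} 0≤a = ≤-+ 0≤a (+-comm a b)

  x≤y⇒0≤y-x : ∀ {x y} → x ≤ y → 0# ≤ y - x
  x≤y⇒0≤y-x {x} {y} p = ≤-trans (≤-reflexive (≈-sym (-‿inverseʳ x))) (+-monoˡ-≤ (- x) p)

  x<y⇒0<y-x : ∀ {x y} → x < y → 0# < y - x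
  x<y⇒0<y-x {x} {y} p = <-resp (-‿inverseʳ x) ≈-refl (+-monoˡ-< x y (- x) p)

  0≤y-x⇒x≤y : ∀ {x y} → 0# ≤ y - x → x ≤ y
  0≤y-x⇒x≤y {x} {y} p = ≤-+ p (solve 2 (λ x y → y := x :+ (y :- x)) ≈-refl x y)

  0<y-x⇒x<y : ∀ {x y} → 0# < y - x → x < y
  0<y-x⇒x<y {x} {y} p = <-resp (+-identityˡ x) (solve 2 (λ x y → y :- x :+ x := y) ≈-refl x y) (+-monoˡ-< 0# (y - x) x p)

  neg-mono-≤ : ∀ {x y} → x ≤ y → - y ≤ - x
  neg-mono-≤ {x} {y} p = 0≤y-x⇒x≤y (≤-resp-≈ ≈-refl
    (solve 2 (λ x y → y :- x := :- x :- :- y) ≈-refl x y) (x≤y⇒0≤y-x p))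

  -x≤0 : ∀ {x} → 0# ≤ x → - x ≤ 0#
  -x≤0 {x} p = ≤-resp-≈ ≈-refl (solve 0 (:- # 0 := # 0) ≈-refl) (neg-mono-≤ p)

  0≤-x : ∀ {x} → x ≤ 0# → 0# ≤ - x
  0≤-x {x} p = ≤-resp-≈ (solve 0 (:- # 0 := # 0) ≈-refl) ≈-refl (neg-mono-≤ p)

  0≤* : ∀ {a b} → 0# ≤ a → 0# ≤ b → 0# ≤ a * b
  0≤* {a} {b} (inj₁ p) (inj₁ q) = inj₁ (*-pos a b p q)
  0≤* {a} {b} (inj₂ p) _        = inj₂ (≈-trans (≈-sym (zeroˡ b)) (*-congʳ p))
  0≤* {a} {b} (inj₁ _) (inj₂ q) = inj₂ (≈-trans (≈-sym (zeroʳ a)) (*-congˡ q))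

  *-monoˡ-≤ : ∀ {a b} c → 0# ≤ c → a ≤ b → c * a ≤ c * b
  *-monoˡ-≤ {a} {b} c 0≤c a≤b = 0≤y-x⇒x≤y (≤-resp-≈ ≈-refl
    (solve 3 (λ a b c → c :* (b :- a) := c :* b :- c :* a) ≈-refl a b c) (0≤* 0≤c (x≤y⇒0≤y-x a≤b)))

  *-monoʳ-≤ : ∀ {a b} c → 0# ≤ c → a ≤ b → a * c ≤ b * c
  *-monoʳ-≤ {a} {b} c 0≤c a≤b = ≤-resp-≈ (*-comm c a) (*-comm c b) (*-monoˡ-≤ c 0≤c a≤b)

  *-mono-≤ : ∀ {a b c d} → 0# ≤ b → 0# ≤ c → a ≤ b → c ≤ d → a * c ≤ b * d
  *-mono-≤ {a} {b} {c} {d} 0≤b 0≤c a≤b c≤d = ≤-trans (*-monoʳ-≤ c 0≤c a≤b) (*-monoˡ-≤ b 0≤b c≤d)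

  *-monoˡ-< : ∀ {a b} c → 0# < c → a < b → c * a < c * b
  *-monoˡ-< {a} {b} c 0<c a<b = 0<y-x⇒x<y (<-resp ≈-refl
    (solve 3 (λ a b c → c :* (b :- a) := c :* b :- c :* a) ≈-refl a b c) (*-pos c (b - a) 0<c (x<y⇒0<y-x a<b)))

  *-cancelˡ-≤ : ∀ {a b} c → 0# < c → c * a ≤ c * b → a ≤ b
  *-cancelˡ-≤ {a} {b} c 0<c ca≤cb with ≤-or-> a b
  ... | inj₁ a≤b = a≤b
  ... | inj₂ b<a = ⊥-elim (≤⇒≯ ca≤cb (*-monoˡ-< c 0<c b<a))

  ²-nonneg : ∀ x → 0# ≤ x ²
  ²-nonneg x with ≤-or-> 0# x
  ... | inj₁ 0≤x = 0≤* 0≤x 0≤x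
  ... | inj₂ x<0 = ≤-resp-≈ ≈-refl (solve 1 (λ x → :- x :* :- x := x :* x) ≈-refl x) (0≤* 0≤-x′ 0≤-x′)
    where 0≤-x′ = 0≤-x (<⇒≤ x<0)

  0≤1 : 0# ≤ 1#
  0≤1 = <⇒≤ 0<1

  0≤fromℕ : ∀ n → 0# ≤ fromℕ n
  0≤fromℕ zero    = ≤-refl
  0≤fromℕ (suc n) = 0≤+ 0≤1 (0≤fromℕ n)

  0<fromℕ : ∀ n .{{_ : ℕ.NonZero n}} → 0# < fromℕ n
  0<fromℕ (suc n) = 0<+ 0<1 (0≤fromℕ n)

  fromℕ-mono-≤ : ∀ {m n} → m ℕ.≤ n → fromℕ m ≤ fromℕ n
  fromℕ-mono-≤ {n = n} ℕ.z≤n   = 0≤fromℕ n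
  fromℕ-mono-≤ (ℕ.s≤s m≤n)     = +-monoʳ-≤ 1# (fromℕ-mono-≤ m≤n)

  fromℕ-mono-< : ∀ {m n} → m ℕ.< n → fromℕ m < fromℕ n
  fromℕ-mono-< {m} m<n = <-≤-trans
    (<-resp (+-identityˡ (fromℕ m)) ≈-refl (+-monoˡ-< 0# 1# (fromℕ m) 0<1)) (fromℕ-mono-≤ m<n)

  *-inverseˡ : ∀ {x} → 0# < x → x ⁻¹ * x ≈ 1#
  *-inverseˡ {x} 0<x = ≈-trans (*-comm (x ⁻¹) x) (*-inverseʳ x (<⇒≉ 0<x))

  0<⁻¹ : ∀ {x} → 0# < x → 0# < x ⁻¹
  0<⁻¹ {x} 0<x with ≤-or-> (x ⁻¹) 0#
  ... | inj₂ p = p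
  ... | inj₁ p = ⊥-elim (≤⇒≯ 1≤0 0<1)
    where
    1≤0 : 1# ≤ 0#
    1≤0 = begin
      1#          ≈⟨ *-inverseʳ x (<⇒≉ 0<x) ⟨
      x * x ⁻¹    ≤⟨ *-monoˡ-≤ x (<⇒≤ 0<x) p ⟩
      x * 0#      ≈⟨ zeroʳ x ⟩
      0#          ∎

  ½ : Carrier
  ½ = 2# ⁻¹

  0<2 : 0# < 2#
  0<2 = 0<fromℕ 2

  0<½ : 0# < ½
  0<½ = 0<⁻¹ 0<2

  x≈½x+½x : ∀ x → x ≈ ½ * x + ½ * x
  x≈½x+½x x = begin-equality
    x                  ≈⟨ *-identityˡ x ⟨
    1# * x             ≈⟨ *-congʳ (*-inverseˡ 0<2) ⟨
    ½ * 2# * x         ≈⟨ solve 2 (λ h x → h :* # 2 :* x := h :* x :+ h :* x) ≈-refl ½ x ⟩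
    ½ * x + ½ * x      ∎

  -- `abs` branches on a Boolean test; later proofs use this case distinction in place of the
  -- definition.
  abs-split : ∀ x → (0# ≤ x × abs x ≈ x) ⊎ (x < 0# × abs x ≈ - x)
  abs-split x with x <? 0#
  ... | yes x<0 = inj₂ (x<0 , ≈-refl)
  ... | no  x≮0 = inj₁ (≮⇒≥ x≮0 , ≈-refl)

  0≤abs : ∀ x → 0# ≤ abs x
  0≤abs x with abs-split x
  ... | inj₁ (0≤x , e) = ≤-trans 0≤x (≤-reflexive (≈-sym e))
  ... | inj₂ (x<0 , e) = ≤-trans (0≤-x (<⇒≤ x<0)) (≤-reflexive (≈-sym e))

  x≤abs : ∀ x → x ≤ abs x
  x≤abs x with abs-split x
  ... | inj₁ (0≤x , e) = ≤-reflexive (≈-sym e)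
  ... | inj₂ (x<0 , e) = ≤-trans (<⇒≤ x<0) (0≤abs x)

  -x≤abs : ∀ x → - x ≤ abs x
  -x≤abs x with abs-split x
  ... | inj₁ (0≤x , e) = ≤-trans (-x≤0 0≤x) (0≤abs x)
  ... | inj₂ (x<0 , e) = ≤-reflexive (≈-sym e)

  abs-≤ : ∀ {x b} → x ≤ b → - x ≤ b → abs x ≤ b
  abs-≤ {x} p q with abs-split x
  ... | inj₁ (_ , e) = ≤-trans (≤-reflexive e) p
  ... | inj₂ (_ , e) = ≤-trans (≤-reflexive e) q

  abs-nonneg : ∀ {x} → 0# ≤ x → abs x ≈ x
  abs-nonneg {x} 0≤x = ≤-antisym (abs-≤ ≤-refl (≤-trans (-x≤0 0≤x) 0≤x)) (x≤abs x)

  abs-cong : ∀ {x y} → x ≈ y → abs x ≈ abs y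
  abs-cong x≈y = ≤-antisym (le x≈y) (le (≈-sym x≈y))
    where
    le : ∀ {x y} → x ≈ y → abs x ≤ abs y
    le {x} {y} e = abs-≤ (≤-trans (≤-reflexive e) (x≤abs y)) (≤-trans (≤-reflexive (-‿cong e)) (-x≤abs y))

  abs-neg : ∀ x → abs (- x) ≈ abs x
  abs-neg x = ≤-antisym
    (abs-≤ (-x≤abs x) (≤-trans (≤-reflexive (solve 1 (λ x → :- :- x := x) ≈-refl x)) (x≤abs x)))
    (abs-≤ (≤-trans (≤-reflexive (solve 1 (λ x → x := :- :- x) ≈-refl x)) (-x≤abs (- x))) (x≤abs (- x)))

  abs-swap : ∀ x y → abs (x - y) ≈ abs (y - x)
  abs-swap x y = ≈-trans (abs-cong (solve 2 (λ x y → x :- y := :- (y :- x)) ≈-refl x y)) (abs-neg (y - x))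

  abs-+ : ∀ x y → abs (x + y) ≤ abs x + abs y
  abs-+ x y = abs-≤ (+-mono-≤ (x≤abs x) (x≤abs y))
    (≤-trans (≤-reflexive (solve 2 (λ x y → :- (x :+ y) := :- x :+ :- y) ≈-refl x y)) (+-mono-≤ (-x≤abs x) (-x≤abs y)))

  abs-* : ∀ x y → abs (x * y) ≈ abs x * abs y
  abs-* x y with abs-split x | abs-split y
  ... | inj₁ (p , e) | inj₁ (q , f) = ≈-trans (abs-nonneg (0≤* p q)) (*-cong (≈-sym e) (≈-sym f))
  ... | inj₁ (p , e) | inj₂ (q , f) = begin-equality
    abs (x * y)        ≈⟨ abs-neg (x * y) ⟨
    abs (- (x * y))    ≈⟨ abs-cong (solve 2 (λ x y → :- (x :* y) := x :* :- y) ≈-refl x y) ⟩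
    abs (x * - y)      ≈⟨ abs-nonneg (0≤* p (0≤-x (<⇒≤ q))) ⟩
    x * - y            ≈⟨ *-cong e f ⟨
    abs x * abs y      ∎
  ... | inj₂ (p , e) | inj₁ (q , f) = begin-equality
    abs (x * y)        ≈⟨ abs-neg (x * y) ⟨
    abs (- (x * y))    ≈⟨ abs-cong (solve 2 (λ x y → :- (x :* y) := :- x :* y) ≈-refl x y) ⟩
    abs (- x * y)      ≈⟨ abs-nonneg (0≤* (0≤-x (<⇒≤ p)) q) ⟩
    - x * y            ≈⟨ *-cong e f ⟨
    abs x * abs y      ∎
  ... | inj₂ (p , e) | inj₂ (q , f) = begin-equality
    abs (x * y)        ≈⟨ abs-cong (solve 2 (λ x y → x :* y := :- x :* :- y) ≈-refl x y) ⟩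
    abs (- x * - y)    ≈⟨ abs-nonneg (0≤* (0≤-x (<⇒≤ p)) (0≤-x (<⇒≤ q))) ⟩
    - x * - y          ≈⟨ *-cong e f ⟨
    abs x * abs y      ∎

  abs-² : ∀ x → abs x ² ≈ x ²
  abs-² x = ≈-trans (≈-sym (abs-* x x)) (abs-nonneg (²-nonneg x))

  ²-mono-≤ : ∀ {a b} → 0# ≤ a → a ≤ b → a ² ≤ b ²
  ²-mono-≤ 0≤a a≤b = *-mono-≤ (≤-trans 0≤a a≤b) 0≤a a≤b a≤b

  ²-cancel-< : ∀ {a b} → 0# ≤ b → a ² < b ² → a < b
  ²-cancel-< {a} {b} 0≤b p with ≤-or-> b a
  ... | inj₂ a<b = a<b
  ... | inj₁ b≤a = ⊥-elim (≤⇒≯ (²-mono-≤ 0≤b b≤a) p)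

  -- Squaring the difference: (a + b)² + (a - b)² = 2 (a² + b²).
  [a+b]²≤2[a²+b²] : ∀ a b → (a + b) ² ≤ 2# * (a ² + b ²)
  [a+b]²≤2[a²+b²] a b = ≤-+ (²-nonneg (a - b))
    (solve 2 (λ a b → # 2 :* (a :* a :+ b :* b) := (a :+ b) :* (a :+ b) :+ (a :- b) :* (a :- b)) ≈-refl a b)

-- Consequences of completeness: Archimedean property, boundedness, mean value inequality.

module Analysis (em : ExcludedMiddle 0ℓ) (R : RealNumbers) where

  open OrderedField R

  -- If no such point existed, `s - δ` would be an upper bound below the least one; excluded middle
  -- turns this contradiction into a point.
  sup-approach : (A : Carrier → Set) (s : Carrier) → (∀ b → b IsUpperBoundOf A → s ≤ b) →
                 ∀ δ → 0# < δ → ∃[ x ] A x × s - x < δ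
  sup-approach A s least δ 0<δ with em {∃[ x ] A x × s - x < δ}
  ... | yes found = found
  ... | no  none  = ⊥-elim (≤⇒≯ (least (s - δ) bound) s-δ<s)
    where
    bound : (s - δ) IsUpperBoundOf A
    bound x Ax with ≤-or-> x (s - δ)
    ... | inj₁ x≤s-δ = x≤s-δ
    ... | inj₂ s-δ<x = ⊥-elim (none (x , Ax , 0<y-x⇒x<y (<-resp ≈-refl
      (solve 3 (λ s x δ → x :- (s :- δ) := δ :- (s :- x)) ≈-refl s x δ) (x<y⇒0<y-x s-δ<x))))
    s-δ<s : s - δ < s
    s-δ<s = 0<y-x⇒x<y (<-resp ≈-refl (solve 2 (λ s δ → δ := s :- (s :- δ)) ≈-refl s δ) 0<δ)

  -- Bounded naturals would have a supremum; some natural lies within 1 of it, and the successor of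
  -- that natural exceeds it.
  archimedean : ∀ x → ∃[ n ] x < fromℕ n
  archimedean x with em {∃[ n ] x < fromℕ n}
  ... | yes found = found
  ... | no  none  = ⊥-elim (≤⇒≯ (isUpper (fromℕ (suc (proj₁ near))) (suc (proj₁ near) , ≈-refl)) s<suc)
    where
    IsNatural : Carrier → Set
    IsNatural y = ∃[ n ] y ≈ fromℕ n
    sup = supremum IsNatural (0# , 0 , ≈-refl)
      (x , λ y (n , y≈n) → ≤-trans (≤-reflexive y≈n) (≮⇒≥ (λ x<n → none (n , x<n))))
    s       = proj₁ sup
    isUpper = proj₁ (proj₂ sup)
    approached : ∃[ y ] IsNatural y × s - y < 1#
    approached = sup-approach IsNatural s (proj₂ (proj₂ sup)) 1# 0<1
    near : IsNatural (proj₁ approached)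
    near = proj₁ (proj₂ approached)
    s<suc : s < fromℕ (suc (proj₁ near))
    s<suc = 0<y-x⇒x<y (<-resp ≈-refl
      (≈-trans (+-congˡ (-‿cong (+-congˡ (-‿cong (proj₂ near)))))
        (solve 2 (λ s n → # 1 :- (s :- n) := (# 1 :+ n) :- s) ≈-refl s (fromℕ (proj₁ near))))
      (x<y⇒0<y-x (proj₂ (proj₂ approached))))

  -- Compactness of [a , b] in a form that avoids covers.
  interval-induction :
    (P : Carrier → Carrier → Set) → (∀ {x y z} → P x y → P y z → P x z) →
    ∀ {a b} → a ≤ b →
    (∀ u → a ≤ u → u ≤ b → ∃[ δ ] 0# < δ ×
      (∀ x y → a ≤ x → x ≤ u → u ≤ y → y ≤ b → u - x < δ → y - u < δ → P x y)) →
    P a b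
  interval-induction P P-trans {a} {b} a≤b local = conclude
    where
    A : Carrier → Set
    A s = a ≤ s × s ≤ b × P a s

    A-a : A a
    A-a with local a ≤-refl a≤b
    ... | δ , 0<δ , near = ≤-refl , a≤b , near a a ≤-refl ≤-refl ≤-refl a≤b a-a<δ a-a<δ
      where a-a<δ = ≤-<-trans (≤-reflexive (-‿inverseʳ a)) 0<δ

    sup : ∃[ s ] s IsUpperBoundOf A × (∀ c → c IsUpperBoundOf A → s ≤ c)
    sup = supremum A (a , A-a) (b , λ _ As → proj₁ (proj₂ As))

    s : Carrier
    s = proj₁ sup

    a≤s : a ≤ s
    a≤s = proj₁ (proj₂ sup) a A-a

    s≤b : s ≤ b
    s≤b = proj₂ (proj₂ sup) b (λ _ As → proj₁ (proj₂ As))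

    conclude : P a b
    conclude with local s a≤s s≤b
    ... | δ , 0<δ , near with sup-approach A s (proj₂ (proj₂ sup)) δ 0<δ
    -- Either `b` lies within δ of the supremum and one local step reaches it, or `s + ½ * δ` would
    -- belong to `A` and exceed the supremum.
    ... | x , (a≤x , x≤b , Pax) , s-x<δ with ≤-or-> δ (b - s)
    ... | inj₂ b-s<δ = P-trans Pax
            (near x b a≤x (proj₁ (proj₂ sup) x (a≤x , x≤b , Pax)) s≤b ≤-refl s-x<δ b-s<δ)
    ... | inj₁ δ≤b-s = ⊥-elim (≤⇒≯ (proj₁ (proj₂ sup) y (a≤y , y≤b , P-trans Pax Pxy)) s<y)
      where
      y = s + ½ * δ
      0<½δ = *-pos ½ δ 0<½ 0<δ
      ½δ<δ : ½ * δ < δ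
      ½δ<δ = <-resp (+-identityˡ (½ * δ)) (≈-sym (x≈½x+½x δ)) (+-monoˡ-< 0# (½ * δ) (½ * δ) 0<½δ)
      s<y : s < y
      s<y = 0<y-x⇒x<y (<-resp ≈-refl (solve 2 (λ s d → d := s :+ d :- s) ≈-refl s (½ * δ)) 0<½δ)
      y≤b : y ≤ b
      y≤b = ≤-trans (+-monoʳ-≤ s (≤-trans (<⇒≤ ½δ<δ) δ≤b-s))
        (≤-reflexive (solve 2 (λ s b → s :+ (b :- s) := b) ≈-refl s b))
      a≤y = ≤-trans a≤s (<⇒≤ s<y)
      Pxy : P x y
      Pxy = near x y a≤x (proj₁ (proj₂ sup) x (a≤x , x≤b , Pax)) (<⇒≤ s<y) y≤b s-x<δ
        (<-resp (solve 2 (λ s d → d := s :+ d :- s) ≈-refl s (½ * δ)) ≈-refl ½δ<δ)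

  ≤-limit : ∀ {a b c} → 0# ≤ c → (∀ ε → 0# < ε → a ≤ b + ε * c) → a ≤ b
  ≤-limit {a} {b} {c} 0≤c bound with ≤-or-> a b
  ... | inj₁ a≤b = a≤b
  ... | inj₂ b<a = ⊥-elim (≤⇒≯ (bound ε 0<ε) b+εc<a)
    where
    0<1+c = 0<+ 0<1 0≤c
    0<a-b = x<y⇒0<y-x b<a
    -- Chosen so that ε + ε c = a - b. Then b + ε c = a - ε lies below `a`, also when `c` is zero.
    ε = (a - b) * (1# + c) ⁻¹
    0<ε = *-pos _ _ 0<a-b (0<⁻¹ 0<1+c)
    b+εc<a : b + ε * c < a
    b+εc<a = begin-strict
      b + ε * c                                    ≈⟨ +-identityˡ _ ⟨
      0# + (b + ε * c)                             <⟨ +-monoˡ-< 0# ε _ 0<ε ⟩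
      ε + (b + ε * c)                              ≈⟨ solve 4 (λ a b c i → (a :- b) :* i :+ (b :+ (a :- b) :* i :* c) :=
                                                        b :+ (a :- b) :* (i :* (# 1 :+ c))) ≈-refl a b c ((1# + c) ⁻¹) ⟩
      b + (a - b) * ((1# + c) ⁻¹ * (1# + c))       ≈⟨ +-congˡ (*-congˡ (*-inverseˡ 0<1+c)) ⟩
      b + (a - b) * 1#                             ≈⟨ solve 2 (λ a b → b :+ (a :- b) :* # 1 := a) ≈-refl a b ⟩
      a                                            ∎

  [_,_] : Carrier → Carrier → Carrier → Set
  [ a , b ] t = a ≤ t × t ≤ b

  module _ {D : Carrier → Set} {f F : Carrier → Carrier} (f′ : HasDerivativeOn D f F)
           {a b : Carrier} (a≤b : a ≤ b) (inD : ∀ u → [ a , b ] u → D u) where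

    private
      between : ∀ {x u y} → a ≤ x → x ≤ u → u ≤ y → y ≤ b → D x × D y
      between a≤x x≤u u≤y y≤b =
        inD _ (a≤x , ≤-trans x≤u (≤-trans u≤y y≤b)) , inD _ (≤-trans a≤x (≤-trans x≤u u≤y) , y≤b)

    -- Differentiability with error 1 gives a bound near each point, and interval induction makes it
    -- global. The sum of two nonnegative bounds serves as their maximum.
    bounded : ∃[ M ] 0# ≤ M × (∀ t → [ a , b ] t → abs (f t) ≤ M)
    bounded = interval-induction Bounded joined a≤b local
      where
      Bounded : Carrier → Carrier → Set
      Bounded x y = ∃[ M ] 0# ≤ M × (∀ t → [ x , y ] t → abs (f t) ≤ M)
      joined : ∀ {x y z} → Bounded x y → Bounded y z → Bounded x z
      joined {x} {y} {z} (M , 0≤M , p) (N , 0≤N , q) = M + N , 0≤+ 0≤M 0≤N , both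
        where
        both : ∀ t → [ x , z ] t → abs (f t) ≤ M + N
        both t (x≤t , t≤z) with ≤-or-> t y
        ... | inj₁ t≤y = ≤-trans (p t (x≤t , t≤y)) (a≤a+b 0≤N)
        ... | inj₂ y<t = ≤-trans (q t (<⇒≤ y<t , t≤z)) (b≤a+b 0≤M)
      local : ∀ u → a ≤ u → u ≤ b → ∃[ δ ] 0# < δ ×
        (∀ x y → a ≤ x → x ≤ u → u ≤ y → y ≤ b → u - x < δ → y - u < δ → Bounded x y)
      local u a≤u u≤b with f′ u (inD u (a≤u , u≤b)) 1# 0<1
      ... | δ , 0<δ , near = δ , 0<δ , λ x y a≤x x≤u u≤y y≤b u-x<δ y-u<δ →
          M , 0≤M , λ t (x≤t , t≤y) → bound t (inD t (≤-trans a≤x x≤t , ≤-trans t≤y y≤b))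
            (close x≤t t≤y u-x<δ y-u<δ)
        where
        M = abs (f u) + (1# + abs (F u)) * δ
        0≤1+∣F∣ = 0≤+ 0≤1 (0≤abs (F u))
        0≤M = 0≤+ (0≤abs (f u)) (0≤* 0≤1+∣F∣ (<⇒≤ 0<δ))
        close : ∀ {x y t} → x ≤ t → t ≤ y → u - x < δ → y - u < δ → abs (t - u) < δ
        close {x} {y} {t} x≤t t≤y u-x<δ y-u<δ with abs-split (t - u)
        ... | inj₁ (_ , e) = ≤-<-trans (≤-trans (≤-reflexive e) (+-monoˡ-≤ (- u) t≤y)) y-u<δ
        ... | inj₂ (_ , e) = ≤-<-trans (≤-trans (≤-reflexive (≈-trans e
                (solve 2 (λ t u → :- (t :- u) := u :- t) ≈-refl t u))) (+-monoʳ-≤ u (neg-mono-≤ x≤t))) u-x<δ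
        bound : ∀ t → D t → abs (t - u) < δ → abs (f t) ≤ M
        bound t Dt t-u<δ = begin
          abs (f t)
            ≈⟨ abs-cong (solve 4 (λ ft fu l d → ft := fu :+ ((ft :- fu :- l :* d) :+ l :* d)) ≈-refl (f t) (f u)
                (F u) (t - u)) ⟩
          abs (f u + ((f t - f u - F u * (t - u)) + F u * (t - u)))
            ≤⟨ ≤-trans (abs-+ _ _) (+-monoʳ-≤ _ (abs-+ _ _)) ⟩
          abs (f u) + (abs (f t - f u - F u * (t - u)) + abs (F u * (t - u)))
            ≤⟨ +-monoʳ-≤ _ (+-mono-≤ (near t Dt t-u<δ) (≤-reflexive (abs-* (F u) (t - u)))) ⟩
          abs (f u) + (1# * abs (t - u) + abs (F u) * abs (t - u))
            ≈⟨ +-congˡ (distribʳ _ _ _) ⟨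
          abs (f u) + (1# + abs (F u)) * abs (t - u)
            ≤⟨ +-monoʳ-≤ _ (*-monoˡ-≤ _ 0≤1+∣F∣ (<⇒≤ t-u<δ)) ⟩
          M ∎

    -- No intermediate point is sought. The estimate with slope `K + ε` is additive over adjacent
    -- intervals, and it holds for short intervals straddling a point `u`, because both ends can be
    -- compared with the tangent at `u`. Interval induction gives it on the whole interval, and ε is
    -- arbitrary.
    mean-value-≤ : ∀ l K → (∀ u → [ a , b ] u → abs (F u - l) ≤ K) →
                   abs (f b - f a - l * (b - a)) ≤ K * (b - a)
    mean-value-≤ l K F≈l = ≤-limit (x≤y⇒0≤y-x a≤b) λ ε 0<ε →
      ≤-trans (approximate ε 0<ε) (≤-reflexive (distribʳ _ _ _))
      where
      approximate : ∀ ε → 0# < ε → abs (f b - f a - l * (b - a)) ≤ (K + ε) * (b - a)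
      approximate ε 0<ε = interval-induction P P-trans a≤b local
        where
        P : Carrier → Carrier → Set
        P x y = abs (f y - f x - l * (y - x)) ≤ (K + ε) * (y - x)
        P-trans : ∀ {x y z} → P x y → P y z → P x z
        P-trans {x} {y} {z} p q = begin
          abs (f z - f x - l * (z - x))
            ≈⟨ abs-cong (solve 7 (λ fx fy fz l x y z → fz :- fx :- l :* (z :- x) :=
                 (fy :- fx :- l :* (y :- x)) :+ (fz :- fy :- l :* (z :- y))) ≈-refl (f x) (f y) (f z) l x y z) ⟩
          abs ((f y - f x - l * (y - x)) + (f z - f y - l * (z - y)))
            ≤⟨ ≤-trans (abs-+ _ _) (+-mono-≤ p q) ⟩
          (K + ε) * (y - x) + (K + ε) * (z - y)
            ≈⟨ solve 4 (λ k x y z → k :* (y :- x) :+ k :* (z :- y) := k :* (z :- x)) ≈-refl (K + ε) x y z ⟩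
          (K + ε) * (z - x) ∎
        local : ∀ u → a ≤ u → u ≤ b → ∃[ δ ] 0# < δ ×
          (∀ x y → a ≤ x → x ≤ u → u ≤ y → y ≤ b → u - x < δ → y - u < δ → P x y)
        local u a≤u u≤b with f′ u (inD u (a≤u , u≤b)) ε 0<ε
        ... | δ , 0<δ , near = δ , 0<δ , around
          where
          e : Carrier → Carrier
          e z = f z - f u - F u * (z - u)
          around : ∀ x y → a ≤ x → x ≤ u → u ≤ y → y ≤ b → u - x < δ → y - u < δ → P x y
          around x y a≤x x≤u u≤y y≤b u-x<δ y-u<δ = begin
            abs (f y - f x - l * (y - x))
              ≈⟨ abs-cong (solve 8 (λ fx fy fu c l x y u → fy :- fx :- l :* (y :- x) :=
                   (fy :- fu :- c :* (y :- u)) :+ (:- (fx :- fu :- c :* (x :- u)) :+ (c :- l) :* (y :- x)))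
                   ≈-refl (f x) (f y) (f u) (F u) l x y u) ⟩
            abs (e y + (- e x + (F u - l) * (y - x)))
              ≤⟨ ≤-trans (abs-+ _ _) (+-monoʳ-≤ _ (abs-+ _ _)) ⟩
            abs (e y) + (abs (- e x) + abs ((F u - l) * (y - x)))
              ≤⟨ +-mono-≤ (near y Dy (≤-<-trans (≤-reflexive ∣y-u∣) y-u<δ)) (+-mono-≤
                   (≤-trans (≤-reflexive (abs-neg (e x))) (near x Dx (≤-<-trans (≤-reflexive ∣x-u∣) u-x<δ)))
                   (≤-trans (≤-reflexive (≈-trans (abs-* _ _) (*-congˡ (abs-nonneg 0≤y-x)))) (*-monoʳ-≤ _ 0≤y-x
                       (F≈l u (a≤u , u≤b))))) ⟩
            -- Since x ≤ u ≤ y, the two tangent errors add up to exactly ε (y - x).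
            ε * abs (y - u) + (ε * abs (x - u) + K * (y - x))
              ≈⟨ +-cong (*-congˡ ∣y-u∣) (+-congʳ (*-congˡ ∣x-u∣)) ⟩
            ε * (y - u) + (ε * (u - x) + K * (y - x))
              ≈⟨ solve 5 (λ ε k x y u → ε :* (y :- u) :+ (ε :* (u :- x) :+ k :* (y :- x)) := (k :+ ε) :*
                  (y :- x)) ≈-refl ε K x y u ⟩
            (K + ε) * (y - x) ∎
            where
            Dx = proj₁ (between a≤x x≤u u≤y y≤b)
            Dy = proj₂ (between a≤x x≤u u≤y y≤b)
            ∣y-u∣ = abs-nonneg (x≤y⇒0≤y-x u≤y)
            ∣x-u∣ = ≈-trans (abs-swap x u) (abs-nonneg (x≤y⇒0≤y-x x≤u))
            0≤y-x = x≤y⇒0≤y-x (≤-trans x≤u u≤y)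

-- Finite sums and averages over lists.

module Sums (R : RealNumbers) where

  open OrderedField R

  private variable
    A B C : Set

  ⟦_⟧ : Bool → Carrier
  ⟦ true  ⟧ = 1#
  ⟦ false ⟧ = 0#

  0≤⟦⟧ : ∀ b → 0# ≤ ⟦ b ⟧
  0≤⟦⟧ true  = 0≤1
  0≤⟦⟧ false = ≤-refl

  ⟦⟧≤1 : ∀ b → ⟦ b ⟧ ≤ 1#
  ⟦⟧≤1 true  = ≤-refl
  ⟦⟧≤1 false = 0≤1

  ∑ : List A → (A → Carrier) → Carrier
  ∑ []       f = 0#
  ∑ (x ∷ xs) f = f x + ∑ xs f

  ∑-cong-∈ : ∀ (xs : List A) {f g} → (∀ {x} → x ∈ xs → f x ≈ g x) → ∑ xs f ≈ ∑ xs g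
  ∑-cong-∈ []       p = ≈-refl
  ∑-cong-∈ (x ∷ xs) p = +-cong (p (here refl)) (∑-cong-∈ xs (λ i → p (there i)))

  ∑-cong : ∀ (xs : List A) {f g} → (∀ x → f x ≈ g x) → ∑ xs f ≈ ∑ xs g
  ∑-cong xs p = ∑-cong-∈ xs (λ {x} _ → p x)

  ∑-mono-∈ : ∀ (xs : List A) {f g} → (∀ {x} → x ∈ xs → f x ≤ g x) → ∑ xs f ≤ ∑ xs g
  ∑-mono-∈ []       p = ≤-refl
  ∑-mono-∈ (x ∷ xs) p = +-mono-≤ (p (here refl)) (∑-mono-∈ xs (λ i → p (there i)))

  ∑-0 : ∀ (xs : List A) → ∑ xs (λ _ → 0#) ≈ 0#
  ∑-0 []       = ≈-refl
  ∑-0 (x ∷ xs) = ≈-trans (+-identityˡ _) (∑-0 xs)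

  ∑-+ : ∀ (xs : List A) f g → ∑ xs (λ x → f x + g x) ≈ ∑ xs f + ∑ xs g
  ∑-+ []       f g = ≈-sym (+-identityˡ 0#)
  ∑-+ (x ∷ xs) f g = ≈-trans (+-congˡ (∑-+ xs f g))
    (solve 4 (λ a b c d → a :+ b :+ (c :+ d) := a :+ c :+ (b :+ d)) ≈-refl (f x) (g x) (∑ xs f) (∑ xs g))

  ∑-* : ∀ (xs : List A) c f → ∑ xs (λ x → c * f x) ≈ c * ∑ xs f
  ∑-* []       c f = ≈-sym (zeroʳ c)
  ∑-* (x ∷ xs) c f = ≈-trans (+-congˡ (∑-* xs c f)) (≈-sym (distribˡ c (f x) (∑ xs f)))

  ∑-const : ∀ (xs : List A) c → ∑ xs (λ _ → c) ≈ fromℕ (length xs) * c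
  ∑-const []       c = ≈-sym (zeroˡ c)
  ∑-const (x ∷ xs) c = ≈-trans (+-congˡ (∑-const xs c))
    (solve 2 (λ c n → c :+ n :* c := (# 1 :+ n) :* c) ≈-refl c (fromℕ (length xs)))

  ∑-++ : ∀ (xs ys : List A) f → ∑ (xs ++ ys) f ≈ ∑ xs f + ∑ ys f
  ∑-++ []       ys f = ≈-sym (+-identityˡ _)
  ∑-++ (x ∷ xs) ys f = ≈-trans (+-congˡ (∑-++ xs ys f)) (≈-sym (+-assoc _ _ _))

  ∑-map : ∀ (g : A → B) xs f → ∑ (map g xs) f ≈ ∑ xs (λ x → f (g x))
  ∑-map g []       f = ≈-refl
  ∑-map g (x ∷ xs) f = +-congˡ (∑-map g xs f)

  ∑-cartesianProductWith : ∀ (g : A → B → C) xs ys f →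
    ∑ (cartesianProductWith g xs ys) f ≈ ∑ xs (λ x → ∑ ys (λ y → f (g x y)))
  ∑-cartesianProductWith g []       ys f = ≈-refl
  ∑-cartesianProductWith g (x ∷ xs) ys f = ≈-trans (∑-++ (map (g x) ys) _ f)
    (+-cong (∑-map (g x) ys f) (∑-cartesianProductWith g xs ys f))

  ∑-swap : ∀ (xs : List A) (ys : List B) (f : A → B → Carrier) → ∑ xs (λ x → ∑ ys (f x)) ≈ ∑ ys (λ y → ∑ xs (λ x → f x y))
  ∑-swap []       ys f = ≈-sym (∑-0 ys)
  ∑-swap (x ∷ xs) ys f = ≈-trans (+-congˡ (∑-swap xs ys f)) (≈-sym (∑-+ ys (f x) _))

  ∑-filter : ∀ {P : Pred A 0ℓ} (P? : Decidable P) xs f →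
    ∑ (filter P? xs) f ≈ ∑ xs (λ x → ⟦ does (P? x) ⟧ * f x)
  ∑-filter P? []       f = ≈-refl
  ∑-filter P? (x ∷ xs) f with does (P? x)
  ... | true  = +-cong (≈-sym (*-identityˡ (f x))) (∑-filter P? xs f)
  ... | false = ≈-trans (∑-filter P? xs f) (≈-sym (≈-trans (+-congʳ (zeroˡ (f x))) (+-identityˡ _)))

  ∑-nonneg : ∀ (xs : List A) {f} → (∀ x → 0# ≤ f x) → 0# ≤ ∑ xs f
  ∑-nonneg []       p = ≤-refl
  ∑-nonneg (x ∷ xs) p = 0≤+ (p x) (∑-nonneg xs p)

  term≤∑ : ∀ {xs : List A} {x f} → (∀ y → 0# ≤ f y) → x ∈ xs → f x ≤ ∑ xs f
  term≤∑ {xs = _ ∷ xs} p (here refl) = a≤a+b (∑-nonneg xs p)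
  term≤∑ {xs = y ∷ _}  p (there i)   = ≤-trans (term≤∑ p i) (b≤a+b (p y))

  ∑-single : ∀ {xs : List A} {y f} → Unique xs → y ∈ xs → (∀ {x} → x ∈ xs → x ≢ y → f x ≈ 0#) → ∑ xs f ≈ f y
  ∑-single {xs = y ∷ xs} {f = f} (y∉xs ∷ _) (here refl) p = begin-equality
    f y + ∑ xs f             ≈⟨ +-congˡ (∑-cong-∈ xs (λ i → p (there i) (λ { refl → All.lookup y∉xs i refl }))) ⟩
    f y + ∑ xs (λ _ → 0#)    ≈⟨ ≈-trans (+-congˡ (∑-0 xs)) (+-identityʳ (f y)) ⟩
    f y                      ∎
  ∑-single {xs = z ∷ xs} {y} {f} (z∉xs ∷ uxs) (there i) p = begin-equality
    f z + ∑ xs f    ≈⟨ +-cong (p (here refl) (All.lookup z∉xs i)) (∑-single uxs i (λ j → p (there j))) ⟩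
    0# + f y        ≈⟨ +-identityˡ (f y) ⟩
    f y             ∎

  -- The expectation under the uniform distribution. On the empty list it is 0 whatever the
  -- unspecified inverse of 0 is, so linearity and monotonicity hold for every list; only
  -- `avg-const` asks for a positive length.
  avg : List A → (A → Carrier) → Carrier
  avg xs f = fromℕ (length xs) ⁻¹ * ∑ xs f

  0≤fromℕ⁻¹ : ∀ n → .{{ℕ.NonZero n}} → 0# ≤ fromℕ n ⁻¹
  0≤fromℕ⁻¹ n = <⇒≤ (0<⁻¹ (0<fromℕ n))

  avg-cong-∈ : ∀ (xs : List A) {f g} → (∀ {x} → x ∈ xs → f x ≈ g x) → avg xs f ≈ avg xs g
  avg-cong-∈ xs p = *-congˡ (∑-cong-∈ xs p)

  avg-cong : ∀ (xs : List A) {f g} → (∀ x → f x ≈ g x) → avg xs f ≈ avg xs g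
  avg-cong xs p = *-congˡ (∑-cong xs p)

  avg-+ : ∀ (xs : List A) f g → avg xs (λ x → f x + g x) ≈ avg xs f + avg xs g
  avg-+ xs f g = ≈-trans (*-congˡ (∑-+ xs f g)) (distribˡ _ _ _)

  avg-* : ∀ (xs : List A) c f → avg xs (λ x → c * f x) ≈ c * avg xs f
  avg-* xs c f = ≈-trans (*-congˡ (∑-* xs c f))
    (solve 3 (λ i c s → i :* (c :* s) := c :* (i :* s)) ≈-refl (fromℕ (length xs) ⁻¹) c (∑ xs f))

  avg-swap : ∀ (xs : List A) (ys : List B) (f : A → B → Carrier) →
    avg xs (λ x → avg ys (f x)) ≈ avg ys (λ y → avg xs (λ x → f x y))
  avg-swap xs ys f = begin-equality
    i * ∑ xs (λ x → j * ∑ ys (f x))              ≈⟨ *-congˡ (∑-* xs j _) ⟩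
    i * (j * ∑ xs (λ x → ∑ ys (f x)))            ≈⟨ *-congˡ (*-congˡ (∑-swap xs ys f)) ⟩
    i * (j * ∑ ys (λ y → ∑ xs (λ x → f x y)))    ≈⟨ solve 3 (λ i j s → i :* (j :* s) := j :* (i :* s)) ≈-refl i j _ ⟩
    j * (i * ∑ ys (λ y → ∑ xs (λ x → f x y)))    ≈⟨ *-congˡ (∑-* ys i _) ⟨
    j * ∑ ys (λ y → i * ∑ xs (λ x → f x y))      ∎
    where
    i = fromℕ (length xs) ⁻¹
    j = fromℕ (length ys) ⁻¹

  avg-mono-∈ : ∀ (xs : List A) {f g} → (∀ {x} → x ∈ xs → f x ≤ g x) → avg xs f ≤ avg xs g
  avg-mono-∈ []         p = ≤-refl
  avg-mono-∈ (x ∷ xs) p = *-monoˡ-≤ _ (0≤fromℕ⁻¹ (suc (length xs))) (∑-mono-∈ (x ∷ xs) p)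

  avg-mono : ∀ (xs : List A) {f g} → (∀ x → f x ≤ g x) → avg xs f ≤ avg xs g
  avg-mono xs p = avg-mono-∈ xs (λ {x} _ → p x)

  avg-nonneg : ∀ (xs : List A) {f} → (∀ x → 0# ≤ f x) → 0# ≤ avg xs f
  avg-nonneg xs p = ≤-trans (≤-reflexive (≈-sym (≈-trans (*-congˡ (∑-0 xs)) (zeroʳ _)))) (avg-mono xs p)

  avg-const : ∀ (xs : List A) → 0# < fromℕ (length xs) → ∀ c → avg xs (λ _ → c) ≈ c
  avg-const xs 0<∣xs∣ c = begin-equality
    fromℕ (length xs) ⁻¹ * ∑ xs (λ _ → c)              ≈⟨ *-congˡ (∑-const xs c) ⟩
    fromℕ (length xs) ⁻¹ * (fromℕ (length xs) * c)     ≈⟨ *-assoc _ _ _ ⟨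
    fromℕ (length xs) ⁻¹ * fromℕ (length xs) * c       ≈⟨ *-congʳ (*-inverseˡ 0<∣xs∣) ⟩
    1# * c                                             ≈⟨ *-identityˡ c ⟩
    c                                                  ∎

  ⁻¹-* : ∀ {x y} → 0# < x → 0# < y → (x * y) ⁻¹ ≈ x ⁻¹ * y ⁻¹
  ⁻¹-* {x} {y} 0<x 0<y = begin-equality
    (x * y) ⁻¹                                     ≈⟨ solve 1 (λ z → z := z :* (# 1 :* # 1)) ≈-refl ((x * y) ⁻¹) ⟩
    (x * y) ⁻¹ * (1# * 1#)                         ≈⟨ *-congˡ (*-cong (*-inverseˡ 0<x) (*-inverseˡ 0<y)) ⟨
    (x * y) ⁻¹ * ((x ⁻¹ * x) * (y ⁻¹ * y))         ≈⟨ solve 5 (λ z x y i j → z :* (i :* x :* (j :* y)) := z :*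
        (x :* y) :* (i :* j)) ≈-refl ((x * y) ⁻¹) x y (x ⁻¹) (y ⁻¹) ⟩
    (x * y) ⁻¹ * (x * y) * (x ⁻¹ * y ⁻¹)           ≈⟨ *-congʳ (*-inverseˡ (*-pos x y 0<x 0<y)) ⟩
    1# * (x ⁻¹ * y ⁻¹)                             ≈⟨ *-identityˡ _ ⟩
    x ⁻¹ * y ⁻¹                                    ∎

  -- Inversion is not assumed to respect `≈`; away from zero this follows from the uniqueness of
  -- inverses.
  ⁻¹-cong : ∀ {x y} → 0# < x → x ≈ y → x ⁻¹ ≈ y ⁻¹
  ⁻¹-cong {x} {y} 0<x x≈y = begin-equality
    x ⁻¹                    ≈⟨ *-identityʳ _ ⟨
    x ⁻¹ * 1#               ≈⟨ *-congˡ (*-inverseʳ y (λ y≈0 → <⇒≉ 0<x (≈-trans x≈y y≈0))) ⟨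
    x ⁻¹ * (y * y ⁻¹)       ≈⟨ *-congˡ (*-congʳ x≈y) ⟨
    x ⁻¹ * (x * y ⁻¹)       ≈⟨ *-assoc _ _ _ ⟨
    x ⁻¹ * x * y ⁻¹         ≈⟨ *-congʳ (*-inverseˡ 0<x) ⟩
    1# * y ⁻¹               ≈⟨ *-identityˡ _ ⟩
    y ⁻¹                    ∎

  length≈∑1 : ∀ (xs : List A) → fromℕ (length xs) ≈ ∑ xs (λ _ → 1#)
  length≈∑1 xs = ≈-sym (≈-trans (∑-const xs 1#) (*-identityʳ _))

  length-cartesianProductWith : ∀ (g : A → B → C) xs ys →
    fromℕ (length (cartesianProductWith g xs ys)) ≈ fromℕ (length xs) * fromℕ (length ys)
  length-cartesianProductWith g xs ys = begin-equality
    fromℕ (length (cartesianProductWith g xs ys))   ≈⟨ length≈∑1 (cartesianProductWith g xs ys) ⟩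
    ∑ (cartesianProductWith g xs ys) (λ _ → 1#)     ≈⟨ ∑-cartesianProductWith g xs ys _ ⟩
    ∑ xs (λ _ → ∑ ys (λ _ → 1#))                    ≈⟨ ∑-cong xs (λ _ → length≈∑1 ys) ⟨
    ∑ xs (λ _ → fromℕ (length ys))                  ≈⟨ ∑-const xs _ ⟩
    fromℕ (length xs) * fromℕ (length ys)           ∎

  0<length-cartesianProductWith : ∀ (g : A → B → C) xs ys → 0# < fromℕ (length xs) → 0# < fromℕ (length ys) →
    0# < fromℕ (length (cartesianProductWith g xs ys))
  0<length-cartesianProductWith g xs ys p q =
    <-resp ≈-refl (≈-sym (length-cartesianProductWith g xs ys)) (*-pos _ _ p q)

  -- Uniform choice from a product means independent uniform choices; this expresses the
  -- independence of the two offered edges and of the rounds.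
  avg-cartesianProductWith : ∀ (g : A → B → C) xs ys → 0# < fromℕ (length xs) → 0# < fromℕ (length ys) → ∀ f →
    avg (cartesianProductWith g xs ys) f ≈ avg xs (λ x → avg ys (λ y → f (g x y)))
  avg-cartesianProductWith g xs ys 0<∣xs∣ 0<∣ys∣ f = begin-equality
    fromℕ (length (cartesianProductWith g xs ys)) ⁻¹ * ∑ (cartesianProductWith g xs ys) f
      ≈⟨ *-cong (≈-trans (⁻¹-cong (0<length-cartesianProductWith g xs ys 0<∣xs∣ 0<∣ys∣)
          (length-cartesianProductWith g xs ys))
           (⁻¹-* 0<∣xs∣ 0<∣ys∣)) (∑-cartesianProductWith g xs ys f) ⟩
    i * j * ∑ xs (λ x → ∑ ys (λ y → f (g x y)))
      ≈⟨ *-assoc i j _ ⟩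
    i * (j * ∑ xs (λ x → ∑ ys (λ y → f (g x y))))
      ≈⟨ *-congˡ (∑-* xs j _) ⟨
    avg xs (λ x → avg ys (λ y → f (g x y))) ∎
    where
    i = fromℕ (length xs) ⁻¹
    j = fromℕ (length ys) ⁻¹

-- Component sizes, their power sums, isolated vertices, and the effect of one new edge.

module Components (R : RealNumbers) where

  open OrderedField R
  open Sums R

  import Algebra.Properties.Semiring.Exp semiring as Exp

  ⟦⊎⟧ : ∀ {A B : Set} (a? : Dec A) (b? : Dec B) → ¬ (A × B) → ⟦ does a? ∨ does b? ⟧ ≈ ⟦ does a? ⟧ + ⟦ does b? ⟧
  ⟦⊎⟧ (yes a) (yes b) ¬both = ⊥-elim (¬both (a , b))
  ⟦⊎⟧ (yes a) (no _)  ¬both = ≈-sym (+-identityʳ 1#)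
  ⟦⊎⟧ (no _)  b?      ¬both = ≈-sym (+-identityˡ _)

  ⟦∧⟧ : ∀ x y → ⟦ x ∧ y ⟧ ≈ ⟦ x ⟧ * ⟦ y ⟧
  ⟦∧⟧ true  y = ≈-sym (*-identityˡ _)
  ⟦∧⟧ false y = ≈-sym (zeroˡ _)

  ^-cong : ∀ k {x y} → x ≈ y → x ^ k ≈ y ^ k
  ^-cong = Exp.^-congˡ

  1^ : ∀ k → 1# ^ k ≈ 1#
  1^ zero    = ≈-refl
  1^ (suc k) = ≈-trans (*-identityˡ _) (1^ k)

  fromℕ-^ : ∀ m k → fromℕ (m ℕ.^ k) ≈ fromℕ m ^ k
  fromℕ-^ m zero    = fromℕ-1
  fromℕ-^ m (suc k) = ≈-trans (fromℕ-* m (m ℕ.^ k)) (*-congˡ (fromℕ-^ m k))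

  mergeGain : ℕ → Carrier → Carrier → Carrier
  mergeGain k x y = (x + y) ^ k - x ^ k - y ^ k

  mergeGain-cong : ∀ k {x x′ y y′} → x ≈ x′ → y ≈ y′ → mergeGain k x y ≈ mergeGain k x′ y′
  mergeGain-cong k p q = +-cong (+-cong (^-cong k (+-cong p q)) (-‿cong (^-cong k p))) (-‿cong (^-cong k q))

  mergeGain-comm : ∀ k x y → mergeGain k x y ≈ mergeGain k y x
  mergeGain-comm k x y = ≈-trans (+-congʳ (+-congʳ (^-cong k (+-comm x y))))
    (solve 3 (λ s a b → s :- a :- b := s :- b :- a) ≈-refl ((y + x) ^ k) (x ^ k) (y ^ k))

  module _ {n : ℕ} where

    joined : Graph n → Fin n → Fin n → Bool
    joined G v w = does (connected? G v w)

    size : Graph n → Fin n → Carrier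
    size G v = ∑ (allFin n) (λ w → ⟦ joined G v w ⟧)

    -- A component of size c contributes c terms, so powerSum k corresponds to
    -- componentPowerSum (suc k).
    powerSum : ℕ → Graph n → Carrier
    powerSum k G = ∑ (allFin n) (λ v → size G v ^ k)

    joined-sym : ∀ G v w → joined G v w ≡ joined G w v
    joined-sym G v w = does-⇔ (mk⇔ (EqC.symmetric _) (EqC.symmetric _)) (connected? G v w) (connected? G w v)

    joined-class : ∀ G {v w} → Connected G v w → ∀ u → joined G v u ≡ joined G w u
    joined-class G {v} {w} v~w u =
      does-⇔ (mk⇔ (EqC.symmetric _ v~w ◅◅_) (v~w ◅◅_)) (connected? G v u) (connected? G w u)

    size-class : ∀ G {v w} → Connected G v w → size G v ≈ size G w
    size-class G v~w = ∑-cong (allFin n) (λ u → reflexive (≡.cong ⟦_⟧ (joined-class G v~w u)))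

    ∑-joined : ∀ G a c → ∑ (allFin n) (λ v → ⟦ joined G v a ⟧ * c) ≈ size G a * c
    ∑-joined G a c = begin-equality
      ∑ (allFin n) (λ v → ⟦ joined G v a ⟧ * c)   ≈⟨ ∑-cong (allFin n) (λ v → ≈-trans (*-comm _ c)
                                                      (*-congˡ (reflexive (≡.cong ⟦_⟧ (joined-sym G v a))))) ⟩
      ∑ (allFin n) (λ v → c * ⟦ joined G a v ⟧)   ≈⟨ ∑-* (allFin n) c _ ⟩
      c * size G a                                ≈⟨ *-comm c _ ⟩
      size G a * c                                ∎

    1≤size : ∀ G v → 1# ≤ size G v
    1≤size G v = ≤-trans (≤-reflexive (reflexive (≡.cong ⟦_⟧ (≡.sym (dec-true (connected? G v v) Star.ε)))))
      (term≤∑ {f = λ w → ⟦ joined G v w ⟧} (λ w → 0≤⟦⟧ (joined G v w)) (∈-allFin v))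

    module _ (G : Graph n) (a b : Fin n) where

      private
        e = (a , b)

      powerSum-joined : Connected G a b → ∀ k → powerSum k (e ∷ G) ≈ powerSum k G
      powerSum-joined a~b k = ∑-cong (allFin n) λ v → ^-cong k (∑-cong (allFin n) λ w →
        reflexive (≡.cong ⟦_⟧ (does-⇔ (mk⇔ (contract v w) weaken) (connected? (e ∷ G) v w) (connected? G v w))))
        where
        contract : ∀ v w → Connected (e ∷ G) v w → Connected G v w
        contract v w p with toThrough p
        ... | inj₁ q              = q
        ... | inj₂ (inj₁ (q , r)) = q ◅◅ a~b ◅◅ r
        ... | inj₂ (inj₂ (q , r)) = q ◅◅ EqC.symmetric _ a~b ◅◅ r

      module _ (a≁b : ¬ Connected G a b) where

        -- When `a` and `b` lie in different components the three alternatives of `Through` exclude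
        -- one another, so the indicator of their disjunction is the sum of their indicators.
        size-merge : ∀ v → size (e ∷ G) v ≈ size G v + (⟦ joined G v a ⟧ * size G b + ⟦ joined G v b ⟧ * size G a)
        size-merge v = begin-equality
          size (e ∷ G) v
            ≈⟨ ∑-cong (allFin n) pointwise ⟩
          ∑ (allFin n) (λ w → ⟦ joined G v w ⟧ + (⟦ joined G v a ⟧ * ⟦ joined G b w ⟧ + ⟦ joined G v b ⟧ * ⟦ joined G a w ⟧))
            ≈⟨ ∑-+ (allFin n) _ _ ⟩
          size G v + ∑ (allFin n) (λ w → ⟦ joined G v a ⟧ * ⟦ joined G b w ⟧ + ⟦ joined G v b ⟧ * ⟦ joined G a w ⟧)
            ≈⟨ +-congˡ (≈-trans (∑-+ (allFin n) _ _) (+-cong (∑-* (allFin n) _ _) (∑-* (allFin n) _ _))) ⟩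
          size G v + (⟦ joined G v a ⟧ * size G b + ⟦ joined G v b ⟧ * size G a) ∎
          where
          pointwise : ∀ w → ⟦ joined (e ∷ G) v w ⟧ ≈
            ⟦ joined G v w ⟧ + (⟦ joined G v a ⟧ * ⟦ joined G b w ⟧ + ⟦ joined G v b ⟧ * ⟦ joined G a w ⟧)
          pointwise w = begin-equality
            ⟦ joined G v w ∨ (joined G v a ∧ joined G b w) ∨ (joined G v b ∧ joined G a w) ⟧
              ≈⟨ ⟦⊎⟧ (connected? G v w) (via-ab? ⊎-dec via-ba?) (λ where
                   (p , inj₁ (q , r)) → a≁b (EqC.symmetric _ q ◅◅ p ◅◅ EqC.symmetric _ r)
                   (p , inj₂ (q , r)) → a≁b (r ◅◅ EqC.symmetric _ p ◅◅ q)) ⟩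
            ⟦ joined G v w ⟧ + ⟦ (joined G v a ∧ joined G b w) ∨ (joined G v b ∧ joined G a w) ⟧
              ≈⟨ +-congˡ (⟦⊎⟧ via-ab? via-ba? (λ ((p , _) , (q , _)) → a≁b (EqC.symmetric _ p ◅◅ q))) ⟩
            ⟦ joined G v w ⟧ + (⟦ joined G v a ∧ joined G b w ⟧ + ⟦ joined G v b ∧ joined G a w ⟧)
              ≈⟨ +-congˡ (+-cong (⟦∧⟧ (joined G v a) _) (⟦∧⟧ (joined G v b) _)) ⟩
            ⟦ joined G v w ⟧ + (⟦ joined G v a ⟧ * ⟦ joined G b w ⟧ + ⟦ joined G v b ⟧ * ⟦ joined G a w ⟧) ∎
            where
            via-ab? = connected? G v a ×-dec connected? G b w
            via-ba? = connected? G v b ×-dec connected? G a w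

        -- The A vertices joined to `a` and the B vertices joined to `b` all receive the value (A +
        -- B)ᵏ. Counting them with multiplicities A and B raises each exponent by one, whence
        -- `suc k`.
        powerSum-merge : ∀ k → powerSum k (e ∷ G) ≈ powerSum k G + mergeGain (suc k) (size G a) (size G b)
        powerSum-merge k = begin-equality
          powerSum k (e ∷ G)
            ≈⟨ ∑-cong (allFin n) pointwise ⟩
          ∑ (allFin n) (λ v → size G v ^ k + (⟦ joined G v a ⟧ * (s - A ^ k) + ⟦ joined G v b ⟧ * (s - B ^ k)))
            ≈⟨ ≈-trans (∑-+ (allFin n) _ _) (+-congˡ (∑-+ (allFin n) _ _)) ⟩
          powerSum k G + (∑ (allFin n) (λ v → ⟦ joined G v a ⟧ * (s - A ^ k)) + ∑ (allFin n) (λ v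
              → ⟦ joined G v b ⟧ * (s - B ^ k)))
            ≈⟨ +-congˡ (+-cong (∑-joined G a _) (∑-joined G b _)) ⟩
          powerSum k G + (A * (s - A ^ k) + B * (s - B ^ k))
            ≈⟨ +-congˡ (solve 5 (λ A B s p q → A :* (s :- p) :+ B :* (s :- q) := (A :+ B) :* s :- A :* p :- B :* q)
                 ≈-refl A B s (A ^ k) (B ^ k)) ⟩
          powerSum k G + mergeGain (suc k) A B ∎
          where
          A = size G a
          B = size G b
          s = (A + B) ^ k
          pointwise : ∀ v → size (e ∷ G) v ^ k ≈
            size G v ^ k + (⟦ joined G v a ⟧ * (s - A ^ k) + ⟦ joined G v b ⟧ * (s - B ^ k))
          pointwise v = by-cases (connected? G v a) (connected? G v b) (size-merge v)
            where
            -- The new size is generalised so that case analysis on the two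
            -- decisions does not touch it.
            by-cases : (a? : Dec (Connected G v a)) (b? : Dec (Connected G v b)) → ∀ {c} →
              c ≈ size G v + (⟦ does a? ⟧ * B + ⟦ does b? ⟧ * A) →
              c ^ k ≈ size G v ^ k + (⟦ does a? ⟧ * (s - A ^ k) + ⟦ does b? ⟧ * (s - B ^ k))
            by-cases (yes v~a) (yes v~b) _ = ⊥-elim (a≁b (EqC.symmetric _ v~a ◅◅ v~b))
            by-cases (yes v~a) (no _) {c} merged = begin-equality
              c ^ k           ≈⟨ ^-cong k (≈-trans merged (≈-trans
                                   (solve 3 (λ v A B → v :+ (# 1 :* B :+ # 0 :* A) := v :+ B) ≈-refl (size G v) A B)
                                   (+-congʳ (size-class G v~a)))) ⟩
              s               ≈⟨ solve 3 (λ s p q → s := p :+ (# 1 :* (s :- p) :+ # 0 :* (s :- q))) ≈-refl s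
                  (A ^ k) (B ^ k) ⟩
              A ^ k + _       ≈⟨ +-congʳ (^-cong k (size-class G v~a)) ⟨
              size G v ^ k + (1# * (s - A ^ k) + 0# * (s - B ^ k)) ∎
            by-cases (no _) (yes v~b) {c} merged = begin-equality
              c ^ k           ≈⟨ ^-cong k (≈-trans merged (≈-trans
                                   (solve 3 (λ v A B → v :+ (# 0 :* B :+ # 1 :* A) := A :+ v) ≈-refl (size G v) A B)
                                   (+-congˡ (size-class G v~b)))) ⟩
              s               ≈⟨ solve 3 (λ s p q → s := q :+ (# 0 :* (s :- p) :+ # 1 :* (s :- q))) ≈-refl s
                  (A ^ k) (B ^ k) ⟩
              B ^ k + _       ≈⟨ +-congʳ (^-cong k (size-class G v~b)) ⟨
              size G v ^ k + (0# * (s - A ^ k) + 1# * (s - B ^ k)) ∎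
            by-cases (no _) (no _) {c} merged = begin-equality
              c ^ k           ≈⟨ ^-cong k (≈-trans merged
                                   (solve 3 (λ v A B → v :+ (# 0 :* B :+ # 0 :* A) := v) ≈-refl (size G v) A B)) ⟩
              size G v ^ k    ≈⟨ solve 4 (λ v s p q → v := v :+ (# 0 :* (s :- p) :+ # 0 :* (s :- q))) ≈-refl
                  (size G v ^ k) s (A ^ k) (B ^ k) ⟩
              size G v ^ k + (0# * (s - A ^ k) + 0# * (s - B ^ k)) ∎

      powerSum-∷ : ∀ k → powerSum k (e ∷ G) ≈
        powerSum k G + ⟦ not (joined G a b) ⟧ * mergeGain (suc k) (size G a) (size G b)
      powerSum-∷ k with connected? G a b
      ... | yes a~b = ≈-trans (powerSum-joined a~b k)
            (solve 2 (λ p g → p := p :+ # 0 :* g) ≈-refl (powerSum k G) _)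
      ... | no  a≁b = ≈-trans (powerSum-merge a≁b k) (+-congˡ (≈-sym (*-identityˡ _)))

    private
      fromℕ-sum : ∀ {A : Set} (φ : A → ℕ) xs → fromℕ (sum (map φ xs)) ≈ ∑ xs (λ x → fromℕ (φ x))
      fromℕ-sum φ []       = ≈-refl
      fromℕ-sum φ (x ∷ xs) = ≈-trans (fromℕ-+ (φ x) _) (+-congˡ (fromℕ-sum φ xs))

      -- `g` is arbitrary because the induction on the subset composes it with `suc`.
      fromℕ-∣∣-tabulate : ∀ {m} (C : Subset m) {A : Set} (g : Fin m → A) (f : A → Carrier) →
        (∀ i → f (g i) ≈ ⟦ lookup C i ⟧) → fromℕ ∣ C ∣ ≈ ∑ (tabulate g) f
      fromℕ-∣∣-tabulate []          g f p = ≈-refl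
      fromℕ-∣∣-tabulate (true  ∷ C) g f p = +-cong (≈-sym (p zero)) (fromℕ-∣∣-tabulate C (λ i → g (suc i)) f (λ i
          → p (suc i)))
      fromℕ-∣∣-tabulate (false ∷ C) g f p = ≈-trans (≈-sym (+-identityˡ _))
        (+-cong (≈-sym (p zero)) (fromℕ-∣∣-tabulate C (λ i → g (suc i)) f (λ i → p (suc i))))

    fromℕ-∣∣ : (C : Subset n) → fromℕ ∣ C ∣ ≈ ∑ (allFin n) (λ v → ⟦ lookup C v ⟧)
    fromℕ-∣∣ C = fromℕ-∣∣-tabulate C (λ i → i) _ (λ _ → ≈-refl)

    lookup-componentOf : ∀ G u v → lookup (componentOf G u) v ≡ joined G u v
    lookup-componentOf G u v = lookup∘tabulate (joined G u) v

    -- Double counting of the pairs of a component C and a vertex in it: one of the k + 1 factors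
    -- |C| is written as a count of vertices and the sums are exchanged. Each vertex then lies in
    -- exactly one listed component, as the list has no duplicates.
    componentPowerSum≈powerSum : ∀ k G → fromℕ (componentPowerSum (suc k) G) ≈ powerSum k G
    componentPowerSum≈powerSum k G = begin-equality
      fromℕ (componentPowerSum (suc k) G)
        ≈⟨ fromℕ-sum (λ C → ∣ C ∣ ℕ.^ suc k) U ⟩
      ∑ U (λ C → fromℕ (∣ C ∣ ℕ.^ suc k))
        ≈⟨ ∑-cong U (λ C → ≈-trans (fromℕ-^ ∣ C ∣ (suc k)) (≈-trans (*-comm _ _) (*-congˡ (fromℕ-∣∣ C)))) ⟩
      ∑ U (λ C → fromℕ ∣ C ∣ ^ k * ∑ (allFin n) (λ v → ⟦ lookup C v ⟧))
        ≈⟨ ∑-cong U (λ C → ∑-* (allFin n) _ _) ⟨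
      ∑ U (λ C → ∑ (allFin n) (λ v → fromℕ ∣ C ∣ ^ k * ⟦ lookup C v ⟧))
        ≈⟨ ∑-swap U (allFin n) _ ⟩
      ∑ (allFin n) (λ v → ∑ U (λ C → fromℕ ∣ C ∣ ^ k * ⟦ lookup C v ⟧))
        ≈⟨ ∑-cong (allFin n) (λ v → ≈-trans (∑-single unique (own v) (others v)) (own-value v)) ⟩
      powerSum k G ∎
      where
      _≟_ = ≡-dec {n = n} Bool._≟_
      U = components G
      unique : Unique U
      unique = UniqueDec.deduplicate-! _≟_ _
      own : ∀ v → componentOf G v ∈ U
      own v = ∈-deduplicate⁺ _≟_ (∈-map⁺ (componentOf G) (∈-allFin v))
      others : ∀ v {C} → C ∈ U → C ≢ componentOf G v → fromℕ ∣ C ∣ ^ k * ⟦ lookup C v ⟧ ≈ 0#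
      others v C∈U C≢ with ∈-map⁻ (componentOf G) (∈-deduplicate⁻ _≟_ (map (componentOf G) (allFin n)) C∈U)
      ... | u , _ , refl = ≈-trans (*-congˡ (reflexive (≡.cong ⟦_⟧ (≡.trans (lookup-componentOf G u v)
              (dec-false (connected? G u v) (λ u~v → C≢ (tabulate-cong (joined-class G u~v)))))))) (zeroʳ _)
      own-value : ∀ v → fromℕ ∣ componentOf G v ∣ ^ k * ⟦ lookup (componentOf G v) v ⟧ ≈ size G v ^ k
      own-value v = ≈-trans (*-cong
          (^-cong k (≈-trans (fromℕ-∣∣ (componentOf G v)) (∑-cong (allFin n) (λ w → reflexive (≡.cong ⟦_⟧
              (lookup-componentOf G v w))))))
          (reflexive (≡.cong ⟦_⟧ (≡.trans (lookup-componentOf G v v) (dec-true (connected? G v v) Star.ε)))))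
        (*-identityʳ _)

    alone : Graph n → Fin n → Bool
    alone G v = does (isolated? G v)

    isolatedCount : Graph n → Carrier
    isolatedCount G = ∑ (allFin n) (λ v → ⟦ alone G v ⟧)

    ∑-≟ : ∀ (a : Fin n) c → ∑ (allFin n) (λ v → ⟦ does (a Fin.≟ v) ⟧ * c) ≈ c
    ∑-≟ a c = ≈-trans
      (∑-single (allFin⁺ n) (∈-allFin a)
        (λ {x} _ x≢a → ≈-trans (*-congʳ (reflexive (≡.cong ⟦_⟧ (dec-false (a Fin.≟ x) (λ a≡x → x≢a
            (≡.sym a≡x)))))) (zeroˡ c)))
      (≈-trans (*-congʳ (reflexive (≡.cong ⟦_⟧ (dec-true (a Fin.≟ a) refl)))) (*-identityˡ c))

    -- The ends must differ: a loop at an isolated vertex would lose one isolated vertex and be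
    -- charged for two.
    isolatedCount-∷ : ∀ G a b → a ≢ b → isolatedCount ((a , b) ∷ G) ≈ isolatedCount G + - (⟦ alone G a ⟧ + ⟦ alone G b ⟧)
    isolatedCount-∷ G a b a≢b = begin-equality
      isolatedCount ((a , b) ∷ G)
        ≈⟨ ∑-cong (allFin n) pointwise ⟩
      ∑ (allFin n) (λ v → ⟦ alone G v ⟧ + (⟦ does (a Fin.≟ v) ⟧ * - ⟦ alone G a ⟧ + ⟦ does (b Fin.≟ v) ⟧ * - ⟦ alone G b ⟧))
        ≈⟨ ≈-trans (∑-+ (allFin n) _ _) (+-congˡ (∑-+ (allFin n) _ _)) ⟩
      isolatedCount G + (∑ (allFin n) (λ v → ⟦ does (a Fin.≟ v) ⟧ * - ⟦ alone G a ⟧) + ∑ (allFin n) (λ v → ⟦ does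
          (b Fin.≟ v) ⟧ * - ⟦ alone G b ⟧))
        ≈⟨ +-congˡ (+-cong (∑-≟ a _) (∑-≟ b _)) ⟩
      isolatedCount G + (- ⟦ alone G a ⟧ + - ⟦ alone G b ⟧)
        ≈⟨ +-congˡ (solve 2 (λ x y → :- x :+ :- y := :- (x :+ y)) ≈-refl _ _) ⟩
      isolatedCount G + - (⟦ alone G a ⟧ + ⟦ alone G b ⟧) ∎
      where
      pointwise : ∀ v → ⟦ alone ((a , b) ∷ G) v ⟧ ≈
        ⟦ alone G v ⟧ + (⟦ does (a Fin.≟ v) ⟧ * - ⟦ alone G a ⟧ + ⟦ does (b Fin.≟ v) ⟧ * - ⟦ alone G b ⟧)
      pointwise v with a Fin.≟ v | b Fin.≟ v
      ... | yes refl | yes refl = ⊥-elim (a≢b refl)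
      ... | yes refl | no _     = solve 2 (λ x y → # 0 := x :+ (# 1 :* :- x :+ # 0 :* :- y)) ≈-refl _ _
      ... | no _     | yes refl = solve 2 (λ x y → # 0 := x :+ (# 0 :* :- y :+ # 1 :* :- x)) ≈-refl _ _
      ... | no _     | no _     = solve 3 (λ x y z → x := x :+ (# 0 :* :- y :+ # 0 :* :- z)) ≈-refl _ _ _

    isolated-connected : ∀ {G : Graph n} {v w} → Isolated G v → Connected G v w → v ≡ w
    isolated-connected iso Star.ε           = refl
    isolated-connected iso (fwd i ◅ _) = ⊥-elim (proj₁ (All.lookup iso i) refl)
    isolated-connected iso (bwd i ◅ _) = ⊥-elim (proj₂ (All.lookup iso i) refl)

    size-isolated : ∀ G v → Isolated G v → size G v ≈ 1#
    size-isolated G v iso = ≈-trans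
      (∑-cong (allFin n) {g = λ w → ⟦ does (v Fin.≟ w) ⟧ * 1#} (λ w →
        ≈-trans (reflexive (≡.cong ⟦_⟧ (only-itself w))) (≈-sym (*-identityʳ _))))
      (∑-≟ v 1#)
      where
      only-itself : ∀ w → joined G v w ≡ does (v Fin.≟ w)
      only-itself w = does-⇔ (mk⇔ (isolated-connected iso) (λ { refl → Star.ε })) (connected? G v w) (v Fin.≟ w)

    size-[] : ∀ v → size [] v ≈ 1#
    size-[] v = size-isolated [] v []

  length-allFin : ∀ n → fromℕ (length (allFin n)) ≈ fromℕ n
  length-allFin n = reflexive (≡.cong fromℕ (length-tabulate {n = n} (λ i → i)))

-- From averages over edges to averages over ordered pairs of vertices.

module EdgeAverages (R : RealNumbers) where

  open OrderedField R
  open Sums R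
  open Components R using (length-allFin; ∑-≟)

  module _ {n : ℕ} where

    private
      V = allFin n

    Symmetric : (Fin n → Fin n → Carrier) → Set
    Symmetric f = ∀ a b → f a b ≈ f b a

    edge-distinct : ∀ {a b} → (a , b) ∈ allEdges n → a ≢ b
    edge-distinct {a} {b} i refl = Fin.<-irrefl refl (proj₂ (∈-filter⁻ (uncurry Fin._<?_) {xs = cartesianProduct V V} i))

    -- Edges are listed in ascending order only. By symmetry the descending pairs contribute the
    -- same, and the diagonal is what remains of all ordered pairs.
    2∑-edges : ∀ (f : Fin n → Fin n → Carrier) → Symmetric f →
      2# * ∑ (allEdges n) (uncurry f) ≈ ∑ V (λ a → ∑ V (f a)) - ∑ V (λ a → f a a)
    2∑-edges f f-sym = begin-equality
      2# * ∑ (allEdges n) (uncurry f)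
        ≈⟨ solve 1 (λ s → # 2 :* s := s :+ s) ≈-refl _ ⟩
      ∑ (allEdges n) (uncurry f) + ∑ (allEdges n) (uncurry f)
        ≈⟨ +-cong ascending (≈-trans ascending descending) ⟩
      S< + S>
        ≈⟨ solve 3 (λ s t d → s :+ t := s :+ t :+ d :- d) ≈-refl S< S> S= ⟩
      S< + S> + S= - S=
        ≈⟨ +-cong (≈-sym total) (-‿cong diagonal) ⟩
      ∑ V (λ a → ∑ V (f a)) - ∑ V (λ a → f a a) ∎
      where
      S< = ∑ V (λ a → ∑ V (λ b → ⟦ does (a Fin.<? b) ⟧ * f a b))
      S> = ∑ V (λ a → ∑ V (λ b → ⟦ does (b Fin.<? a) ⟧ * f a b))
      S= = ∑ V (λ a → ∑ V (λ b → ⟦ does (a Fin.≟ b) ⟧ * f a b))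
      ascending : ∑ (allEdges n) (uncurry f) ≈ S<
      ascending = ≈-trans (∑-filter (uncurry Fin._<?_) (cartesianProduct V V) (uncurry f))
        (∑-cartesianProductWith _,_ V V _)
      descending : S< ≈ S>
      descending = ≈-trans (∑-swap V V _) (∑-cong V (λ b → ∑-cong V (λ a → *-congˡ (f-sym a b))))
      diagonal : S= ≈ ∑ V (λ a → f a a)
      diagonal = ∑-cong V (λ a → ≈-trans (∑-cong V (λ b → only a b)) (∑-≟ a (f a a)))
        where
        only : ∀ a b → ⟦ does (a Fin.≟ b) ⟧ * f a b ≈ ⟦ does (a Fin.≟ b) ⟧ * f a a
        only a b with a Fin.≟ b
        ... | yes refl = ≈-refl
        ... | no _     = ≈-trans (zeroˡ _) (≈-sym (zeroˡ _))
      total : ∑ V (λ a → ∑ V (f a)) ≈ S< + S> + S=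
      total = ≈-trans (∑-cong V (λ a → ≈-trans (∑-cong V (split a)) (≈-trans (∑-+ V _ _) (+-congʳ (∑-+ V _ _)))))
        (≈-trans (∑-+ V _ _) (+-congʳ (∑-+ V _ _)))
        where
        split : ∀ a b → f a b ≈
          ⟦ does (a Fin.<? b) ⟧ * f a b + ⟦ does (b Fin.<? a) ⟧ * f a b + ⟦ does (a Fin.≟ b) ⟧ * f a b
        split a b with Fin.<-cmp a b
        ... | tri< p q r rewrite dec-true (a Fin.<? b) p | dec-false (b Fin.<? a) r | dec-false (a Fin.≟ b) q =
              solve 1 (λ x → x := # 1 :* x :+ # 0 :* x :+ # 0 :* x) ≈-refl _
        ... | tri≈ p q r rewrite dec-false (a Fin.<? b) p | dec-false (b Fin.<? a) r | dec-true (a Fin.≟ b) q =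
              solve 1 (λ x → x := # 0 :* x :+ # 0 :* x :+ # 1 :* x) ≈-refl _
        ... | tri> p q r rewrite dec-false (a Fin.<? b) p | dec-true (b Fin.<? a) r | dec-false (a Fin.≟ b) q =
              solve 1 (λ x → x := # 0 :* x :+ # 1 :* x :+ # 0 :* x) ≈-refl _

  module Means (n : ℕ) where

    private
      V = allFin n

    mean : (Fin n → Carrier) → Carrier
    mean = avg V

    mean² : (Fin n → Fin n → Carrier) → Carrier
    mean² f = mean (λ a → mean (f a))

    mean²-cong : ∀ {f g} → (∀ a b → f a b ≈ g a b) → mean² f ≈ mean² g
    mean²-cong p = avg-cong V (λ a → avg-cong V (p a))

    mean²-mono : ∀ {f g} → (∀ a b → f a b ≤ g a b) → mean² f ≤ mean² g
    mean²-mono p = avg-mono V (λ a → avg-mono V (p a))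

    mean²-+ : ∀ f g → mean² (λ a b → f a b + g a b) ≈ mean² f + mean² g
    mean²-+ f g = ≈-trans (avg-cong V (λ a → avg-+ V (f a) (g a))) (avg-+ V _ _)

    mean²-* : ∀ c f → mean² (λ a b → c * f a b) ≈ c * mean² f
    mean²-* c f = ≈-trans (avg-cong V (λ a → avg-* V c (f a))) (avg-* V c _)

    mean²-product : ∀ f g → mean² (λ a b → f a * g b) ≈ mean f * mean g
    mean²-product f g = ≈-trans
      (avg-cong V (λ a → ≈-trans (avg-* V (f a) g) (*-comm _ _)))
      (≈-trans (avg-* V (mean g) f) (*-comm _ _))

    mean≈ : ∀ f → mean f ≈ fromℕ n ⁻¹ * ∑ (allFin n) f
    mean≈ f = *-congʳ (reflexive (≡.cong _⁻¹ (≡.cong fromℕ len)))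
      where
      open import Data.List.Properties using (length-tabulate)
      len : length (allFin n) ≡ n
      len = length-tabulate {n = n} (λ i → i)

  module AtLeastTwo (n : ℕ) (2≤n : 2 ℕ.≤ n) where

    open Means n public

    private
      V = allFin n

    edges : List (Edge n)
    edges = allEdges n

    ν : Carrier
    ν = fromℕ n

    h : Carrier
    h = ν ⁻¹

    0<ν : 0# < ν
    0<ν = <-≤-trans 0<2 (fromℕ-mono-≤ 2≤n)

    0<h : 0# < h
    0<h = 0<⁻¹ 0<ν

    0≤h : 0# ≤ h
    0≤h = <⇒≤ 0<h

    hν≈1 : h * ν ≈ 1#
    hν≈1 = *-inverseˡ 0<ν

    2h≤1 : 2# * h ≤ 1#
    2h≤1 = begin
      2# * h    ≤⟨ *-monoʳ-≤ h 0≤h (fromℕ-mono-≤ 2≤n) ⟩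
      ν * h     ≈⟨ *-comm ν h ⟩
      h * ν     ≈⟨ hν≈1 ⟩
      1#        ∎

    h≤1 : h ≤ 1#
    h≤1 = ≤-trans (≤-+ 0≤h (solve 1 (λ h → # 2 :* h := h :+ h) ≈-refl h)) 2h≤1

    0<∣V∣ : 0# < fromℕ (length V)
    0<∣V∣ = <-resp ≈-refl (≈-sym (length-allFin n)) 0<ν

    mean-const : ∀ c → mean (λ _ → c) ≈ c
    mean-const = avg-const V 0<∣V∣

    private
      N = fromℕ (length edges)

      2N : 2# * N ≈ ν * ν - ν
      2N = begin-equality
        2# * N                                            ≈⟨ *-congˡ (length≈∑1 edges) ⟩
        2# * ∑ edges (λ _ → 1#)                           ≈⟨ 2∑-edges {n} (λ _ _ → 1#) (λ _ _ → ≈-refl) ⟩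
        ∑ V (λ _ → ∑ V (λ _ → 1#)) - ∑ V (λ _ → 1#)       ≈⟨ +-cong (≈-trans (∑-cong V (λ _ → ∑V1)) (≈-trans
            (∑-const V ν) (*-congʳ (length-allFin n)))) (-‿cong ∑V1) ⟩
        ν * ν - ν                                         ∎
        where
        ∑V1 : ∑ V (λ _ → 1#) ≈ ν
        ∑V1 = ≈-trans (≈-sym (length≈∑1 V)) (length-allFin n)

    0<∣edges∣ : 0# < fromℕ (length edges)
    0<∣edges∣ with ≤-or-> N 0#
    ... | inj₂ 0<N = 0<N
    ... | inj₁ N≤0 = ⊥-elim (≤⇒≯ 2N≤0 (<-resp ≈-refl (≈-sym 2N) 0<ν²-ν))
      where
      2N≤0 : 2# * N ≤ 0#
      2N≤0 = ≤-trans (*-monoˡ-≤ 2# (<⇒≤ 0<2) N≤0) (≤-reflexive (zeroʳ 2#))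
      0<ν²-ν : 0# < ν * ν - ν
      0<ν²-ν = <-resp ≈-refl (solve 1 (λ v → v :* (v :- # 1) := v :* v :- v) ≈-refl ν)
        (*-pos ν (ν - 1#) 0<ν (x<y⇒0<y-x (<-≤-trans 1<2 (fromℕ-mono-≤ 2≤n))))
        where
        1<2 : 1# < 2#
        1<2 = <-resp fromℕ-1 ≈-refl (fromℕ-mono-< {1} {2} (ℕ.s≤s (ℕ.s≤s ℕ.z≤n)))

    -- There are ν (ν - 1) / 2 edges, whence the factor 1 - h; both sides equal 2 h² times the sum
    -- over the edges.
    edge-avg : ∀ f → Symmetric f →
      (1# - h) * avg edges (uncurry f) ≈ mean² f - h * mean (λ a → f a a)
    edge-avg f f-sym = begin-equality
      (1# - h) * (N ⁻¹ * S)
        ≈⟨ *-congʳ (solve 2 (λ h v → # 1 :- h := # 1 :* # 1 :- h :* # 1) ≈-refl h ν) ⟩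
      (1# * 1# - h * 1#) * (N ⁻¹ * S)
        ≈⟨ *-congʳ (+-cong (*-cong hν≈1 hν≈1) (-‿cong (*-congˡ hν≈1))) ⟨
      (h * ν * (h * ν) - h * (h * ν)) * (N ⁻¹ * S)
        ≈⟨ solve 4 (λ h v i s → (h :* v :* (h :* v) :- h :* (h :* v)) :* (i :* s) := h :* h :* ((v :* v :- v) :*
            (i :* s))) ≈-refl h ν (N ⁻¹) S ⟩
      h * h * ((ν * ν - ν) * (N ⁻¹ * S))
        ≈⟨ *-congˡ (*-congʳ 2N) ⟨
      h * h * (2# * N * (N ⁻¹ * S))
        ≈⟨ *-congˡ (solve 3 (λ n i s → # 2 :* n :* (i :* s) := i :* n :* (# 2 :* s)) ≈-refl N (N ⁻¹) S) ⟩
      h * h * (N ⁻¹ * N * (2# * S))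
        ≈⟨ *-congˡ (≈-trans (*-congʳ (*-inverseˡ 0<∣edges∣)) (*-identityˡ _)) ⟩
      h * h * (2# * S)
        ≈⟨ *-congˡ (2∑-edges f f-sym) ⟩
      h * h * (∑ V (λ a → ∑ V (f a)) - ∑ V (λ a → f a a))
        ≈⟨ solve 3 (λ h s d → h :* h :* (s :- d) := h :* (h :* s) :- h :* (h :* d)) ≈-refl h _ _ ⟩
      h * (h * ∑ V (λ a → ∑ V (f a))) - h * (h * ∑ V (λ a → f a a))
        ≈⟨ +-cong mean²≈ (-‿cong (*-congˡ (mean≈ _))) ⟨
      mean² f - h * mean (λ a → f a a) ∎
      where
      S = ∑ edges (uncurry f)
      mean²≈ : mean² f ≈ h * (h * ∑ V (λ a → ∑ V (f a)))
      mean²≈ = ≈-trans (mean≈ _) (*-congˡ (≈-trans (∑-cong V (λ a → mean≈ (f a))) (∑-* V h _)))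

    -- The cost of replacing a random edge by two independent random vertices. The edge average
    -- remains on the right, but with the factor h, so a crude bound for it suffices.
    edge-avg-diff : ∀ f → Symmetric f →
      avg edges (uncurry f) - mean² f ≈ h * (avg edges (uncurry f) - mean (λ a → f a a))
    edge-avg-diff f f-sym = begin-equality
      A - mean² f                              ≈⟨ solve 4 (λ a m h d → a :- m := (a :-
          (m :- h :* d)) :- h :* d) ≈-refl A (mean² f) h _ ⟩
      (A - (mean² f - h * D)) - h * D          ≈⟨ +-congʳ (+-congˡ (-‿cong (edge-avg f f-sym))) ⟨
      (A - (1# - h) * A) - h * D               ≈⟨ solve 3 (λ a h d → (a :- (# 1 :- h) :* a) :- h :* d := h :*
          (a :- d)) ≈-refl A h D ⟩
      h * (A - D)                              ∎
      where
      A = avg edges (uncurry f)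
      D = mean (λ a → f a a)

    -- For n ≥ 2 the factor 1 - h in `edge-avg` is at least one half, and the diagonal term has the
    -- favourable sign.
    edge-avg≤2mean² : ∀ f → Symmetric f → (∀ a b → 0# ≤ f a b) → avg edges (uncurry f) ≤ 2# * mean² f
    edge-avg≤2mean² f f-sym 0≤f = begin
      A                                        ≤⟨ ≤-+ (0≤* (x≤y⇒0≤y-x 2h≤1) 0≤A)
                                                    (solve 2 (λ a h → # 2 :* ((# 1 :- h) :* a) := a :+
                                                        (# 1 :- # 2 :* h) :* a) ≈-refl A h) ⟩
      2# * ((1# - h) * A)                      ≈⟨ *-congˡ (edge-avg f f-sym) ⟩
      2# * (mean² f - h * D)                   ≤⟨ *-monoˡ-≤ 2# (<⇒≤ 0<2) (≤-+ (0≤* 0≤h (avg-nonneg V (λ a → 0≤f a a)))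
                                                    (solve 2 (λ m d → m := m :- d :+ d) ≈-refl (mean² f) (h * D))) ⟩
      2# * mean² f                             ∎
      where
      A = avg edges (uncurry f)
      D = mean (λ a → f a a)
      0≤A : 0# ≤ A
      0≤A = avg-nonneg edges (λ (a , b) → 0≤f a b)

-- Bounds for the gain of one merger and for its averages.

module MergeGain (R : RealNumbers) where

  open OrderedField R
  open Sums R
  open Components R using (mergeGain; mergeGain-comm; 1^)
  open EdgeAverages R

  0≤^ : ∀ k {x} → 0# ≤ x → 0# ≤ x ^ k
  0≤^ zero    0≤x = 0≤1
  0≤^ (suc k) 0≤x = 0≤* 0≤x (0≤^ k 0≤x)

  1≤^ : ∀ k {x} → 1# ≤ x → 1# ≤ x ^ k
  1≤^ zero    1≤x = ≤-refl
  1≤^ (suc k) 1≤x = ≤-trans (≤-reflexive (≈-sym (*-identityˡ 1#)))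
    (*-mono-≤ (≤-trans 0≤1 1≤x) 0≤1 1≤x (1≤^ k 1≤x))

  ^-monoˡ-≤ : ∀ k {x y} → 0# ≤ x → x ≤ y → x ^ k ≤ y ^ k
  ^-monoˡ-≤ zero    0≤x x≤y = ≤-refl
  ^-monoˡ-≤ (suc k) 0≤x x≤y = *-mono-≤ (≤-trans 0≤x x≤y) (0≤^ k 0≤x) x≤y (^-monoˡ-≤ k 0≤x x≤y)

  ^-monoʳ-≤ : ∀ {i j x} → 1# ≤ x → i ℕ.≤ j → x ^ i ≤ x ^ j
  ^-monoʳ-≤ {j = j} 1≤x z≤n   = 1≤^ j 1≤x
  ^-monoʳ-≤ 1≤x (s≤s i≤j) = *-monoˡ-≤ _ (≤-trans 0≤1 1≤x) (^-monoʳ-≤ 1≤x i≤j)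

  mergeGain-1 : ∀ a b → mergeGain 1 a b ≈ 0#
  mergeGain-1 = solve 2 (λ a b → (a :+ b) :* # 1 :- a :* # 1 :- b :* # 1 := # 0) ≈-refl

  mergeGain-suc : ∀ j a b → mergeGain (2 ℕ.+ j) a b ≈
    (a + b) * mergeGain (1 ℕ.+ j) a b + (a * b ^ (1 ℕ.+ j) + b * a ^ (1 ℕ.+ j))
  mergeGain-suc j a b = solve 5 (λ a b p q r →
      (a :+ b) :* p :- a :* q :- b :* r := (a :+ b) :* (p :- q :- r) :+ (a :* r :+ b :* q))
    ≈-refl a b ((a + b) ^ (1 ℕ.+ j)) (a ^ (1 ℕ.+ j)) (b ^ (1 ℕ.+ j))

  0≤mergeGain : ∀ j {a b} → 0# ≤ a → 0# ≤ b → 0# ≤ mergeGain (1 ℕ.+ j) a b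
  0≤mergeGain zero    {a} {b} 0≤a 0≤b = ≤-reflexive (≈-sym (mergeGain-1 a b))
  0≤mergeGain (suc j) {a} {b} 0≤a 0≤b = ≤-trans
    (0≤+ (0≤* (0≤+ 0≤a 0≤b) (0≤mergeGain j 0≤a 0≤b)) (0≤+ (0≤* 0≤a (0≤^ (suc j) 0≤b)) (0≤* 0≤b (0≤^ (suc j) 0≤a))))
    (≤-reflexive (≈-sym (mergeGain-suc j a b)))

  -- In closed form 2^(j + 1) - 1, the least constant possible in `mergeGain≤`, as a = b = 1 shows.
  gainBound : ℕ → Carrier
  gainBound zero    = 1#
  gainBound (suc j) = 2# * gainBound j + 1#

  0≤gainBound : ∀ j → 0# ≤ gainBound j
  0≤gainBound zero    = 0≤1
  0≤gainBound (suc j) = 0≤+ (0≤* (<⇒≤ 0<2) (0≤gainBound j)) 0≤1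

  gainBound≤suc : ∀ j → gainBound j ≤ gainBound (suc j)
  gainBound≤suc j = ≤-+ (0≤+ (0≤gainBound j) 0≤1)
    (solve 1 (λ k → # 2 :* k :+ # 1 := k :+ (k :+ # 1)) ≈-refl (gainBound j))

  private
    similarly-ordered : ∀ j {a b} → 0# ≤ a → 0# ≤ b → 0# ≤ (a - b) * (a ^ j - b ^ j)
    similarly-ordered j {a} {b} 0≤a 0≤b with ≤-or-> b a
    ... | inj₁ b≤a = 0≤* (x≤y⇒0≤y-x b≤a) (x≤y⇒0≤y-x (^-monoˡ-≤ j 0≤b b≤a))
    ... | inj₂ a<b = ≤-trans (0≤* (x≤y⇒0≤y-x (<⇒≤ a<b)) (x≤y⇒0≤y-x (^-monoˡ-≤ j 0≤a (<⇒≤ a<b))))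
      (≤-reflexive (solve 4 (λ a b p q → (b :- a) :* (q :- p) := (a :- b) :* (p :- q)) ≈-refl a b (a ^ j) (b ^ j)))

  -- Induction through `mergeGain-suc`. The factor a + b creates the mixed terms a^(j+1) b² + a²
  -- b^(j+1); they are dominated by a^(j+2) b + a b^(j+2), the difference being ab (a - b) (aʲ -
  -- bʲ). The bound keeps one factor of degree one in each term, so that its average contains a
  -- single high moment.
  mergeGain≤ : ∀ j {a b} → 0# ≤ a → 0# ≤ b →
    mergeGain (2 ℕ.+ j) a b ≤ gainBound j * (a ^ (1 ℕ.+ j) * b + a * b ^ (1 ℕ.+ j))
  mergeGain≤ zero {a} {b} 0≤a 0≤b = ≤-reflexive (solve 2 (λ a b →
    (a :+ b) :* ((a :+ b) :* # 1) :- a :* (a :* # 1) :- b :* (b :* # 1) := # 1 :* (a :* # 1 :* b :+ a :*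
        (b :* # 1))) ≈-refl a b)
  mergeGain≤ (suc j) {a} {b} 0≤a 0≤b = begin
    mergeGain (3 ℕ.+ j) a b
      ≈⟨ mergeGain-suc (suc j) a b ⟩
    (a + b) * mergeGain (2 ℕ.+ j) a b + (a * b ^ (2 ℕ.+ j) + b * a ^ (2 ℕ.+ j))
      ≤⟨ +-monoˡ-≤ _ (*-monoˡ-≤ _ (0≤+ 0≤a 0≤b) (mergeGain≤ j 0≤a 0≤b)) ⟩
    (a + b) * (K * (a ^ (1 ℕ.+ j) * b + a * b ^ (1 ℕ.+ j))) + (a * b ^ (2 ℕ.+ j) + b * a ^ (2 ℕ.+ j))
      ≤⟨ ≤-+ (0≤* (0≤gainBound j) (0≤* (0≤* 0≤a 0≤b) (similarly-ordered j 0≤a 0≤b)))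
           (solve 5 (λ a b k p q →
             (# 2 :* k :+ # 1) :* (a :* (a :* p) :* b :+ a :* (b :* (b :* q))) :=
             (a :+ b) :* (k :* (a :* p :* b :+ a :* (b :* q))) :+ (a :* (b :* (b :* q)) :+ b :* (a :* (a :* p)))
             :+ k :* (a :* b :* ((a :- b) :* (p :- q)))) ≈-refl a b K (a ^ j) (b ^ j)) ⟩
    gainBound (suc j) * (a ^ (2 ℕ.+ j) * b + a * b ^ (2 ℕ.+ j)) ∎
    where K = gainBound j

  mergeGain-11≤ : ∀ j → mergeGain (2 ℕ.+ j) 1# 1# ≤ 2# * gainBound j
  mergeGain-11≤ j = ≤-trans (mergeGain≤ j 0≤1 0≤1) (≤-reflexive (≈-trans
    (*-congˡ (+-cong (*-congʳ (1^ (suc j))) (*-congˡ (1^ (suc j)))))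
    (solve 1 (λ k → k :* (# 1 :* # 1 :+ # 1 :* # 1) := # 2 :* k) ≈-refl (gainBound j))))

  module Moments (n : ℕ) (2≤n : 2 ℕ.≤ n) (s : Fin n → Carrier) (1≤s : ∀ v → 1# ≤ s v) where

    open AtLeastTwo n 2≤n

    private
      V = allFin n
      0≤s : ∀ v → 0# ≤ s v
      0≤s v = ≤-trans 0≤1 (1≤s v)

    -- For component sizes this is the susceptibility of index k + 1, since an average over vertices
    -- weights each component by its size.
    moment : ℕ → Carrier
    moment k = mean (λ v → s v ^ k)

    1≤moment : ∀ k → 1# ≤ moment k
    1≤moment k = ≤-trans (≤-reflexive (≈-sym (mean-const 1#))) (avg-mono V (λ v → 1≤^ k (1≤s v)))

    0≤moment : ∀ k → 0# ≤ moment k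
    0≤moment k = ≤-trans 0≤1 (1≤moment k)

    moment-mono : ∀ {i j} → i ℕ.≤ j → moment i ≤ moment j
    moment-mono i≤j = avg-mono V (λ v → ^-monoʳ-≤ (1≤s v) i≤j)

    mean²-monomial : ∀ i j → mean² (λ a b → s a ^ i * s b ^ j) ≈ moment i * moment j
    mean²-monomial i j = mean²-product (λ a → s a ^ i) (λ b → s b ^ j)

    mean²-symmetric : ∀ c i j → mean² (λ a b → c * (s a ^ i * s b ^ j + s a ^ j * s b ^ i)) ≈ c * (2# *
        (moment i * moment j))
    mean²-symmetric c i j = ≈-trans (mean²-* c _) (*-congˡ (≈-trans (mean²-+ _ _)
      (≈-trans (+-cong (mean²-monomial i j) (mean²-monomial j i))
        (solve 2 (λ p q → p :* q :+ q :* p := # 2 :* (p :* q)) ≈-refl (moment i) (moment j)))))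

    gain : ℕ → Carrier
    gain k = mean² (λ a b → mergeGain k (s a) (s b))

    gain-2 : gain 2 ≈ 2# * (moment 1 * moment 1)
    gain-2 = ≈-trans (mean²-cong (λ a b → solve 2 (λ a b →
        (a :+ b) :^ 2 :- a :^ 2 :- b :^ 2 := # 1 :* (a :^ 1 :* b :^ 1 :+ a :^ 1 :* b :^ 1)) ≈-refl (s a) (s b)))
      (≈-trans (mean²-symmetric 1# 1 1) (*-identityˡ _))

    gain-3 : gain 3 ≈ fromℕ 3 * (2# * (moment 2 * moment 1))
    gain-3 = ≈-trans (mean²-cong (λ a b → solve 2 (λ a b →
        (a :+ b) :^ 3 :- a :^ 3 :- b :^ 3 := # 3 :* (a :^ 2 :* b :^ 1 :+ a :^ 1 :* b :^ 2)) ≈-refl (s a) (s b)))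
      (mean²-symmetric (fromℕ 3) 2 1)

    -- The binomial coefficient 6 of a² b² is split as 3 + 3 to fit `mean²-symmetric`.
    gain-4 : gain 4 ≈ fromℕ 4 * (2# * (moment 3 * moment 1)) + fromℕ 3 * (2# * (moment 2 * moment 2))
    gain-4 = ≈-trans (mean²-cong (λ a b → solve 2 (λ a b →
        (a :+ b) :^ 4 :- a :^ 4 :- b :^ 4 :=
        # 4 :* (a :^ 3 :* b :^ 1 :+ a :^ 1 :* b :^ 3) :+ # 3 :* (a :^ 2 :* b :^ 2 :+ a :^ 2 :* b :^ 2)) ≈-refl (s a) (s b)))
      (≈-trans (mean²-+ _ _) (+-cong (mean²-symmetric (fromℕ 4) 3 1) (mean²-symmetric (fromℕ 3) 2 2)))

    0≤gain : ∀ j → 0# ≤ gain (1 ℕ.+ j)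
    0≤gain j = avg-nonneg V (λ a → avg-nonneg V (λ b → 0≤mergeGain j (0≤s a) (0≤s b)))

    -- The high moment occurs linearly, next to `moment 1`, which is s₂. For j = 5 this makes the
    -- expected growth of s₇ linear in s₇.
    gain≤ : ∀ j → gain (2 ℕ.+ j) ≤ gainBound j * (2# * (moment (1 ℕ.+ j) * moment 1))
    gain≤ j = ≤-trans
      (mean²-mono (λ a b → ≤-trans (mergeGain≤ j (0≤s a) (0≤s b)) (≤-reflexive (*-congˡ
        (+-cong (*-congˡ (≈-sym (*-identityʳ (s b)))) (*-congʳ (≈-sym (*-identityʳ (s a)))))))))
      (≤-reflexive (mean²-symmetric (gainBound j) (1 ℕ.+ j) 1))

-- Conditional first and second moments of the increments in one round.

module OneRound (R : RealNumbers) where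

  open OrderedField R
  open Sums R
  open Components R
  open EdgeAverages R
  open MergeGain R

  convex≤ : ∀ {p a b} → 0# ≤ p → p ≤ 1# → 0# ≤ a → 0# ≤ b → p * a + (1# - p) * b ≤ a + b
  convex≤ {p} {a} {b} 0≤p p≤1 0≤a 0≤b = ≤-+ (0≤+ (0≤* (x≤y⇒0≤y-x p≤1) 0≤a) (0≤* 0≤p 0≤b))
    (solve 3 (λ p a b → a :+ b := p :* a :+ (# 1 :- p) :* b :+ ((# 1 :- p) :* a :+ p :* b)) ≈-refl p a b)

  private
    ∣a-b∣≤1 : ∀ {a b} → 0# ≤ a → a ≤ 1# → 0# ≤ b → b ≤ 1# → abs (a - b) ≤ 1#
    ∣a-b∣≤1 {a} {b} 0≤a a≤1 0≤b b≤1 = abs-≤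
      (≤-trans (≤-+ 0≤b (solve 2 (λ a b → a := a :- b :+ b) ≈-refl a b)) a≤1)
      (≤-trans (≤-+ 0≤a (solve 2 (λ a b → b := :- (a :- b) :+ a) ≈-refl a b)) b≤1)

    ∣a-b∣≤a+b : ∀ {a b} → 0# ≤ a → 0# ≤ b → abs (a - b) ≤ a + b
    ∣a-b∣≤a+b {a} {b} 0≤a 0≤b = ≤-trans (abs-+ a (- b))
      (≤-reflexive (+-cong (abs-nonneg 0≤a) (≈-trans (abs-neg b) (abs-nonneg 0≤b))))

  module AtGraph (n : ℕ) (2≤n : 2 ℕ.≤ n) (G : Graph n) where

    open AtLeastTwo n 2≤n public
    open Moments n 2≤n (size G) (1≤size G) public

    private
      V = allFin n
      κ = size G

      0≤κ : ∀ v → 0# ≤ κ v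
      0≤κ v = ≤-trans 0≤1 (1≤size G v)

    rounds : List (Round n)
    rounds = cartesianProduct edges edges

    0<∣rounds∣ : 0# < fromℕ (length rounds)
    0<∣rounds∣ = 0<length-cartesianProductWith _,_ edges edges 0<∣edges∣ 0<∣edges∣

    solitary : Edge n → Bool
    solitary (a , b) = alone G a ∧ alone G b

    chosen : Round n → Edge n
    chosen (e₁ , e₂) = if solitary e₁ then e₁ else e₂

    bfStep≡ : ∀ r → bfStep r G ≡ chosen r ∷ G
    bfStep≡ (e₁ , e₂) with solitary e₁
    ... | true  = refl
    ... | false = refl

    chosen∈edges : ∀ {r} → r ∈ rounds → chosen r ∈ edges
    chosen∈edges {e₁ , e₂} i with solitary e₁ | ∈-cartesianProduct⁻ edges edges i
    ... | true  | e₁∈ , _ = e₁∈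
    ... | false | _ , e₂∈ = e₂∈

    p : Carrier
    p = avg edges (λ e → ⟦ solitary e ⟧)

    x : Carrier
    x = mean (λ v → ⟦ alone G v ⟧)

    0≤p : 0# ≤ p
    0≤p = avg-nonneg edges (λ e → 0≤⟦⟧ (solitary e))

    p≤1 : p ≤ 1#
    p≤1 = ≤-trans (avg-mono edges (λ e → ⟦⟧≤1 (solitary e))) (≤-reflexive (avg-const edges 0<∣edges∣ 1#))

    0≤x : 0# ≤ x
    0≤x = avg-nonneg V (λ v → 0≤⟦⟧ (alone G v))

    x≤1 : x ≤ 1#
    x≤1 = ≤-trans (avg-mono V (λ v → ⟦⟧≤1 (alone G v))) (≤-reflexive (mean-const 1#))

    -- Indicators are idempotent, so the diagonal term in `edge-avg-diff` is `x`; the error is h |p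
    -- - x|, and both numbers lie between 0 and 1.
    p≈x² : abs (p - x ²) ≤ h
    p≈x² = begin
      abs (p - x ²)        ≈⟨ abs-cong (+-cong p≈ (-‿cong (mean²-product i i))) ⟨
      abs (avg edges (uncurry f) - mean² f)                       ≈⟨ abs-cong (edge-avg-diff f (λ a b → *-comm
          (i a) (i b))) ⟩
      abs (h * (avg edges (uncurry f) - mean (λ a → f a a)))      ≈⟨ abs-cong (*-congˡ (+-cong p≈ (-‿cong
          (avg-cong V idem)))) ⟩
      abs (h * (p - x))    ≈⟨ ≈-trans (abs-* h (p - x)) (*-congʳ (abs-nonneg 0≤h)) ⟩
      h * abs (p - x)      ≤⟨ *-monoˡ-≤ h 0≤h (∣a-b∣≤1 0≤p p≤1 0≤x x≤1) ⟩
      h * 1#               ≈⟨ *-identityʳ h ⟩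
      h                    ∎
      where
      i : Fin n → Carrier
      i v = ⟦ alone G v ⟧
      f : Fin n → Fin n → Carrier
      f a b = i a * i b
      p≈ : avg edges (uncurry f) ≈ p
      p≈ = avg-cong edges (λ (a , b) → ≈-sym (⟦∧⟧ (alone G a) (alone G b)))
      idem : ∀ v → i v * i v ≈ i v
      idem v with alone G v
      ... | true  = *-identityˡ 1#
      ... | false = zeroˡ 0#

    -- Given e₁, either it is kept or an independent e₂ is drawn from all edges. The second case
    -- therefore contributes the full average of `f`, weighted by the probability 1 - p that e₁ is
    -- rejected.
    avg-chosen : ∀ f → avg rounds (λ r → f (chosen r)) ≈
      avg edges (λ e → ⟦ solitary e ⟧ * f e) + (1# - p) * avg edges f
    avg-chosen f = begin-equality
      avg rounds (λ r → f (chosen r))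
        ≈⟨ avg-cartesianProductWith _,_ edges edges 0<∣edges∣ 0<∣edges∣ _ ⟩
      avg edges (λ e₁ → avg edges (λ e₂ → f (chosen (e₁ , e₂))))
        ≈⟨ avg-cong edges inner ⟩
      avg edges (λ e → ⟦ solitary e ⟧ * f e + (A + - A * ⟦ solitary e ⟧))
        ≈⟨ ≈-trans (avg-+ edges _ _) (+-congˡ (≈-trans (avg-+ edges _ _) (+-cong (avg-const edges 0<∣edges∣ A)
            (avg-* edges (- A) _)))) ⟩
      avg edges (λ e → ⟦ solitary e ⟧ * f e) + (A + - A * p)
        ≈⟨ +-congˡ (solve 2 (λ a p → a :+ :- a :* p := (# 1 :- p) :* a) ≈-refl A p) ⟩
      avg edges (λ e → ⟦ solitary e ⟧ * f e) + (1# - p) * A ∎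
      where
      A = avg edges f
      inner : ∀ e₁ → avg edges (λ e₂ → f (chosen (e₁ , e₂))) ≈ ⟦ solitary e₁ ⟧ * f e₁ + (A + - A * ⟦ solitary e₁ ⟧)
      inner e₁ with solitary e₁
      ... | true  = ≈-trans (avg-const edges 0<∣edges∣ (f e₁)) (solve 2 (λ f a → f := # 1 :* f :+
          (a :+ :- a :* # 1)) ≈-refl (f e₁) A)
      ... | false = solve 2 (λ f a → a := # 0 :* f :+ (a :+ :- a :* # 0)) ≈-refl (f e₁) A

    module _ {f : Edge n → Carrier} {δ : Carrier}
             (f≈δ : ∀ {e} → e ∈ edges → ⟦ solitary e ⟧ * f e ≈ ⟦ solitary e ⟧ * δ) where

      avg-chosen-δ : avg rounds (λ r → f (chosen r)) ≈ p * δ + (1# - p) * avg edges f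
      avg-chosen-δ = ≈-trans (avg-chosen f) (+-congʳ (begin-equality
        avg edges (λ e → ⟦ solitary e ⟧ * f e)   ≈⟨ avg-cong-∈ edges (λ i → ≈-trans (f≈δ i) (*-comm _ δ)) ⟩
        avg edges (λ e → δ * ⟦ solitary e ⟧)     ≈⟨ avg-* edges δ _ ⟩
        δ * p                                    ≈⟨ *-comm δ p ⟩
        p * δ                                    ∎))

      -- On solitary edges the increment is the constant δ. The error splits into (p - x²) (δ - g),
      -- controlled by `p≈x²`, and 1 - p times the error of `g` as an edge average.
      drift : ∀ {g η} → abs (avg edges f - g) ≤ η →
        abs (avg rounds (λ r → f (chosen r)) - (x ² * δ + (1# - x ²) * g)) ≤ h * (abs δ + abs g) + η
      drift {g} {η} A≈g = begin
        abs (avg rounds (λ r → f (chosen r)) - (x ² * δ + (1# - x ²) * g))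
          ≈⟨ abs-cong (+-congʳ avg-chosen-δ) ⟩
        abs ((p * δ + (1# - p) * A) - (x ² * δ + (1# - x ²) * g))
          ≈⟨ abs-cong (solve 5 (λ p δ a q g → p :* δ :+ (# 1 :- p) :* a :- (q :* δ :+ (# 1 :- q) :* g) :=
               (p :- q) :* (δ :- g) :+ (# 1 :- p) :* (a :- g)) ≈-refl p δ A (x ²) g) ⟩
        abs ((p - x ²) * (δ - g) + (1# - p) * (A - g))
          ≤⟨ ≤-trans (abs-+ _ _) (≤-reflexive (+-cong (abs-* _ _) (≈-trans (abs-* _ _) (*-congʳ (abs-nonneg 0≤1-p))))) ⟩
        abs (p - x ²) * abs (δ - g) + (1# - p) * abs (A - g)
          ≤⟨ +-mono-≤ (*-mono-≤ 0≤h (0≤abs _) p≈x² (≤-trans (abs-+ δ (- g)) (+-monoʳ-≤ _ (≤-reflexive (abs-neg g)))))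
               (≤-trans (*-monoʳ-≤ _ (0≤abs _) (≤-+ 0≤p (solve 1 (λ p → # 1 := # 1 :- p :+ p) ≈-refl p)))
                 (≤-trans (≤-reflexive (*-identityˡ _)) A≈g)) ⟩
        h * (abs δ + abs g) + η ∎
        where
        A = avg edges f
        0≤1-p = x≤y⇒0≤y-x p≤1

    squares-δ : ∀ {f : Edge n → Carrier} {δ} → (∀ {e} → e ∈ edges → ⟦ solitary e ⟧ * f e ≈ ⟦ solitary e ⟧ * δ) →
      ∀ {e} → e ∈ edges → ⟦ solitary e ⟧ * f e ² ≈ ⟦ solitary e ⟧ * δ ²
    squares-δ {f} {δ} f≈δ {e} i = begin-equality
      ⟦ solitary e ⟧ * (f e * f e)    ≈⟨ *-assoc _ _ _ ⟨
      ⟦ solitary e ⟧ * f e * f e      ≈⟨ *-congʳ (f≈δ i) ⟩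
      ⟦ solitary e ⟧ * δ * f e        ≈⟨ solve 3 (λ s d f → s :* d :* f := s :* f :* d) ≈-refl _ δ (f e) ⟩
      ⟦ solitary e ⟧ * f e * δ        ≈⟨ *-congʳ (f≈δ i) ⟩
      ⟦ solitary e ⟧ * δ * δ          ≈⟨ *-assoc _ _ _ ⟩
      ⟦ solitary e ⟧ * (δ * δ)        ∎

    square : ∀ {f : Edge n → Carrier} {δ} → (∀ {e} → e ∈ edges → ⟦ solitary e ⟧ * f e ≈ ⟦ solitary e ⟧ * δ) →
      avg rounds (λ r → f (chosen r) ²) ≤ δ ² + avg edges (λ e → f e ²)
    square {f} {δ} f≈δ = ≤-trans (≤-reflexive (avg-chosen-δ (squares-δ f≈δ)))
      (convex≤ 0≤p p≤1 (²-nonneg δ) (avg-nonneg edges (λ e → ²-nonneg (f e))))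

    solitary-isolated : ∀ a b → solitary (a , b) ≡ true → Isolated G a × Isolated G b
    solitary-isolated a b eq with isolated? G a | isolated? G b
    ... | yes p | yes q = p , q

    isolatedLoss : Edge n → Carrier
    isolatedLoss (a , b) = - (⟦ alone G a ⟧ + ⟦ alone G b ⟧)

    isolatedLoss-solitary : ∀ {e} → e ∈ edges → ⟦ solitary e ⟧ * isolatedLoss e ≈ ⟦ solitary e ⟧ * - 2#
    isolatedLoss-solitary {a , b} _ with alone G a | alone G b
    ... | true  | true  = *-congˡ (-‿cong (solve 0 (# 1 :+ # 1 := # 2) ≈-refl))
    ... | true  | false = ≈-trans (zeroˡ _) (≈-sym (zeroˡ _))
    ... | false | _     = ≈-trans (zeroˡ _) (≈-sym (zeroˡ _))

    isolatedCount-bfStep : ∀ {r} → r ∈ rounds → isolatedCount (bfStep r G) ≈ isolatedCount G + isolatedLoss (chosen r)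
    isolatedCount-bfStep {r} i = ≈-trans (reflexive (≡.cong isolatedCount (bfStep≡ r)))
      (isolatedCount-∷ G _ _ (edge-distinct (chosen∈edges i)))

    -- The mean over pairs and the diagonal mean are both 2 x, so the error is h times a difference
    -- of two numbers between 0 and 2, here bounded by their sum.
    isolatedLoss-avg : abs (avg edges isolatedLoss - - (2# * x)) ≤ h * fromℕ 4
    isolatedLoss-avg = begin
      abs (avg edges isolatedLoss - - (2# * x))
        ≈⟨ abs-cong (+-congʳ (≈-trans (avg-cong edges (λ e → solve 1 (λ a → :- a := :- # 1 :* a) ≈-refl _))
            (avg-* edges (- 1#) _))) ⟩
      abs (- 1# * A - - (2# * x))
        ≈⟨ abs-cong (solve 2 (λ a m → :- # 1 :* a :- :- m := :- (a :- m)) ≈-refl A (2# * x)) ⟩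
      abs (- (A - 2# * x))
        ≈⟨ abs-neg _ ⟩
      abs (A - 2# * x)
        ≈⟨ abs-cong (+-congˡ (-‿cong mean²f)) ⟨
      abs (A - mean² f)
        ≈⟨ abs-cong (edge-avg-diff f (λ a b → +-comm (i a) (i b))) ⟩
      abs (h * (A - mean (λ a → f a a)))
        ≈⟨ ≈-trans (abs-* h _) (*-cong (abs-nonneg 0≤h) (abs-cong (+-congˡ (-‿cong diag)))) ⟩
      h * abs (A - 2# * x)
        ≤⟨ *-monoˡ-≤ h 0≤h (≤-trans (∣a-b∣≤a+b 0≤A (0≤* (<⇒≤ 0<2) 0≤x)) (+-mono-≤ A≤2 (*-monoˡ-≤ 2# (<⇒≤ 0<2) x≤1))) ⟩
      h * (2# + 2# * 1#)
        ≈⟨ *-congˡ (solve 0 (# 2 :+ # 2 :* # 1 := # 4) ≈-refl) ⟩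
      h * fromℕ 4 ∎
      where
      i : Fin n → Carrier
      i v = ⟦ alone G v ⟧
      f : Fin n → Fin n → Carrier
      f a b = i a + i b
      A = avg edges (uncurry f)
      0≤A : 0# ≤ A
      0≤A = avg-nonneg edges (λ (a , b) → 0≤+ (0≤⟦⟧ (alone G a)) (0≤⟦⟧ (alone G b)))
      A≤2 : A ≤ 2#
      A≤2 = ≤-trans (avg-mono edges (λ (a , b) → +-mono-≤ (⟦⟧≤1 (alone G a)) (⟦⟧≤1 (alone G b))))
        (≤-trans (≤-reflexive (avg-const edges 0<∣edges∣ _)) (≤-reflexive (solve 0 (# 1 :+ # 1 := # 2) ≈-refl)))
      2x : x + x ≈ 2# * x
      2x = solve 1 (λ x → x :+ x := # 2 :* x) ≈-refl x
      mean²f : mean² f ≈ 2# * x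
      mean²f = ≈-trans (mean²-+ (λ a b → i a) (λ a b → i b))
        (≈-trans (+-cong (avg-cong V (λ a → mean-const (i a))) (mean-const x)) 2x)
      diag : mean (λ a → f a a) ≈ 2# * x
      diag = ≈-trans (avg-+ V i i) 2x

    isolatedLoss-square : avg edges (λ e → isolatedLoss e ²) ≤ fromℕ 4
    isolatedLoss-square = ≤-trans (avg-mono edges bound) (≤-reflexive (avg-const edges 0<∣edges∣ _))
      where
      bound : ∀ e → isolatedLoss e ² ≤ fromℕ 4
      bound (a , b) = ≤-trans (≤-reflexive (solve 1 (λ z → :- z :* :- z := z :* z) ≈-refl _))
        (≤-trans (²-mono-≤ (0≤+ (0≤⟦⟧ (alone G a)) (0≤⟦⟧ (alone G b))) (+-mono-≤ (⟦⟧≤1 (alone G a)) (⟦⟧≤1 (alone G b))))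
          (≤-reflexive (solve 0 ((# 1 :+ # 1) :* (# 1 :+ # 1) := # 4) ≈-refl)))

    module _ (j : ℕ) where

      private
        K = gainBound j
        0≤K = 0≤gainBound j
        mg : Fin n → Fin n → Carrier
        mg a b = mergeGain (2 ℕ.+ j) (κ a) (κ b)

        0≤mg : ∀ a b → 0# ≤ mg a b
        0≤mg a b = 0≤mergeGain (1 ℕ.+ j) (0≤κ a) (0≤κ b)

        mg≤ : ∀ a b → mg a b ≤ K * (κ a ^ (1 ℕ.+ j) * κ b + κ a * κ b ^ (1 ℕ.+ j))
        mg≤ a b = mergeGain≤ j (0≤κ a) (0≤κ b)

        f : Fin n → Fin n → Carrier
        f a b = ⟦ not (joined G a b) ⟧ * mg a b

        f-sym : Symmetric f
        f-sym a b = *-cong (reflexive (≡.cong (λ c → ⟦ not c ⟧) (joined-sym G a b))) (mergeGain-comm (2 ℕ.+ j) (κ a) (κ b))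

        0≤f : ∀ a b → 0# ≤ f a b
        0≤f a b = 0≤* (0≤⟦⟧ (not (joined G a b))) (0≤mg a b)

        f≤mg : ∀ a b → f a b ≤ mg a b
        f≤mg a b = ≤-trans (*-monoʳ-≤ _ (0≤mg a b) (⟦⟧≤1 (not (joined G a b)))) (≤-reflexive (*-identityˡ _))

      δ : Carrier
      δ = mergeGain (2 ℕ.+ j) 1# 1#

      0≤δ : 0# ≤ δ
      0≤δ = 0≤mergeGain (1 ℕ.+ j) 0≤1 0≤1

      powerGain : Edge n → Carrier
      powerGain = uncurry f

      powerSum-bfStep : ∀ r → powerSum (1 ℕ.+ j) (bfStep r G) ≈ powerSum (1 ℕ.+ j) G + powerGain (chosen r)
      powerSum-bfStep r = ≈-trans (reflexive (≡.cong (powerSum (1 ℕ.+ j)) (bfStep≡ r)))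
        (powerSum-∷ G _ _ (1 ℕ.+ j))

      -- The ends of an edge are distinct; if both are isolated they lie in different components,
      -- each of size 1.
      powerGain-solitary : ∀ {e} → e ∈ edges → ⟦ solitary e ⟧ * powerGain e ≈ ⟦ solitary e ⟧ * δ
      powerGain-solitary {a , b} i with solitary (a , b) in eq
      ... | false = ≈-trans (zeroˡ _) (≈-sym (zeroˡ _))
      ... | true  = *-congˡ (≈-trans (*-cong
          (reflexive (≡.cong (λ c → ⟦ not c ⟧) (dec-false (connected? G a b) (λ a~b → edge-distinct i
              (isolated-connected iso-a a~b)))))
          (mergeGain-cong (2 ℕ.+ j) (size-isolated G a iso-a) (size-isolated G b iso-b)))
        (*-identityˡ δ))
        where
        iso-a = proj₁ (solitary-isolated a b eq)
        iso-b = proj₂ (solitary-isolated a b eq)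

      0≤avg-powerGain : 0# ≤ avg edges powerGain
      0≤avg-powerGain = avg-nonneg edges (λ (a , b) → 0≤f a b)

      avg-powerGain≤ : avg edges powerGain ≤ 2# * gain (2 ℕ.+ j)
      avg-powerGain≤ = ≤-trans (edge-avg≤2mean² f f-sym 0≤f) (*-monoˡ-≤ 2# (<⇒≤ 0<2) (mean²-mono f≤mg))

      private
        diag : mean (λ a → f a a) ≈ 0#
        diag = ≈-trans (avg-cong V (λ a → ≈-trans (*-congʳ (reflexive (≡.cong (λ c → ⟦ not c ⟧) (dec-true
            (connected? G a a) Star.ε)))) (zeroˡ _)))
          (mean-const 0#)

        -- The pairs inside one component, which the process cannot merge,
        -- carry only a fraction 1/n of the expected gain.
        inside : gain (2 ℕ.+ j) - mean² f ≤ h * (2# * K * moment (3 ℕ.+ j))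
        inside = begin
          gain (2 ℕ.+ j) - mean² f
            ≈⟨ +-congʳ (≈-trans (mean²-cong split) (mean²-+ f _)) ⟩
          (mean² f + mean² (λ a b → ⟦ joined G a b ⟧ * mg a b)) - mean² f
            ≈⟨ solve 2 (λ s t → s :+ t :- s := t) ≈-refl (mean² f) _ ⟩
          mean² (λ a b → ⟦ joined G a b ⟧ * mg a b)
            ≈⟨ avg-cong V (λ a → ≈-trans (mean≈ _) (*-congˡ (∑-cong V (own a)))) ⟩
          mean (λ a → h * ∑ V (λ b → mg a a * ⟦ joined G a b ⟧))
            ≈⟨ avg-cong V (λ a → *-congˡ (∑-* V (mg a a) _)) ⟩
          mean (λ a → h * (mg a a * κ a))
            ≈⟨ avg-* V h _ ⟩
          h * mean (λ a → mg a a * κ a)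
            ≤⟨ *-monoˡ-≤ h 0≤h (avg-mono V (λ a → ≤-trans (*-monoʳ-≤ _ (0≤κ a) (mg≤ a a))
                 (≤-reflexive (solve 3 (λ k s q → k :* (s :* q :* s :+ s :* (s :* q)) :* s := # 2 :* k :* (s :*
                     (s :* (s :* q))))
                   ≈-refl K (κ a) (κ a ^ j))))) ⟩
          h * mean (λ a → 2# * K * κ a ^ (3 ℕ.+ j))
            ≈⟨ *-congˡ (avg-* V _ _) ⟩
          h * (2# * K * moment (3 ℕ.+ j)) ∎
          where
          split : ∀ a b → mg a b ≈ f a b + ⟦ joined G a b ⟧ * mg a b
          split a b with joined G a b
          ... | true  = solve 1 (λ m → m := # 0 :* m :+ # 1 :* m) ≈-refl _
          ... | false = solve 1 (λ m → m := # 1 :* m :+ # 0 :* m) ≈-refl _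
          own : ∀ a b → ⟦ joined G a b ⟧ * mg a b ≈ mg a a * ⟦ joined G a b ⟧
          own a b with connected? G a b
          ... | yes a~b = ≈-trans (*-comm _ _) (*-congʳ (mergeGain-cong (2 ℕ.+ j) ≈-refl (≈-sym (size-class G a~b))))
          ... | no  _   = ≈-trans (zeroˡ _) (≈-sym (zeroʳ _))

      -- Two errors. Passing from edges to pairs costs h times the edge average, since the indicator
      -- vanishes on the diagonal; restoring the pairs inside one component costs `inside`.
      powerGain-avg : abs (avg edges powerGain - gain (2 ℕ.+ j)) ≤
        h * (2# * gain (2 ℕ.+ j) + 2# * K * moment (3 ℕ.+ j))
      powerGain-avg = begin
        abs (A - g)
          ≈⟨ abs-cong (solve 3 (λ a m g → a :- g := (a :- m) :+ :- (g :- m)) ≈-refl A (mean² f) g) ⟩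
        abs ((A - mean² f) + - (g - mean² f))
          ≤⟨ ≤-trans (abs-+ _ _) (+-monoʳ-≤ _ (≤-reflexive (abs-neg _))) ⟩
        abs (A - mean² f) + abs (g - mean² f)
          ≈⟨ +-cong (abs-cong (≈-trans (edge-avg-diff f f-sym) (*-congˡ (≈-trans (+-congˡ (-‿cong diag)) (solve 1
              (λ a → a :- # 0 := a) ≈-refl A)))))
               (abs-nonneg (x≤y⇒0≤y-x (mean²-mono f≤mg))) ⟩
        abs (h * A) + (g - mean² f)
          ≈⟨ +-congʳ (abs-nonneg (0≤* 0≤h 0≤avg-powerGain)) ⟩
        h * A + (g - mean² f)
          ≤⟨ +-mono-≤ (*-monoˡ-≤ h 0≤h avg-powerGain≤) inside ⟩
        h * (2# * g) + h * (2# * K * moment (3 ℕ.+ j))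
          ≈⟨ distribˡ h _ _ ⟨
        h * (2# * g + 2# * K * moment (3 ℕ.+ j)) ∎
        where
        A = avg edges powerGain
        g = gain (2 ℕ.+ j)

      -- Squaring the bound of `mergeGain≤` produces a^(2 (1 + j)) b². For j ≤ 2 the exponent is at
      -- most 6, and this is where s₇ enters.
      powerGain-square : avg edges (λ e → powerGain e ²) ≤ fromℕ 8 * (K ² * (moment (2 ℕ.* (1 ℕ.+ j)) * moment 2))
      powerGain-square = begin
        avg edges (λ e → powerGain e ²)
          ≤⟨ edge-avg≤2mean² (λ a b → f a b ²) (λ a b → *-cong (f-sym a b) (f-sym a b)) (λ a b → ²-nonneg (f a b)) ⟩
        2# * mean² (λ a b → f a b ²)
          ≤⟨ *-monoˡ-≤ 2# (<⇒≤ 0<2) (mean²-mono pointwise) ⟩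
        2# * mean² (λ a b → (2# * K ²) * (κ a ^ (2 ℕ.* (1 ℕ.+ j)) * κ b ^ 2 + κ a ^ 2 * κ b ^ (2 ℕ.* (1 ℕ.+ j))))
          ≈⟨ *-congˡ (mean²-symmetric (2# * K ²) (2 ℕ.* (1 ℕ.+ j)) 2) ⟩
        2# * (2# * K ² * (2# * (moment (2 ℕ.* (1 ℕ.+ j)) * moment 2)))
          ≈⟨ solve 2 (λ k m → # 2 :* (# 2 :* k :* (# 2 :* m)) := # 8 :* (k :* m)) ≈-refl (K ²) _ ⟩
        fromℕ 8 * (K ² * (moment (2 ℕ.* (1 ℕ.+ j)) * moment 2)) ∎
        where
        ^-double : ∀ y k → y ^ (2 ℕ.* k) ≈ (y ^ k) ²
        ^-double y zero    = ≈-sym (*-identityˡ 1#)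
        ^-double y (suc k) = begin-equality
          y * y ^ (k ℕ.+ suc (k ℕ.+ 0))   ≡⟨ ≡.cong (λ m → y * y ^ m) (ℕ.+-suc k (k ℕ.+ 0)) ⟩
          y * (y * y ^ (2 ℕ.* k))         ≈⟨ *-congˡ (*-congˡ (^-double y k)) ⟩
          y * (y * (y ^ k) ²)             ≈⟨ solve 2 (λ y p → y :* (y :* (p :* p)) := y :* p :* (y :* p)) ≈-refl y (y ^ k) ⟩
          (y * y ^ k) ²                   ∎
          where import Data.Nat.Properties as ℕ
        pointwise : ∀ a b → f a b ² ≤
          (2# * K ²) * (κ a ^ (2 ℕ.* (1 ℕ.+ j)) * κ b ^ 2 + κ a ^ 2 * κ b ^ (2 ℕ.* (1 ℕ.+ j)))
        pointwise a b = begin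
          f a b ²
            ≤⟨ ²-mono-≤ (0≤f a b) (≤-trans (f≤mg a b) (mg≤ a b)) ⟩
          (K * (P * κ b + κ a * Q)) ²
            ≈⟨ solve 5 (λ k p b a q → k :* (p :* b :+ a :* q) :* (k :* (p :* b :+ a :* q)) :=
                 k :* k :* ((p :* b :+ a :* q) :* (p :* b :+ a :* q))) ≈-refl K P (κ b) (κ a) Q ⟩
          K ² * (P * κ b + κ a * Q) ²
            ≤⟨ *-monoˡ-≤ _ (²-nonneg K) ([a+b]²≤2[a²+b²] _ _) ⟩
          K ² * (2# * ((P * κ b) ² + (κ a * Q) ²))
            ≈⟨ solve 5 (λ k p b a q → k :* (# 2 :* (p :* b :* (p :* b) :+ a :* q :* (a :* q))) :=
                 # 2 :* k :* (p :* p :* (b :* (b :* # 1)) :+ a :* (a :* # 1) :* (q :* q))) ≈-refl (K ²) P (κ b) (κ a) Q ⟩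
          2# * K ² * (P ² * κ b ^ 2 + κ a ^ 2 * Q ²)
            ≈⟨ *-congˡ (+-cong (*-congʳ (^-double (κ a) (1 ℕ.+ j))) (*-congˡ (^-double (κ b) (1 ℕ.+ j)))) ⟨
          2# * K ² * (κ a ^ (2 ℕ.* (1 ℕ.+ j)) * κ b ^ 2 + κ a ^ 2 * κ b ^ (2 ℕ.* (1 ℕ.+ j))) ∎
          where
          P = κ a ^ (1 ℕ.+ j)
          Q = κ b ^ (1 ℕ.+ j)

-- The limiting system: bounds, Lipschitz constants and a Taylor estimate.

module Trajectory (em : ExcludedMiddle 0ℓ) (R : RealNumbers) where

  open OrderedField R
  open Sums R
  open Analysis em R

  data Statistic : Set where
    isolates second third fourth : Statistic

  statistics : List Statistic
  statistics = isolates ∷ second ∷ third ∷ fourth ∷ []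

  ∈-statistics : ∀ i → i ∈ statistics
  ∈-statistics isolates = here refl
  ∈-statistics second   = there (here refl)
  ∈-statistics third    = there (there (here refl))
  ∈-statistics fourth   = there (there (there (here refl)))

  State : Set
  State = Statistic → Carrier

  drift-field : Statistic → State → Carrier
  drift-field isolates u = - (u isolates ^ 2) - (1# - u isolates ^ 2) * u isolates
  drift-field second   u = u isolates ^ 2 + (1# - u isolates ^ 2) * u second ^ 2
  drift-field third    u = fromℕ 3 * u isolates ^ 2 + fromℕ 3 * (1# - u isolates ^ 2) * u second * u third
  drift-field fourth   u = fromℕ 7 * u isolates ^ 2
    + (1# - u isolates ^ 2) * (fromℕ 4 * u second * u fourth + fromℕ 3 * u third ^ 2)

  distance : State → State → Carrier
  distance u v = ∑ statistics (λ i → abs (u i - v i))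

  0≤distance : ∀ u v → 0# ≤ distance u v
  0≤distance u v = ∑-nonneg statistics (λ i → 0≤abs (u i - v i))

  coordinate≤distance : ∀ u v i → abs (u i - v i) ≤ distance u v
  coordinate≤distance u v i = term≤∑ {f = λ i → abs (u i - v i)} (λ i → 0≤abs (u i - v i)) (∈-statistics i)

  -- The sum of the four nonnegative bounds serves as their maximum.
  uniformly : (P : Statistic → Carrier → Set) → (∀ i {K L} → K ≤ L → P i K → P i L) →
              (∀ i → ∃[ K ] 0# ≤ K × P i K) → ∃[ K ] 0# ≤ K × (∀ i → P i K)
  uniformly P mono each =
    ∑ statistics (λ i → proj₁ (each i)) , ∑-nonneg statistics (λ i → proj₁ (proj₂ (each i))) ,
    λ i → mono i (term≤∑ {f = λ i → proj₁ (each i)} (λ i → proj₁ (proj₂ (each i))) (∈-statistics i)) (proj₂ (proj₂ (each i)))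

  InBox : Carrier → State → Set
  InBox M u = ∀ i → abs (u i) ≤ M

  -- Bounded and Lipschitz on the box, with one constant for both. The class is closed under the
  -- ring operations, so the constants for the polynomials `drift-field` arise by composition.
  Tame : Carrier → (State → Carrier) → Carrier → Set
  Tame M f B = (∀ u → InBox M u → abs (f u) ≤ B) ×
               (∀ u v → InBox M u → InBox M v → abs (f u - f v) ≤ B * distance u v)

  Tame-mono : ∀ {M f B C} → B ≤ C → Tame M f B → Tame M f C
  Tame-mono B≤C (bd , lip) = (λ u u∈ → ≤-trans (bd u u∈) B≤C) ,
    (λ u v u∈ v∈ → ≤-trans (lip u v u∈ v∈) (*-monoʳ-≤ _ (0≤distance u v) B≤C))

  IsTame : Carrier → (State → Carrier) → Set
  IsTame M f = ∃[ B ] 0# ≤ B × Tame M f B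

  module _ {M : Carrier} where

    const-tame : ∀ c → IsTame M (λ _ → c)
    const-tame c = abs c , 0≤abs c , (λ _ _ → ≤-refl) , λ u v _ _ → ≤-trans
      (≤-reflexive (≈-trans (abs-cong (-‿inverseʳ c)) (abs-nonneg ≤-refl))) (0≤* (0≤abs c) (0≤distance u v))

    -- `abs M` accounts for the size of the coordinate and the summand 1 for its Lipschitz constant.
    proj-tame : ∀ i → IsTame M (λ u → u i)
    proj-tame i = abs M + 1# , 0≤+ (0≤abs M) 0≤1 ,
      (λ u u∈ → ≤-trans (u∈ i) (≤-trans (x≤abs M) (a≤a+b 0≤1))) ,
      λ u v _ _ → ≤-trans (coordinate≤distance u v i) (≤-trans (≤-reflexive (≈-sym (*-identityˡ _)))
        (*-monoʳ-≤ _ (0≤distance u v) (b≤a+b (0≤abs M))))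

    infixl 6 _+tame_ _∸tame_
    infixl 7 _*tame_
    infixr 8 _²tame

    -‿tame : ∀ {f} → IsTame M f → IsTame M (λ u → - f u)
    -‿tame {f} (B , 0≤B , bd , lip) = B , 0≤B , (λ u u∈ → ≤-trans (≤-reflexive (abs-neg (f u))) (bd u u∈)) ,
      λ u v u∈ v∈ → ≤-trans (≤-reflexive (≈-trans
        (abs-cong (solve 2 (λ x y → :- x :- :- y := :- (x :- y)) ≈-refl (f u) (f v))) (abs-neg _))) (lip u v u∈ v∈)

    _+tame_ : ∀ {f g} → IsTame M f → IsTame M g → IsTame M (λ u → f u + g u)
    _+tame_ {f} {g} (B , 0≤B , bd , lip) (C , 0≤C , bd′ , lip′) = B + C , 0≤+ 0≤B 0≤C ,
      (λ u u∈ → ≤-trans (abs-+ _ _) (+-mono-≤ (bd u u∈) (bd′ u u∈))) ,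
      λ u v u∈ v∈ → begin
        abs ((f u + g u) - (f v + g v))               ≈⟨ abs-cong (solve 4 (λ a b c d → a :+ b :- (c :+ d) :=
            (a :- c) :+ (b :- d)) ≈-refl (f u) (g u) (f v) (g v)) ⟩
        abs ((f u - f v) + (g u - g v))               ≤⟨ ≤-trans (abs-+ _ _) (+-mono-≤ (lip u v u∈ v∈) (lip′ u v u∈ v∈)) ⟩
        B * distance u v + C * distance u v           ≈⟨ distribʳ _ _ _ ⟨
        (B + C) * distance u v                        ∎

    _∸tame_ : ∀ {f g} → IsTame M f → IsTame M g → IsTame M (λ u → f u - g u)
    p ∸tame q = p +tame (-‿tame q)

    _*tame_ : ∀ {f g} → IsTame M f → IsTame M g → IsTame M (λ u → f u * g u)
    _*tame_ {f} {g} (B , 0≤B , bd , lip) (C , 0≤C , bd′ , lip′) = 2# * (B * C) , 0≤* (<⇒≤ 0<2) 0≤BC ,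
      (λ u u∈ → ≤-trans (≤-trans (≤-reflexive (abs-* _ _)) (*-mono-≤ 0≤B (0≤abs _) (bd u u∈) (bd′ u u∈)))
        (≤-+ 0≤BC (solve 1 (λ x → # 2 :* x := x :+ x) ≈-refl (B * C)))) ,
      λ u v u∈ v∈ → begin
        abs (f u * g u - f v * g v)
          ≈⟨ abs-cong (solve 4 (λ a b c d → a :* b :- c :* d := a :* (b :- d) :+ (a :- c) :* d) ≈-refl (f u) (g u)
              (f v) (g v)) ⟩
        abs (f u * (g u - g v) + (f u - f v) * g v)
          ≤⟨ ≤-trans (abs-+ _ _) (≤-reflexive (+-cong (abs-* _ _) (abs-* _ _))) ⟩
        abs (f u) * abs (g u - g v) + abs (f u - f v) * abs (g v)
          ≤⟨ +-mono-≤ (*-mono-≤ 0≤B (0≤abs _) (bd u u∈) (lip′ u v u∈ v∈))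
               (*-mono-≤ (0≤* 0≤B (0≤distance u v)) (0≤abs _) (lip u v u∈ v∈) (bd′ v v∈)) ⟩
        B * (C * distance u v) + B * distance u v * C
          ≈⟨ solve 3 (λ b c d → b :* (c :* d) :+ b :* d :* c := # 2 :* (b :* c) :* d) ≈-refl B C (distance u v) ⟩
        2# * (B * C) * distance u v ∎
      where 0≤BC = 0≤* 0≤B 0≤C

    _²tame : ∀ {f} → IsTame M f → IsTame M (λ u → f u ^ 2)
    p ²tame = p *tame (p *tame const-tame 1#)

    drift-field-tame : ∀ i → IsTame M (drift-field i)
    drift-field-tame = λ where
        isolates → -‿tame (x ²tame) ∸tame free *tame x
        second   → x ²tame +tame free *tame (s₂ ²tame)
        third    → const-tame (fromℕ 3) *tame x ²tame +tame const-tame (fromℕ 3) *tame free *tame s₂ *tame s₃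
        fourth   → const-tame (fromℕ 7) *tame x ²tame
                   +tame free *tame (const-tame (fromℕ 4) *tame s₂ *tame s₄ +tame const-tame (fromℕ 3) *tame s₃ ²tame)
      where
      x = proj-tame isolates
      s₂ = proj-tame second
      s₃ = proj-tame third
      s₄ = proj-tame fourth
      free = const-tame 1# ∸tame x ²tame

  -- The box in `tame` is wider by 1 than the one in `inBox`: it also holds every state whose
  -- coordinates are within 1 of the limit curve.
  record Estimates (ū : Statistic → Carrier → Carrier) (T : Carrier) : Set where
    field
      M B    : Carrier
      0≤T    : 0# ≤ T
      0≤M    : 0# ≤ M
      0≤B    : 0# ≤ B
      inBox  : ∀ i s → [ 0# , T ] s → abs (ū i s) ≤ M
      tame   : ∀ i → Tame (M + 1#) (drift-field i) B
      lipschitz : ∀ i {a b} → 0# ≤ a → a ≤ b → b ≤ T → abs (ū i b - ū i a) ≤ B * (b - a)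
      taylor : ∀ i {a b} → 0# ≤ a → a ≤ b → b ≤ T →
               abs (ū i b - ū i a - drift-field i (λ j → ū j a) * (b - a)) ≤ B * (b - a) ²

  estimates : (ū : Statistic → Carrier → Carrier) (T : Carrier) → 0# ≤ T →
    (∀ i → HasDerivativeOn [ 0# , T ] (ū i) (λ s → drift-field i (λ j → ū j s))) →
    Estimates ū T
  estimates ū T 0≤T ode = record
    { M = M ; B = L + 4L² ; 0≤T = 0≤T ; 0≤M = proj₁ (proj₂ boxed) ; 0≤B = 0≤+ 0≤L 0≤4L²
    ; inBox = inBox
    ; tame = λ i → Tame-mono {f = drift-field i} (a≤a+b 0≤4L²) (tame i)
    ; lipschitz = λ i p q r → ≤-trans (lipschitz i p q r) (*-monoʳ-≤ _ (x≤y⇒0≤y-x q) (a≤a+b 0≤4L²))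
    ; taylor = taylor
    }
    where
    inside : ∀ {a b} → 0# ≤ a → b ≤ T → ∀ u → [ a , b ] u → [ 0# , T ] u
    inside 0≤a b≤T u (a≤u , u≤b) = ≤-trans 0≤a a≤u , ≤-trans u≤b b≤T

    boxed = uniformly (λ i K → ∀ s → [ 0# , T ] s → abs (ū i s) ≤ K) (λ i K≤L p s s∈ → ≤-trans (p s s∈) K≤L)
      (λ i → bounded (ode i) 0≤T (λ u u∈ → u∈))
    M = proj₁ boxed
    inBox : ∀ i s → [ 0# , T ] s → abs (ū i s) ≤ M
    inBox = proj₂ (proj₂ boxed)

    tamed = uniformly (λ i B → Tame (M + 1#) (drift-field i) B) (λ i → Tame-mono {f = drift-field i}) drift-field-tame
    L = proj₁ tamed
    0≤L = proj₁ (proj₂ tamed)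
    tame : ∀ i → Tame (M + 1#) (drift-field i) L
    tame = proj₂ (proj₂ tamed)

    -- Bounds the rate at which the drift changes along the curve: four coordinates move with speed
    -- at most `L`, and the drift is Lipschitz with constant `L`.
    4L² = L * (fromℕ 4 * L)
    0≤4L² = 0≤* 0≤L (0≤* (0≤fromℕ 4) 0≤L)

    Φ : Statistic → Carrier → Carrier
    Φ i s = drift-field i (λ j → ū j s)

    box+1 : ∀ s → [ 0# , T ] s → InBox (M + 1#) (λ j → ū j s)
    box+1 s s∈ j = ≤-trans (inBox j s s∈) (a≤a+b 0≤1)

    x-0x : ∀ x y → x - 0# * y ≈ x
    x-0x = solve 2 (λ x y → x :- # 0 :* y := x) ≈-refl

    lipschitz : ∀ i {a b} → 0# ≤ a → a ≤ b → b ≤ T → abs (ū i b - ū i a) ≤ L * (b - a)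
    lipschitz i {a} {b} 0≤a a≤b b≤T = ≤-trans (≤-reflexive (abs-cong (≈-sym (x-0x _ (b - a)))))
      (mean-value-≤ (ode i) a≤b (inside 0≤a b≤T) 0# L (λ u u∈ → ≤-trans
        (≤-reflexive (abs-cong (solve 1 (λ x → x :- # 0 := x) ≈-refl (Φ i u))))
        (proj₁ (tame i) (λ j → ū j u) (box+1 u (inside 0≤a b≤T u u∈)))))

    distance≤ : ∀ {a b} → 0# ≤ a → a ≤ b → b ≤ T → distance (λ j → ū j b) (λ j → ū j a) ≤ fromℕ 4 * (L * (b - a))
    distance≤ 0≤a a≤b b≤T = ≤-trans (∑-mono-∈ statistics (λ {i} _ → lipschitz i 0≤a a≤b b≤T)) (≤-reflexive
        (∑-const statistics _))

    -- The mean value inequality with the slope at `a`: on the whole interval the derivative departs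
    -- from it by at most 4L² (b - a).
    taylor : ∀ i {a b} → 0# ≤ a → a ≤ b → b ≤ T → abs (ū i b - ū i a - Φ i a * (b - a)) ≤ (L + 4L²) * (b - a) ²
    taylor i {a} {b} 0≤a a≤b b≤T = begin
      abs (ū i b - ū i a - Φ i a * (b - a))
        ≤⟨ mean-value-≤ (ode i) a≤b (inside 0≤a b≤T) (Φ i a) (4L² * (b - a)) close ⟩
      4L² * (b - a) * (b - a)
        ≈⟨ *-assoc _ _ _ ⟩
      4L² * (b - a) ²
        ≤⟨ *-monoʳ-≤ _ (²-nonneg (b - a)) (b≤a+b 0≤L) ⟩
      (L + 4L²) * (b - a) ² ∎
      where
      close : ∀ u → [ a , b ] u → abs (Φ i u - Φ i a) ≤ 4L² * (b - a)
      close u (a≤u , u≤b) = begin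
        abs (Φ i u - Φ i a)
          ≤⟨ proj₂ (tame i) _ _ (box+1 u (≤-trans 0≤a a≤u , ≤-trans u≤b b≤T)) (box+1 a (0≤a , ≤-trans a≤b b≤T)) ⟩
        L * distance (λ j → ū j u) (λ j → ū j a)
          ≤⟨ *-monoˡ-≤ L 0≤L (distance≤ 0≤a a≤u (≤-trans u≤b b≤T)) ⟩
        L * (fromℕ 4 * (L * (u - a)))
          ≤⟨ *-monoˡ-≤ L 0≤L (*-monoˡ-≤ _ (0≤fromℕ 4) (*-monoˡ-≤ L 0≤L (+-monoˡ-≤ (- a) u≤b))) ⟩
        L * (fromℕ 4 * (L * (b - a)))
          ≈⟨ solve 3 (λ l f d → l :* (f :* (l :* d)) := l :* (f :* l) :* d) ≈-refl L (fromℕ 4) (b - a) ⟩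
        4L² * (b - a) ∎

-- The one-round inequality for the Lyapunov function.

module Lyapunov (em : ExcludedMiddle 0ℓ) (R : RealNumbers) where

  open OrderedField R
  open Sums R
  open Components R
  open EdgeAverages R
  open MergeGain R
  open OneRound R
  open Trajectory em R

  -- The square (hΔ - η)² is bounded by 2 h² Δ² + 2 η², with slack (hΔ + η)². The cross term stays
  -- exact, because the cancellation between drift and η shows only after averaging.
  avg-square : ∀ {A : Set} (xs : List A) → 0# < fromℕ (length xs) → ∀ (Δ : A → Carrier) h z η →
    avg xs (λ r → (z + (h * Δ r - η)) ²) ≤
    z ² + 2# * (z * (h * avg xs Δ - η)) + 2# * (h ² * avg xs (λ r → Δ r ²)) + 2# * η ²
  avg-square xs 0<∣xs∣ Δ h z η = begin
    avg xs (λ r → (z + (h * Δ r - η)) ²)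
      ≤⟨ avg-mono xs pointwise ⟩
    avg xs (λ r → c + (2# * (z * h) * Δ r + 2# * h ² * Δ r ²))
      ≈⟨ ≈-trans (avg-+ xs _ _) (+-cong (avg-const xs 0<∣xs∣ c) (≈-trans (avg-+ xs _ _) (+-cong (avg-* xs _ _)
          (avg-* xs _ _)))) ⟩
    c + (2# * (z * h) * avg xs Δ + 2# * h ² * avg xs (λ r → Δ r ²))
      ≈⟨ solve 5 (λ z h η m q →
           z :* z :- # 2 :* (z :* η) :+ # 2 :* (η :* η) :+ (# 2 :* (z :* h) :* m :+ # 2 :* (h :* h) :* q) :=
           z :* z :+ # 2 :* (z :* (h :* m :- η)) :+ # 2 :* (h :* h :* q) :+ # 2 :* (η :* η)) ≈-refl z h η (avg xs Δ) _ ⟩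
    z ² + 2# * (z * (h * avg xs Δ - η)) + 2# * (h ² * avg xs (λ r → Δ r ²)) + 2# * η ² ∎
    where
    c = z ² - 2# * (z * η) + 2# * η ²
    pointwise : ∀ r → (z + (h * Δ r - η)) ² ≤ c + (2# * (z * h) * Δ r + 2# * h ² * Δ r ²)
    pointwise r = ≤-+ (²-nonneg (h * Δ r + η)) (solve 4 (λ z h η d →
        z :* z :- # 2 :* (z :* η) :+ # 2 :* (η :* η) :+ (# 2 :* (z :* h) :* d :+ # 2 :* (h :* h) :* (d :* d)) :=
        (z :+ (h :* d :- η)) :* (z :+ (h :* d :- η)) :+ (h :* d :+ η) :* (h :* d :+ η)) ≈-refl z h η (Δ r))

  -- Here 12 = 2 · 5 + 2 and 72 = 2 · 36, where the 5 and the 36 = 6² come from the bounds for h m -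
  -- η and η² in `square-step`.
  squareConstant : Carrier → Carrier
  squareConstant B = fromℕ 12 * B + fromℕ 72 * B ²

  -- z is the current deviation, m and q are the first two moments of the
  -- increment of the process, and η is the increment of the limit.
  square-step : ∀ {B h w z d m q η F F̄} → 0# ≤ B → 0# ≤ h → h ≤ 1# → 1# ≤ w → 0# ≤ d →
    abs (m - 2# * F) ≤ B * (h * w) → q ≤ B * w → abs (η - F̄ * (2# * h)) ≤ B * (2# * h) ² →
    abs (F - F̄) ≤ B * d → abs F̄ ≤ B → abs z ≤ 1# → abs z ≤ d →
    z ² + 2# * (z * (h * m - η)) + 2# * (h ² * q) + 2# * η ² ≤ z ² + h * (squareConstant B * (d ² + h * w))
  square-step {B} {h} {w} {z} {d} {m} {q} {η} {F} {F̄} 0≤B 0≤h h≤1 1≤w 0≤d m≈ q≤ η≈ F≈F̄ F̄≤B z≤1 z≤d = begin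
    z ² + 2# * (z * (h * m - η)) + 2# * (h ² * q) + 2# * η ²
      ≤⟨ +-mono-≤ (+-mono-≤ (+-monoʳ-≤ (z ²) (*-monoˡ-≤ 2# 0≤2 cross≤)) (*-monoˡ-≤ 2# 0≤2 (*-monoˡ-≤ _
          (²-nonneg h) q≤))) (*-monoˡ-≤ 2# 0≤2 η²≤) ⟩
    z ² + 2# * (fromℕ 5 * B * h ² * w + 2# * B * h * d ²) + 2# * (h ² * (B * w)) + 2# * (fromℕ 36 * B ² * h ² * w)
      ≤⟨ ≤-+ (0≤+ (0≤* (0≤* (0≤* (0≤fromℕ 8) 0≤B) 0≤h) (²-nonneg d)) (0≤* (0≤* (0≤* (0≤fromℕ 72)
          (²-nonneg B)) 0≤h) (²-nonneg d)))
          (solve 5 (λ z b h w d →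
            z :* z :+ h :* ((# 12 :* b :+ # 72 :* (b :* b)) :* (d :* d :+ h :* w)) :=
            z :* z :+ # 2 :* (# 5 :* b :* (h :* h) :* w :+ # 2 :* b :* h :* (d :* d)) :+ # 2 :* (h :* h :* (b :* w))
            :+ # 2 :* (# 36 :* (b :* b) :* (h :* h) :* w)
            :+ (# 8 :* b :* h :* (d :* d) :+ # 72 :* (b :* b) :* h :* (d :* d))) ≈-refl z B h w d) ⟩
    z ² + h * (squareConstant B * (d ² + h * w)) ∎
    where
    0≤2 = <⇒≤ 0<2
    0≤w = ≤-trans 0≤1 1≤w
    0≤w-1 = x≤y⇒0≤y-x 1≤w
    0≤1-h = x≤y⇒0≤y-x h≤1
    0≤Bh² = 0≤* 0≤B (²-nonneg h)

    -- The 5 is 1 for the drift error plus 4 for the Taylor error (2h)², which w ≥ 1 absorbs.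
    ∣hm-η∣≤ : abs (h * m - η) ≤ fromℕ 5 * B * h ² * w + 2# * B * h * d
    ∣hm-η∣≤ = begin
      abs (h * m - η)
        ≈⟨ abs-cong (solve 5 (λ h m η f g → h :* m :- η := h :* (m :- # 2 :* f) :+ (# 2 :* h :* (f :- g) :+ :-
            (η :- g :* (# 2 :* h)))) ≈-refl h m η F F̄) ⟩
      abs (h * (m - 2# * F) + (2# * h * (F - F̄) + - (η - F̄ * (2# * h))))
        ≤⟨ ≤-trans (abs-+ _ _) (+-monoʳ-≤ _ (abs-+ _ _)) ⟩
      abs (h * (m - 2# * F)) + (abs (2# * h * (F - F̄)) + abs (- (η - F̄ * (2# * h))))
        ≈⟨ +-cong (≈-trans (abs-* _ _) (*-congʳ (abs-nonneg 0≤h)))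
             (+-cong (≈-trans (abs-* _ _) (*-congʳ (abs-nonneg (0≤* 0≤2 0≤h)))) (abs-neg _)) ⟩
      h * abs (m - 2# * F) + (2# * h * abs (F - F̄) + abs (η - F̄ * (2# * h)))
        ≤⟨ +-mono-≤ (*-monoˡ-≤ h 0≤h m≈) (+-mono-≤ (*-monoˡ-≤ _ (0≤* 0≤2 0≤h) F≈F̄) η≈) ⟩
      h * (B * (h * w)) + (2# * h * (B * d) + B * (2# * h) ²)
        ≤⟨ ≤-+ (0≤* (0≤* (0≤fromℕ 4) 0≤Bh²) 0≤w-1) (solve 4 (λ b h w d →
             # 5 :* b :* (h :* h) :* w :+ # 2 :* b :* h :* d :=
             h :* (b :* (h :* w)) :+ (# 2 :* h :* (b :* d) :+ b :* (# 2 :* h :* (# 2 :* h))) :+ # 4 :* (b :*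
                 (h :* h)) :* (w :- # 1)) ≈-refl B h w d) ⟩
      fromℕ 5 * B * h ² * w + 2# * B * h * d ∎

    -- The bound |z| ≤ 1 is spent on the term in h², and |z| ≤ d on the term linear in d, which
    -- thereby becomes quadratic.
    cross≤ : z * (h * m - η) ≤ fromℕ 5 * B * h ² * w + 2# * B * h * d ²
    cross≤ = begin
      z * (h * m - η)
        ≤⟨ ≤-trans (x≤abs _) (≤-reflexive (abs-* _ _)) ⟩
      abs z * abs (h * m - η)
        ≤⟨ *-monoˡ-≤ _ (0≤abs z) ∣hm-η∣≤ ⟩
      abs z * (fromℕ 5 * B * h ² * w + 2# * B * h * d)
        ≈⟨ distribˡ _ _ _ ⟩
      abs z * (fromℕ 5 * B * h ² * w) + abs z * (2# * B * h * d)
        ≤⟨ +-mono-≤ (*-monoʳ-≤ _ (0≤* (0≤* (0≤* (0≤fromℕ 5) 0≤B) (²-nonneg h)) 0≤w) z≤1)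
             (*-monoʳ-≤ _ (0≤* (0≤* (0≤* 0≤2 0≤B) 0≤h) 0≤d) z≤d) ⟩
      1# * (fromℕ 5 * B * h ² * w) + d * (2# * B * h * d)
        ≈⟨ solve 3 (λ c k d → # 1 :* c :+ d :* (k :* d) := c :+ k :* (d :* d)) ≈-refl (fromℕ 5 * B * h ² * w)
            (2# * B * h) d ⟩
      fromℕ 5 * B * h ² * w + 2# * B * h * d ² ∎

    -- The 6 is 4 + 2, where h ≤ 1 reduces the quadratic Taylor error to a linear one.
    ∣η∣≤ : abs η ≤ fromℕ 6 * B * h
    ∣η∣≤ = begin
      abs η
        ≈⟨ abs-cong (solve 2 (λ η g → η := (η :- g) :+ g) ≈-refl η (F̄ * (2# * h))) ⟩
      abs ((η - F̄ * (2# * h)) + F̄ * (2# * h))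
        ≤⟨ ≤-trans (abs-+ _ _) (+-monoʳ-≤ _ (≤-reflexive (≈-trans (abs-* _ _) (*-congˡ (abs-nonneg (0≤* 0≤2 0≤h)))))) ⟩
      abs (η - F̄ * (2# * h)) + abs F̄ * (2# * h)
        ≤⟨ +-mono-≤ η≈ (*-monoʳ-≤ _ (0≤* 0≤2 0≤h) F̄≤B) ⟩
      B * (2# * h) ² + B * (2# * h)
        ≤⟨ ≤-+ (0≤* (0≤* (0≤* (0≤fromℕ 4) 0≤B) 0≤h) 0≤1-h) (solve 2 (λ b h →
             # 6 :* b :* h := b :* (# 2 :* h :* (# 2 :* h)) :+ b :* (# 2 :* h) :+ # 4 :* b :* h :* (# 1 :- h)) ≈-refl B h) ⟩
      fromℕ 6 * B * h ∎

    η²≤ : η ² ≤ fromℕ 36 * B ² * h ² * w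
    η²≤ = begin
      η ²                                   ≈⟨ abs-² η ⟨
      abs η ²                               ≤⟨ ²-mono-≤ (0≤abs η) ∣η∣≤ ⟩
      (fromℕ 6 * B * h) ²                   ≤⟨ ≤-+ (0≤* (0≤* (0≤* (0≤fromℕ 36) (²-nonneg B)) (²-nonneg h)) 0≤w-1)
                                                (solve 3 (λ b h w → # 36 :* (b :* b) :* (h :* h) :* w :=
                                                  # 6 :* b :* h :* (# 6 :* b :* h) :+ # 36 :* (b :* b) :*
                                                      (h :* h) :* (w :- # 1)) ≈-refl B h w) ⟩
      fromℕ 36 * B ² * h ² * w              ∎

  squaredDistance : State → State → Carrier
  squaredDistance u v = ∑ statistics (λ i → (u i - v i) ²)

  -- The Cauchy-Schwarz inequality for four terms, by pairing twice.
  distance²≤ : ∀ u v → distance u v ² ≤ fromℕ 4 * squaredDistance u v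
  distance²≤ u v = begin
    (a + (b + (c + (d + 0#)))) ²
      ≈⟨ solve 4 (λ a b c d → (a :+ (b :+ (c :+ (d :+ # 0)))) :* (a :+ (b :+ (c :+ (d :+ # 0)))) :=
           ((a :+ b) :+ (c :+ d)) :* ((a :+ b) :+ (c :+ d))) ≈-refl a b c d ⟩
    ((a + b) + (c + d)) ²
      ≤⟨ [a+b]²≤2[a²+b²] _ _ ⟩
    2# * ((a + b) ² + (c + d) ²)
      ≤⟨ *-monoˡ-≤ 2# (<⇒≤ 0<2) (+-mono-≤ ([a+b]²≤2[a²+b²] a b) ([a+b]²≤2[a²+b²] c d)) ⟩
    2# * (2# * (a ² + b ²) + 2# * (c ² + d ²))
      ≈⟨ solve 4 (λ a b c d → # 2 :* (# 2 :* (a :+ b) :+ # 2 :* (c :+ d)) := # 4 :* (a :+ (b :+ (c :+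
          (d :+ # 0))))) ≈-refl (a ²) (b ²) (c ²) (d ²) ⟩
    fromℕ 4 * (a ² + (b ² + (c ² + (d ² + 0#))))
      ≈⟨ *-congˡ (+-cong (abs-² _) (+-cong (abs-² _) (+-cong (abs-² _) (+-congʳ (abs-² _))))) ⟩
    fromℕ 4 * squaredDistance u v ∎
    where
    a = abs (u isolates - v isolates)
    b = abs (u second - v second)
    c = abs (u third - v third)
    d = abs (u fourth - v fourth)

  module _ {n : ℕ} where

    open Means n

    state : Graph n → State
    state G isolates = mean (λ v → ⟦ alone G v ⟧)
    state G second   = mean (λ v → size G v ^ 1)
    state G third    = mean (λ v → size G v ^ 2)
    state G fourth   = mean (λ v → size G v ^ 3)

    -- The seventh susceptibility: it dominates the second moments of all the
    -- increments, and it occurs in the Lyapunov function with the factor 1/n.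
    seventh : Graph n → Carrier
    seventh G = mean (λ v → size G v ^ 6)

    lyapunov : State → Graph n → Carrier
    lyapunov ū G = squaredDistance (state G) ū + fromℕ n ⁻¹ * seventh G

  module Constants (N : Carrier) (1≤N : 1# ≤ N) where

    0≤N : 0# ≤ N
    0≤N = ≤-trans 0≤1 1≤N

    -- The largest of the constants for the merge exponents 2, 3 and 4.
    K : Carrier
    K = gainBound 2

    0≤K : 0# ≤ K
    0≤K = 0≤gainBound 2

    -- `2# * K` covers the constant gain of a solitary edge and the pairs inside one component; the
    -- other summand is three times the bound 2 K N² for `gain`.
    driftConstant : Carrier
    driftConstant = 2# * K + fromℕ 6 * K * N ²

    0≤driftConstant : 0# ≤ driftConstant
    0≤driftConstant = 0≤+ (0≤* (<⇒≤ 0<2) 0≤K) (0≤* (0≤* (0≤fromℕ 6) 0≤K) (²-nonneg N))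

    varianceConstant : Carrier
    varianceConstant = fromℕ 4 * K ² + fromℕ 8 * K ² * N

    0≤varianceConstant : 0# ≤ varianceConstant
    0≤varianceConstant = 0≤+ (0≤* (0≤fromℕ 4) (²-nonneg K)) (0≤* (0≤* (0≤fromℕ 8) (²-nonneg K)) 0≤N)

    -- The summand 8 takes care of the isolated vertices.
    incrementConstant : Carrier
    incrementConstant = fromℕ 8 + (driftConstant + varianceConstant)

    0≤incrementConstant : 0# ≤ incrementConstant
    0≤incrementConstant = 0≤+ (0≤fromℕ 8) (0≤+ 0≤driftConstant 0≤varianceConstant)

    seventhConstant : Carrier
    seventhConstant = 2# * gainBound 5 * (1# + 2# * N)

    0≤seventhConstant : 0# ≤ seventhConstant
    0≤seventhConstant = 0≤* (0≤* (<⇒≤ 0<2) (0≤gainBound 5)) (0≤+ 0≤1 (0≤* (<⇒≤ 0<2) 0≤N))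

  module Increments (n : ℕ) (2≤n : 2 ℕ.≤ n) (G : Graph n) (N : Carrier) (1≤N : 1# ≤ N) (box : InBox N (state G)) where

    open AtGraph n 2≤n G
    open Constants N 1≤N

    -- The summand 1 lets one weight dominate both the constant errors and those of order s₇.
    w : Carrier
    w = 1# + moment 6

    1≤w : 1# ≤ w
    1≤w = a≤a+b (0≤moment 6)

    -- `Δ` is the change of the sum over vertices, before division by n; the factor 2 in `drift≤`
    -- reflects that a round lasts 2h.
    record Increment (i : Statistic) : Set where
      field
        Δ : Round n → Carrier
        step : ∀ {r} → r ∈ rounds → state (bfStep r G) i ≈ state G i + h * Δ r
        drift≤ : abs (avg rounds Δ - 2# * drift-field i (state G)) ≤ incrementConstant * (h * w)
        square≤ : avg rounds (λ r → Δ r ²) ≤ incrementConstant * w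

    private
      8≤C : fromℕ 8 ≤ incrementConstant
      8≤C = a≤a+b (0≤+ 0≤driftConstant 0≤varianceConstant)

      mean-step : ∀ {f g : Fin n → Carrier} {c} → ∑ (allFin n) f ≈ ∑ (allFin n) g + c → mean f ≈ mean g + h * c
      mean-step {f} {g} {c} e = ≈-trans (mean≈ f) (≈-trans (*-congˡ e) (≈-trans (distribˡ h _ c) (+-congʳ (≈-sym
          (mean≈ g)))))

    isolates-increment : Increment isolates
    isolates-increment = record
      { Δ = λ r → isolatedLoss (chosen r)
      ; step = λ i → mean-step (isolatedCount-bfStep i)
      ; drift≤ = begin
          abs (avg rounds (λ r → isolatedLoss (chosen r)) - 2# * drift-field isolates (state G))
            ≈⟨ abs-cong (+-congˡ (-‿cong (solve 1 (λ x → # 2 :* (:- (x :* (x :* # 1)) :- (# 1 :- x :* (x :* # 1)) :* x) :=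
                 x :* x :* :- # 2 :+ (# 1 :- x :* x) :* :- (# 2 :* x)) ≈-refl x))) ⟩
          abs (avg rounds (λ r → isolatedLoss (chosen r)) - (x ² * - 2# + (1# - x ²) * - (2# * x)))
            ≤⟨ drift isolatedLoss-solitary isolatedLoss-avg ⟩
          h * (abs (- 2#) + abs (- (2# * x))) + h * fromℕ 4
            ≤⟨ +-monoˡ-≤ _ (*-monoˡ-≤ h 0≤h (+-mono-≤ (≤-reflexive (≈-trans (abs-neg 2#) (abs-nonneg 0≤2)))
                 (≤-trans (≤-reflexive (≈-trans (abs-neg _) (abs-nonneg (0≤* 0≤2 0≤x)))) (*-monoˡ-≤ 2# 0≤2 x≤1)))) ⟩
          h * (2# + 2# * 1#) + h * fromℕ 4
            ≈⟨ solve 1 (λ h → h :* (# 2 :+ # 2 :* # 1) :+ h :* # 4 := # 8 :* h) ≈-refl h ⟩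
          fromℕ 8 * h
            ≤⟨ *-mono-≤ (≤-trans (0≤fromℕ 8) 8≤C) 0≤h 8≤C (≤-trans (≤-reflexive (≈-sym (*-identityʳ h)))
                (*-monoˡ-≤ h 0≤h 1≤w)) ⟩
          incrementConstant * (h * w) ∎
      ; square≤ = begin
          avg rounds (λ r → isolatedLoss (chosen r) ²)
            ≤⟨ square isolatedLoss-solitary ⟩
          (- 2#) ² + avg edges (λ e → isolatedLoss e ²)
            ≤⟨ +-monoʳ-≤ _ isolatedLoss-square ⟩
          (- 2#) ² + fromℕ 4
            ≈⟨ solve 0 (:- # 2 :* :- # 2 :+ # 4 := # 8 :* # 1) ≈-refl ⟩
          fromℕ 8 * 1#
            ≤⟨ *-mono-≤ (≤-trans (0≤fromℕ 8) 8≤C) 0≤1 8≤C 1≤w ⟩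
          incrementConstant * w ∎
      }
      where 0≤2 = <⇒≤ 0<2

    -- The cases j = 0, 1, 2 are s₂, s₃, s₄. The restriction on `j` keeps the exponents 3 + j and 2
    -- (1 + j) at most 6, so that `moment 6` dominates both error moments.
    module PowerIncrement (j : ℕ) (j≤2 : j ℕ.≤ 2) (m≤N : moment (1 ℕ.+ j) ≤ N) where

      private
        k = gainBound j
        0≤2 = <⇒≤ 0<2

        gainBound-mono : ∀ {i} → i ℕ.≤ 2 → gainBound i ≤ K
        gainBound-mono {zero} _ = ≤-trans (gainBound≤suc 0) (gainBound≤suc 1)
        gainBound-mono {suc zero} _ = gainBound≤suc 1
        gainBound-mono {suc (suc zero)} _ = ≤-refl
        gainBound-mono {suc (suc (suc i))} (s≤s (s≤s ()))

        k≤K : k ≤ K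
        k≤K = gainBound-mono j≤2

        moment1≤N : moment 1 ≤ N
        moment1≤N = ≤-trans (x≤abs _) (box second)

        moment2≤N : moment 2 ≤ N
        moment2≤N = ≤-trans (x≤abs _) (box third)

        δ≤ : δ j ≤ 2# * K
        δ≤ = ≤-trans (mergeGain-11≤ j) (*-monoˡ-≤ 2# 0≤2 k≤K)

        gain≤2KN² : gain (2 ℕ.+ j) ≤ 2# * (K * N ²)
        gain≤2KN² = begin
          gain (2 ℕ.+ j)                              ≤⟨ gain≤ j ⟩
          k * (2# * (moment (1 ℕ.+ j) * moment 1))    ≤⟨ *-mono-≤ 0≤K (0≤* 0≤2 (0≤* (0≤moment (1 ℕ.+ j)) (0≤moment 1))) k≤K
                                                           (*-monoˡ-≤ 2# 0≤2 (*-mono-≤ 0≤N (0≤moment 1) m≤N moment1≤N)) ⟩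
          K * (2# * (N * N))                          ≈⟨ solve 2 (λ k m → k :* (# 2 :* m) := # 2 :*
              (k :* m)) ≈-refl K (N ²) ⟩
          2# * (K * N ²)                              ∎

      gain-drift≤ : abs (avg rounds (λ r → powerGain j (chosen r)) - (x ² * δ j + (1# - x ²) * gain
          (2 ℕ.+ j))) ≤ incrementConstant * (h * w)
      gain-drift≤ = begin
        abs (avg rounds (λ r → powerGain j (chosen r)) - (x ² * δ j + (1# - x ²) * g))
          ≤⟨ drift (powerGain-solitary j) (powerGain-avg j) ⟩
        h * (abs (δ j) + abs g) + h * (2# * g + 2# * k * moment (3 ℕ.+ j))
          ≈⟨ ≈-trans (+-congʳ (*-congˡ (+-cong (abs-nonneg (0≤δ j)) (abs-nonneg (0≤gain (1 ℕ.+ j)))))) (≈-sym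
              (distribˡ h _ _)) ⟩
        h * ((δ j + g) + (2# * g + 2# * k * moment (3 ℕ.+ j)))
          ≤⟨ *-monoˡ-≤ h 0≤h (+-mono-≤ (+-mono-≤ δ≤ gain≤2KN²) (+-mono-≤ (*-monoˡ-≤ 2# 0≤2 gain≤2KN²)
               (*-mono-≤ (0≤* 0≤2 0≤K) (0≤moment (3 ℕ.+ j)) (*-monoˡ-≤ 2# 0≤2 k≤K) (moment-mono 3+j≤6)))) ⟩
        h * ((2# * K + 2# * (K * N ²)) + (2# * (2# * (K * N ²)) + 2# * K * moment 6))
          ≤⟨ *-monoˡ-≤ h 0≤h (≤-+ (0≤* (0≤* (0≤fromℕ 6) (0≤* 0≤K (²-nonneg N))) (0≤moment 6)) (solve 3 (λ k n m →
               (# 2 :* k :+ # 6 :* k :* n) :* (# 1 :+ m) :=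
               (# 2 :* k :+ # 2 :* (k :* n)) :+ (# 2 :* (# 2 :* (k :* n)) :+ # 2 :* k :* m) :+ # 6 :*
                   (k :* n) :* m) ≈-refl K (N ²) (moment 6))) ⟩
        h * (driftConstant * w)
          ≤⟨ *-monoˡ-≤ h 0≤h (*-monoʳ-≤ w (≤-trans 0≤1 1≤w) (≤-trans (a≤a+b 0≤varianceConstant) (b≤a+b (0≤fromℕ 8)))) ⟩
        h * (incrementConstant * w)
          ≈⟨ solve 3 (λ h c w → h :* (c :* w) := c :* (h :* w)) ≈-refl h incrementConstant w ⟩
        incrementConstant * (h * w) ∎
        where
        g = gain (2 ℕ.+ j)
        import Data.Nat.Properties as ℕ
        3+j≤6 : 3 ℕ.+ j ℕ.≤ 6
        3+j≤6 = ℕ.≤-trans (ℕ.+-monoʳ-≤ 3 j≤2) (s≤s (s≤s (s≤s (s≤s (s≤s z≤n)))))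

      gain-square≤ : avg rounds (λ r → powerGain j (chosen r) ²) ≤ incrementConstant * w
      gain-square≤ = begin
        avg rounds (λ r → powerGain j (chosen r) ²)
          ≤⟨ square (powerGain-solitary j) ⟩
        δ j ² + avg edges (λ e → powerGain j e ²)
          ≤⟨ +-mono-≤ (²-mono-≤ (0≤δ j) δ≤) (powerGain-square j) ⟩
        (2# * K) ² + fromℕ 8 * (k ² * (moment (2 ℕ.* (1 ℕ.+ j)) * moment 2))
          ≤⟨ +-monoʳ-≤ _ (*-monoˡ-≤ _ (0≤fromℕ 8) (*-mono-≤ (²-nonneg K) (0≤* (0≤moment (2 ℕ.* (1 ℕ.+ j)))
              (0≤moment 2)) (²-mono-≤ (0≤gainBound j) k≤K)
               (*-mono-≤ (0≤moment 6) (0≤moment 2) (moment-mono 2+2j≤6) moment2≤N))) ⟩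
        (2# * K) ² + fromℕ 8 * (K ² * (moment 6 * N))
          ≤⟨ ≤-+ (0≤+ (0≤* (0≤* (0≤fromℕ 4) (²-nonneg K)) (0≤moment 6)) (0≤* (0≤* (0≤fromℕ 8) (²-nonneg K)) 0≤N))
              (solve 3 (λ k n m →
               (# 4 :* (k :* k) :+ # 8 :* (k :* k) :* n) :* (# 1 :+ m) :=
               # 2 :* k :* (# 2 :* k) :+ # 8 :* (k :* k :* (m :* n)) :+ (# 4 :* (k :* k) :* m :+ # 8 :*
                   (k :* k) :* n)) ≈-refl K N (moment 6)) ⟩
        varianceConstant * w
          ≤⟨ *-monoʳ-≤ w (≤-trans 0≤1 1≤w) (≤-trans (b≤a+b 0≤driftConstant) (b≤a+b (0≤fromℕ 8))) ⟩
        incrementConstant * w ∎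
        where
        import Data.Nat.Properties as ℕ
        2+2j≤6 : 2 ℕ.* (1 ℕ.+ j) ℕ.≤ 6
        2+2j≤6 = ℕ.*-monoʳ-≤ 2 (s≤s j≤2)

      power-step : ∀ r → mean (λ v → size (bfStep r G) v ^ (1 ℕ.+ j)) ≈ moment (1 ℕ.+ j) + h * powerGain j (chosen r)
      power-step r = mean-step (powerSum-bfStep j r)

    private module P₂ = PowerIncrement 0 z≤n (≤-trans (x≤abs _) (box second))
    private module P₃ = PowerIncrement 1 (s≤s z≤n) (≤-trans (x≤abs _) (box third))
    private module P₄ = PowerIncrement 2 (s≤s (s≤s z≤n)) (≤-trans (x≤abs _) (box fourth))

    increment : ∀ i → Increment i
    increment isolates = isolates-increment
    increment second = record
      { Δ = λ r → powerGain 0 (chosen r)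
      ; step = λ {r} _ → P₂.power-step r
      ; drift≤ = ≤-trans (≤-reflexive (abs-cong (+-congˡ (-‿cong (≈-trans
          (solve 2 (λ x s → # 2 :* (x :* (x :* # 1) :+ (# 1 :- x :* (x :* # 1)) :* (s :* (s :* # 1))) :=
             x :* x :* ((# 1 :+ # 1) :^ 2 :- # 1 :^ 2 :- # 1 :^ 2) :+ (# 1 :- x :* x) :* (# 2 :*
                 (s :* s))) ≈-refl x (moment 1))
          (+-congˡ (*-congˡ (≈-sym gain-2)))))))) P₂.gain-drift≤
      ; square≤ = P₂.gain-square≤
      }
    increment third = record
      { Δ = λ r → powerGain 1 (chosen r)
      ; step = λ {r} _ → P₃.power-step r
      ; drift≤ = ≤-trans (≤-reflexive (abs-cong (+-congˡ (-‿cong (≈-trans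
          (solve 3 (λ x s t → # 2 :* (# 3 :* (x :* (x :* # 1)) :+ # 3 :* (# 1 :- x :* (x :* # 1)) :* s :* t) :=
             x :* x :* ((# 1 :+ # 1) :^ 3 :- # 1 :^ 3 :- # 1 :^ 3) :+ (# 1 :- x :* x) :* (# 3 :* (# 2 :*
                 (t :* s)))) ≈-refl x (moment 1) (moment 2))
          (+-congˡ (*-congˡ (≈-sym gain-3)))))))) P₃.gain-drift≤
      ; square≤ = P₃.gain-square≤
      }
    increment fourth = record
      { Δ = λ r → powerGain 2 (chosen r)
      ; step = λ {r} _ → P₄.power-step r
      ; drift≤ = ≤-trans (≤-reflexive (abs-cong (+-congˡ (-‿cong (≈-trans
          (solve 4 (λ x s t f → # 2 :* (# 7 :* (x :* (x :* # 1)) :+ (# 1 :- x :* (x :* # 1)) :*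
              (# 4 :* s :* f :+ # 3 :* (t :* (t :* # 1)))) :=
             x :* x :* ((# 1 :+ # 1) :^ 4 :- # 1 :^ 4 :- # 1 :^ 4) :+ (# 1 :- x :* x) :* (# 4 :* (# 2 :*
                 (f :* s)) :+ # 3 :* (# 2 :* (t :* t))))
             ≈-refl x (moment 1) (moment 2) (moment 3))
          (+-congˡ (*-congˡ (≈-sym gain-4)))))))) P₄.gain-drift≤
      ; square≤ = P₄.gain-square≤
      }

    -- `gain≤ 5` gives a multiple of `moment 6 * moment 1`, and the box bounds `moment 1` by N. The
    -- constant gain `δ 5` is absorbed because `moment 6` is at least 1.
    seventh-step : avg rounds (λ r → seventh (bfStep r G)) ≤ seventh G + h * (seventhConstant * seventh G)
    seventh-step = begin
      avg rounds (λ r → seventh (bfStep r G))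
        ≈⟨ avg-cong rounds (λ r → mean-step (powerSum-bfStep 5 r)) ⟩
      avg rounds (λ r → seventh G + h * powerGain 5 (chosen r))
        ≈⟨ ≈-trans (avg-+ rounds _ _) (+-cong (avg-const rounds 0<∣rounds∣ _) (avg-* rounds h _)) ⟩
      seventh G + h * avg rounds (λ r → powerGain 5 (chosen r))
        ≤⟨ +-monoʳ-≤ _ (*-monoˡ-≤ h 0≤h bound) ⟩
      seventh G + h * (seventhConstant * seventh G) ∎
      where
      k = gainBound 5
      0≤k = 0≤gainBound 5
      0≤2 = <⇒≤ 0<2
      A = avg edges (powerGain 5)
      bound : avg rounds (λ r → powerGain 5 (chosen r)) ≤ seventhConstant * moment 6
      bound = begin
        avg rounds (λ r → powerGain 5 (chosen r))
          ≈⟨ avg-chosen-δ (powerGain-solitary 5) ⟩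
        p * δ 5 + (1# - p) * A
          ≤⟨ convex≤ 0≤p p≤1 (0≤δ 5) (0≤avg-powerGain 5) ⟩
        δ 5 + A
          ≤⟨ +-mono-≤ (mergeGain-11≤ 5) (≤-trans (avg-powerGain≤ 5) (*-monoˡ-≤ 2# 0≤2 (≤-trans (gain≤ 5)
               (*-monoˡ-≤ k 0≤k (*-monoˡ-≤ 2# 0≤2 (*-monoˡ-≤ _ (0≤moment 6) (≤-trans (x≤abs _) (box second)))))))) ⟩
        2# * k + 2# * (k * (2# * (moment 6 * N)))
          ≤⟨ ≤-+ (0≤* (0≤* 0≤2 0≤k) (x≤y⇒0≤y-x (1≤moment 6))) (solve 3 (λ k n m →
               # 2 :* k :* (# 1 :+ # 2 :* n) :* m := # 2 :* k :+ # 2 :* (k :* (# 2 :* (m :* n))) :+ # 2 :* k :*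
                   (m :- # 1)) ≈-refl k N (moment 6)) ⟩
        seventhConstant * moment 6 ∎

  avg-∑ : ∀ {A B : Set} (xs : List A) (ys : List B) (f : A → B → Carrier) →
    avg xs (λ x → ∑ ys (f x)) ≈ ∑ ys (λ y → avg xs (λ x → f x y))
  avg-∑ xs ys f = ≈-trans (*-congˡ (∑-swap xs ys f)) (≈-sym (∑-* ys _ _))

  module Growth {ū : Statistic → Carrier → Carrier} {T : Carrier} (est : Estimates ū T) where

    open Estimates est

    N : Carrier
    N = M + 1#

    1≤N : 1# ≤ N
    1≤N = b≤a+b 0≤M

    open Constants N 1≤N

    common : Carrier
    common = B + incrementConstant

    0≤common : 0# ≤ common
    0≤common = 0≤+ 0≤B 0≤incrementConstant

    S : Carrier
    S = squareConstant common

    0≤S : 0# ≤ S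
    0≤S = 0≤+ (0≤* (0≤fromℕ 12) 0≤common) (0≤* (0≤fromℕ 72) (²-nonneg common))

    -- The 20 is 16 + 4: each of four coordinates contributes S (4 sq + h w), the inner 4 coming
    -- from `distance²≤`.
    growthRate : Carrier
    growthRate = fromℕ 20 * S + seventhConstant

    0≤growthRate : 0# ≤ growthRate
    0≤growthRate = 0≤+ (0≤* (0≤fromℕ 20) 0≤S) 0≤seventhConstant

    at : Carrier → State
    at s i = ū i s

    module _ (n : ℕ) (2≤n : 2 ℕ.≤ n) (G : Graph n) {a b : Carrier} (0≤a : 0# ≤ a) (b≤T : b ≤ T)
             (b-a≈2h : b - a ≈ 2# * fromℕ n ⁻¹) where

      open AtGraph n 2≤n G

      private
        z : Statistic → Carrier
        z i = state G i - at a i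

        0≤b-a : 0# ≤ b - a
        0≤b-a = ≤-trans (0≤* (<⇒≤ 0<2) 0≤h) (≤-reflexive (≈-sym b-a≈2h))

        a≤b : a ≤ b
        a≤b = 0≤y-x⇒x≤y 0≤b-a

        a∈ : 0# ≤ a × a ≤ T
        a∈ = 0≤a , ≤-trans a≤b b≤T

        sq : Carrier
        sq = squaredDistance (state G) (at a)

        s : Carrier
        s = seventh G

        L : Carrier
        L = lyapunov (at a) G

        0≤hs : 0# ≤ h * s
        0≤hs = 0≤* 0≤h (0≤moment 6)

        0≤sq : 0# ≤ sq
        0≤sq = ∑-nonneg statistics (λ i → ²-nonneg (z i))

      -- Below 1 the Lyapunov function bounds every squared deviation, so the state lies in the box
      -- of radius M + 1 where all one-round estimates hold.
      lyapunov-step : lyapunov (at a) G < 1# →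
        avg rounds (λ r → lyapunov (at b) (bfStep r G)) ≤ lyapunov (at a) G + h * (growthRate * (lyapunov (at a) G + h))
      lyapunov-step L<1 = begin
        avg rounds (λ r → lyapunov (at b) (bfStep r G))
          ≈⟨ ≈-trans (avg-+ rounds _ _) (+-cong (avg-∑ rounds statistics (λ r i → (state
              (bfStep r G) i - at b i) ²)) (avg-* rounds h _)) ⟩
        ∑ statistics (λ i → avg rounds (λ r → (state (bfStep r G) i - at b i) ²)) + h * avg rounds (λ r → seventh
            (bfStep r G))
          ≤⟨ +-mono-≤ (∑-mono-∈ statistics (λ {i} _ → per-statistic i)) (*-monoˡ-≤ h 0≤h I.seventh-step) ⟩
        ∑ statistics (λ i → z i ² + e) + h * (s + h * (seventhConstant * s))
          ≈⟨ +-congʳ (≈-trans (∑-+ statistics (λ i → z i ²) (λ _ → e)) (+-congˡ (∑-const statistics e))) ⟩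
        (sq + fromℕ 4 * e) + h * (s + h * (seventhConstant * s))
          ≤⟨ +-monoˡ-≤ _ (+-monoʳ-≤ sq (*-monoˡ-≤ _ (0≤fromℕ 4) (*-monoˡ-≤ h 0≤h (*-monoˡ-≤ S 0≤S (+-monoˡ-≤ _
              (distance²≤ (state G) (at a))))))) ⟩
        (sq + fromℕ 4 * (h * (S * (fromℕ 4 * sq + h * I.w)))) + h * (s + h * (seventhConstant * s))
          ≤⟨ ≤-+ (0≤+ (0≤* (0≤* (0≤* 0≤h 0≤S) (0≤fromℕ 4)) (0≤+ 0≤sq (0≤+ (0≤* (0≤fromℕ 4) 0≤hs) (0≤*
              (0≤fromℕ 4) 0≤h)))) (0≤* (0≤* 0≤h 0≤seventhConstant) (0≤+ 0≤sq 0≤h)))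
               (solve 5 (λ q h s S c →
                 q :+ h :* s :+ h :* ((# 20 :* S :+ c) :* (q :+ h :* s :+ h)) :=
                 q :+ # 4 :* (h :* (S :* (# 4 :* q :+ h :* (# 1 :+ s)))) :+ h :* (s :+ h :* (c :* s))
                 :+ (h :* S :* # 4 :* (q :+ (# 4 :* (h :* s) :+ # 4 :* h)) :+ h :* c :*
                     (q :+ h))) ≈-refl sq h s S seventhConstant) ⟩
        L + h * (growthRate * (L + h)) ∎
        where
        ∣z∣≤1 : ∀ i → abs (z i) ≤ 1#
        ∣z∣≤1 i = <⇒≤ (²-cancel-< 0≤1 (begin-strict
          abs (z i) ²    ≈⟨ abs-² (z i) ⟩
          z i ²          ≤⟨ term≤∑ {f = λ i → z i ²} (λ i → ²-nonneg (z i)) (∈-statistics i) ⟩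
          sq             ≤⟨ a≤a+b 0≤hs ⟩
          L              <⟨ L<1 ⟩
          1#             ≈⟨ *-identityˡ 1# ⟨
          1# ²           ∎))
        box : InBox N (state G)
        box i = begin
          abs (state G i)               ≈⟨ abs-cong (solve 2 (λ u v → u := v :+ (u :- v)) ≈-refl (state G i) (at a i)) ⟩
          abs (at a i + z i)            ≤⟨ ≤-trans (abs-+ _ _) (+-mono-≤ (inBox i a a∈) (∣z∣≤1 i)) ⟩
          N                             ∎
        box̄ : InBox N (at a)
        box̄ i = ≤-trans (inBox i a a∈) (a≤a+b 0≤1)
        module I = Increments n 2≤n G N 1≤N box
        d = distance (state G) (at a)
        e = h * (S * (d ² + h * I.w))
        per-statistic : ∀ i → avg rounds (λ r → (state (bfStep r G) i - at b i) ²) ≤ z i ² + e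
        per-statistic i = begin
          avg rounds (λ r → (state (bfStep r G) i - at b i) ²)
            ≈⟨ avg-cong-∈ rounds (λ r∈ → *-cong (deviation r∈) (deviation r∈)) ⟩
          avg rounds (λ r → (z i + (h * Δ r - η)) ²)
            ≤⟨ avg-square rounds 0<∣rounds∣ Δ h (z i) η ⟩
          _ ≤⟨ square-step 0≤common 0≤h h≤1 I.1≤w (0≤distance (state G) (at a))
                 (≤-trans drift≤ (*-monoʳ-≤ _ (0≤* 0≤h (≤-trans 0≤1 I.1≤w)) C≤common))
                 (≤-trans square≤ (*-monoʳ-≤ _ (≤-trans 0≤1 I.1≤w) C≤common))
                 η≈
                 (≤-trans (proj₂ (tame i) (state G) (at a) box box̄) (*-monoʳ-≤ _ (0≤distance (state G) (at a)) B≤common))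
                 (≤-trans (proj₁ (tame i) (at a) box̄) B≤common)
                 (∣z∣≤1 i) (coordinate≤distance (state G) (at a) i) ⟩
          z i ² + e ∎
          where
          open I.Increment (I.increment i)
          η = at b i - at a i
          C≤common : incrementConstant ≤ common
          C≤common = b≤a+b 0≤B
          B≤common : B ≤ common
          B≤common = a≤a+b 0≤incrementConstant
          deviation : ∀ {r} → r ∈ rounds → state (bfStep r G) i - at b i ≈ z i + (h * Δ r - η)
          deviation r∈ = ≈-trans (+-congʳ (step r∈)) (solve 4 (λ u p a b → u :+ p :- b := (u :- a) :+ (p :- (b :- a))) ≈-refl
            (state G i) (h * Δ _) (at a i) (at b i))
          η≈ : abs (η - drift-field i (at a) * (2# * h)) ≤ common * (2# * h) ²
          η≈ = begin
            abs (η - drift-field i (at a) * (2# * h))    ≈⟨ abs-cong (+-congˡ (-‿cong (*-congˡ b-a≈2h))) ⟨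
            abs (η - drift-field i (at a) * (b - a))     ≤⟨ taylor i 0≤a a≤b b≤T ⟩
            B * (b - a) ²                                ≈⟨ *-congˡ (*-cong b-a≈2h b-a≈2h) ⟩
            B * (2# * h) ²                               ≤⟨ *-monoʳ-≤ _ (²-nonneg (2# * h)) B≤common ⟩
            common * (2# * h) ²                          ∎

-- Truncation, discrete Gronwall inequality and Markov's inequality.

module Main (em : ExcludedMiddle 0ℓ) (R : RealNumbers) where

  open OrderedField R
  open Analysis em R
  open Sums R
  open Components R
  open EdgeAverages R
  open MergeGain R
  open OneRound R
  open Trajectory em R
  open Lyapunov em R
  import Algebra.Properties.Semiring.Exp semiring as Exp

  cap : Carrier → Carrier
  cap y with ≤-or-> 1# y
  ... | inj₁ _ = 1#
  ... | inj₂ _ = y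

  cap≤1 : ∀ y → cap y ≤ 1#
  cap≤1 y with ≤-or-> 1# y
  ... | inj₁ _   = ≤-refl
  ... | inj₂ y<1 = <⇒≤ y<1

  cap≤ : ∀ y → cap y ≤ y
  cap≤ y with ≤-or-> 1# y
  ... | inj₁ 1≤y = 1≤y
  ... | inj₂ _   = ≤-refl

  cap-greatest : ∀ {x y} → x ≤ 1# → x ≤ y → x ≤ cap y
  cap-greatest {y = y} x≤1 x≤y with ≤-or-> 1# y
  ... | inj₁ _ = x≤1
  ... | inj₂ _ = x≤y

  0<cap : ∀ {y} → 0# < y → 0# < cap y
  0<cap {y} 0<y with ≤-or-> 1# y
  ... | inj₁ _ = 0<1
  ... | inj₂ _ = 0<y

  markov : ∀ {Ω : Set} (xs : List Ω) {P : Pred Ω 0ℓ} (P? : Decidable P) {c} (Y : Ω → Carrier) →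
    (∀ ω → 0# ≤ Y ω) → (∀ ω → P ω → c ≤ Y ω) → c * ℙ xs P? ≤ avg xs Y
  markov xs P? {c} Y 0≤Y c≤Y = begin
    c * (fromℕ (length (filter P? xs)) * fromℕ (length xs) ⁻¹)
      ≈⟨ *-congˡ (≈-trans (*-comm _ _) (*-congˡ (≈-trans (length≈∑1 (filter P? xs)) (∑-filter P? xs _)))) ⟩
    c * avg xs (λ ω → ⟦ does (P? ω) ⟧ * 1#)
      ≈⟨ avg-* xs c _ ⟨
    avg xs (λ ω → c * (⟦ does (P? ω) ⟧ * 1#))
      ≤⟨ avg-mono xs pointwise ⟩
    avg xs Y ∎
    where
    pointwise : ∀ ω → c * (⟦ does (P? ω) ⟧ * 1#) ≤ Y ω
    pointwise ω with P? ω
    ... | yes Pω = ≤-trans (≤-reflexive (solve 1 (λ c → c :* (# 1 :* # 1) := c) ≈-refl c)) (c≤Y ω Pω)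
    ... | no  _  = ≤-trans (≤-reflexive (solve 1 (λ c → c :* (# 0 :* # 1) := # 0) ≈-refl c)) (0≤Y ω)

  0≤ℙ : ∀ {Ω : Set} (xs : List Ω) {P : Pred Ω 0ℓ} (P? : Decidable P) → 0# ≤ ℙ xs P?
  0≤ℙ []       P? = ≤-reflexive (≈-sym (zeroˡ _))
  0≤ℙ (x ∷ xs) P? = 0≤* (0≤fromℕ (length (filter P? (x ∷ xs)))) (0≤fromℕ⁻¹ (suc (length xs)))

  bernoulli : ∀ q {u} → 0# ≤ u → 1# + fromℕ q * u ≤ (1# + u) ^ q
  bernoulli zero    {u} 0≤u = ≤-reflexive (solve 1 (λ u → # 1 :+ # 0 :* u := # 1) ≈-refl u)
  bernoulli (suc q) {u} 0≤u = begin
    1# + fromℕ (suc q) * u             ≤⟨ ≤-+ (0≤* (0≤fromℕ q) (²-nonneg u)) (solve 2 (λ q u →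
                                            (# 1 :+ u) :* (# 1 :+ q :* u) := # 1 :+ (# 1 :+ q) :* u :+ q :*
                                                (u :* u)) ≈-refl (fromℕ q) u) ⟩
    (1# + u) * (1# + fromℕ q * u)      ≤⟨ *-monoˡ-≤ _ (0≤+ 0≤1 0≤u) (bernoulli q 0≤u) ⟩
    (1# + u) ^ suc q                   ∎

  -- Induction from (1 + u) (1 - (m + 1) u) = 1 - m u - (m + 1) u².
  inverse-bernoulli : ∀ m {u} → 0# ≤ u → (1# + u) ^ m * (1# - fromℕ m * u) ≤ 1#
  inverse-bernoulli zero    {u} 0≤u = ≤-reflexive (solve 1 (λ u → # 1 :* (# 1 :- # 0 :* u) := # 1) ≈-refl u)
  inverse-bernoulli (suc m) {u} 0≤u = begin
    (1# + u) ^ suc m * (1# - fromℕ (suc m) * u)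
      ≤⟨ ≤-+ (0≤* (0≤^ m (0≤+ 0≤1 0≤u)) (0≤* (0≤fromℕ (suc m)) (²-nonneg u))) (solve 3 (λ p m u →
           p :* (# 1 :- m :* u) := (# 1 :+ u) :* p :* (# 1 :- (# 1 :+ m) :* u) :+ p :* ((# 1 :+ m) :*
               (u :* u))) ≈-refl ((1# + u) ^ m) (fromℕ m) u) ⟩
    (1# + u) ^ m * (1# - fromℕ m * u)
      ≤⟨ inverse-bernoulli m 0≤u ⟩
    1# ∎

  -- (1 + x)^m ≤ (1 + x/q)^(qm), and (1 + u)^m ≤ 1/(1 - mu) ≤ 2 for u = x/q.
  compound≤ : ∀ m q .{{_ : ℕ.NonZero q}} {x} → 0# ≤ x → 2# * (fromℕ m * x) ≤ fromℕ q → (1# + x) ^ m ≤ 2# ^ q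
  compound≤ m q {x} 0≤x 2mx≤q = begin
    (1# + x) ^ m             ≈⟨ ^-cong m (+-congˡ (≈-trans (≈-sym (*-identityˡ x)) (≈-trans (*-congʳ (≈-sym
        (*-inverseʳ _ (<⇒≉ 0<q))))
                                  (solve 3 (λ q i x → q :* i :* x := q :* (i :* x)) ≈-refl (fromℕ q) (fromℕ q ⁻¹) x)))) ⟩
    (1# + fromℕ q * u) ^ m   ≤⟨ ^-monoˡ-≤ m (0≤+ 0≤1 (0≤* (0≤fromℕ q) 0≤u)) (bernoulli q 0≤u) ⟩
    ((1# + u) ^ q) ^ m       ≈⟨ Exp.^-assocʳ (1# + u) q m ⟩
    (1# + u) ^ (q ℕ.* m)     ≡⟨ ≡.cong ((1# + u) ^_) (ℕ.*-comm q m) ⟩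
    (1# + u) ^ (m ℕ.* q)     ≈⟨ Exp.^-assocʳ (1# + u) m q ⟨
    ((1# + u) ^ m) ^ q       ≤⟨ ^-monoˡ-≤ q (0≤^ m (0≤+ 0≤1 0≤u)) [1+u]^m≤2 ⟩
    2# ^ q                   ∎
    where
    0<q = 0<fromℕ q
    u = fromℕ q ⁻¹ * x
    0≤u : 0# ≤ u
    0≤u = 0≤* (0≤fromℕ⁻¹ q) 0≤x
    2mu≤1 : 2# * (fromℕ m * u) ≤ 1#
    2mu≤1 = begin
      2# * (fromℕ m * u)                  ≈⟨ solve 3 (λ m i x → # 2 :* (m :* (i :* x)) := i :* (# 2 :*
          (m :* x))) ≈-refl (fromℕ m) (fromℕ q ⁻¹) x ⟩
      fromℕ q ⁻¹ * (2# * (fromℕ m * x))   ≤⟨ *-monoˡ-≤ _ (0≤fromℕ⁻¹ q) 2mx≤q ⟩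
      fromℕ q ⁻¹ * fromℕ q                ≈⟨ *-inverseˡ 0<q ⟩
      1#                                  ∎
    [1+u]^m≤2 : (1# + u) ^ m ≤ 2#
    [1+u]^m≤2 = begin
      (1# + u) ^ m
        ≤⟨ ≤-+ (0≤* (0≤^ m (0≤+ 0≤1 0≤u)) (x≤y⇒0≤y-x 2mu≤1)) (solve 2 (λ p v →
             # 2 :* (p :* (# 1 :- v)) := p :+ p :* (# 1 :- # 2 :* v)) ≈-refl ((1# + u) ^ m) (fromℕ m * u)) ⟩
      2# * ((1# + u) ^ m * (1# - fromℕ m * u))
        ≤⟨ *-monoˡ-≤ 2# (<⇒≤ 0<2) (inverse-bernoulli m 0≤u) ⟩
      2# * 1#
        ≈⟨ *-identityʳ 2# ⟩
      2# ∎

  module Expectation (n : ℕ) (2≤n : 2 ℕ.≤ n) where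

    open AtLeastTwo n 2≤n
    open AtGraph n 2≤n [] using (rounds; 0<∣rounds∣)

    expectation : ℕ → (Graph n → Carrier) → Carrier
    expectation m φ = avg (histories n m) (λ ω → φ (bohmanFrieze ω))

    0<∣histories∣ : ∀ m → 0# < fromℕ (length (histories n m))
    0<∣histories∣ zero    = 0<fromℕ 1
    0<∣histories∣ (suc m) = 0<length-cartesianProductWith _∷_ rounds (histories n m) 0<∣rounds∣ (0<∣histories∣ m)

    -- The latest round is the head of a history; exchanging the averages makes it the inner one,
    -- the conditional expectation given the earlier rounds.
    expectation-suc : ∀ m φ → expectation (suc m) φ ≈ expectation m (λ G → avg rounds (λ r → φ (bfStep r G)))
    expectation-suc m φ = ≈-trans
      (avg-cartesianProductWith _∷_ rounds (histories n m) 0<∣rounds∣ (0<∣histories∣ m) (λ ω → φ (bohmanFrieze ω)))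
      (avg-swap rounds (histories n m) (λ r ω → φ (bfStep r (bohmanFrieze ω))))

    module _ {ū : Statistic → Carrier → Carrier} {T : Carrier} (est : Estimates ū T) (ū-init : ∀ i → ū i 0# ≈ 1#) where

      open Estimates est
      open Growth est

      time : ℕ → Carrier
      time i = fromℕ i * (2# * h)

      0≤time : ∀ i → 0# ≤ time i
      0≤time i = 0≤* (0≤fromℕ i) (0≤* (<⇒≤ 0<2) 0≤h)

      time-suc : ∀ i → time (suc i) - time i ≈ 2# * h
      time-suc i = solve 2 (λ i h → (# 1 :+ i) :* (# 2 :* h) :- i :* (# 2 :* h) := # 2 :* h) ≈-refl (fromℕ i) h

      potential : ℕ → Graph n → Carrier
      potential i G = cap (lyapunov (at (time i)) G)

      0≤lyapunov : ∀ v G → 0# ≤ lyapunov v G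
      0≤lyapunov v G = 0≤+ (∑-nonneg statistics (λ i → ²-nonneg (state G i - v i))) (0≤* 0≤h
        (avg-nonneg (allFin n) (λ v → 0≤^ 6 (≤-trans 0≤1 (1≤size G v)))))

      potential-step : ∀ i → time (suc i) ≤ T → ∀ G →
        avg rounds (λ r → potential (suc i) (bfStep r G)) ≤ potential i G + h * (growthRate * (potential i G + h))
      potential-step i t≤T G with ≤-or-> 1# (lyapunov (at (time i)) G)
      -- Here the present potential is 1, and no later value exceeds 1.
      ... | inj₁ _ = ≤-trans (avg-mono rounds (λ r → cap≤1 _)) (≤-trans (≤-reflexive (avg-const rounds 0<∣rounds∣ 1#))
              (a≤a+b (0≤* 0≤h (0≤* 0≤growthRate (0≤+ 0≤1 0≤h)))))
      ... | inj₂ L<1 = ≤-trans (avg-mono rounds (λ r → cap≤ _)) (lyapunov-step n 2≤n G (0≤time i) t≤T (time-suc i) L<1)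

      private
        ∅ : Graph n
        ∅ = []

        1+hA : Carrier
        1+hA = 1# + h * growthRate

        0≤1+hA : 0# ≤ 1+hA
        0≤1+hA = 0≤+ 0≤1 (0≤* 0≤h 0≤growthRate)

        initial : potential 0 ∅ ≤ h
        initial = ≤-trans (cap≤ _) (≤-reflexive (begin-equality
          ∑ statistics (λ i → (state ∅ i - at (time 0) i) ²) + h * seventh ∅
            ≈⟨ +-cong (∑-cong statistics (λ i → *-cong (vanishes i) (vanishes i))) (*-congˡ (power1 6)) ⟩
          ∑ statistics (λ i → 0# * 0#) + h * 1#
            ≈⟨ solve 1 (λ h → # 0 :* # 0 :+ (# 0 :* # 0 :+ (# 0 :* # 0 :+ (# 0 :* # 0 :+ # 0))) :+ h :* # 1 := h) ≈-refl h ⟩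
          h ∎))
          where
          power1 : ∀ k → mean (λ v → size ∅ v ^ k) ≈ 1#
          power1 k = ≈-trans (avg-cong (allFin n) (λ v → ≈-trans (^-cong k (size-[] v)) (1^ k))) (mean-const 1#)
          state-[] : ∀ i → state ∅ i ≈ 1#
          state-[] isolates = mean-const 1#
          state-[] second   = power1 1
          state-[] third    = power1 2
          state-[] fourth   = power1 3
          time-0 : time 0 ≈ 0#
          time-0 = zeroˡ _
          -- `time 0` equals `0#` only up to `≈`, which the functions are not assumed to respect;
          -- the Lipschitz bound supplies the equality.
          ū-start : ∀ i → ū i (time 0) - ū i 0# ≈ 0#
          ū-start i = ≤-antisym (≤-trans (x≤abs _) small) (≤-trans (≤-reflexive (solve 0 (# 0 := :- # 0) ≈-refl))
            (≤-trans (neg-mono-≤ (≤-trans (-x≤abs _) small)) (≤-reflexive (solve 1 (λ x → :- :- x := x) ≈-refl _))))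
            where
            small : abs (ū i (time 0) - ū i 0#) ≤ 0#
            small = ≤-trans (lipschitz i ≤-refl (≤-reflexive (≈-sym time-0)) (≤-trans (≤-reflexive time-0) 0≤T))
              (≤-reflexive (≈-trans (*-congˡ (≈-trans (+-congʳ time-0) (-‿inverseʳ 0#))) (zeroʳ B)))
          vanishes : ∀ i → state ∅ i - at (time 0) i ≈ 0#
          vanishes i = begin-equality
            state ∅ i - ū i (time 0)
              ≈⟨ +-congʳ (≈-trans (state-[] i) (≈-sym (ū-init i))) ⟩
            ū i 0# - ū i (time 0)
              ≈⟨ solve 2 (λ a b → a :- b := :- (b :- a)) ≈-refl (ū i 0#) (ū i (time 0)) ⟩
            - (ū i (time 0) - ū i 0#)
              ≈⟨ ≈-trans (-‿cong (ū-start i)) (solve 0 (:- # 0 := # 0) ≈-refl) ⟩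
            0# ∎

      -- Adding h makes the recursion homogeneous: a′ ≤ a + hA (a + h) becomes a′ + h ≤ (1 + hA) (a
      -- + h). The final factor 2h is the starting bound, h from `initial` and h from this summand.
      expectation-potential≤ : ∀ m → time m ≤ T → expectation m (potential m) + h ≤ (1# + h * growthRate) ^ m * (2# * h)
      expectation-potential≤ zero    _ = begin
        expectation 0 (potential 0) + h
          ≤⟨ +-monoˡ-≤ h (≤-trans (≤-reflexive (≈-trans (avg-cong (histories n 0) {λ ω → potential 0
              (bohmanFrieze ω)} {λ _ → potential 0 ∅} (λ { [] → ≈-refl }))
               (avg-const (histories n 0) (0<∣histories∣ 0) (potential 0 ∅)))) initial) ⟩
        h + h
          ≈⟨ solve 1 (λ h → h :+ h := # 1 :* (# 2 :* h)) ≈-refl h ⟩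
        1# * (2# * h) ∎
      expectation-potential≤ (suc m) t≤T = begin
        expectation (suc m) (potential (suc m)) + h
          ≈⟨ +-congʳ (expectation-suc m (potential (suc m))) ⟩
        expectation m (λ G → avg rounds (λ r → potential (suc m) (bfStep r G))) + h
          ≤⟨ +-monoˡ-≤ h (avg-mono (histories n m) (λ ω → potential-step m t≤T (bohmanFrieze ω))) ⟩
        expectation m (λ G → potential m G + h * (growthRate * (potential m G + h))) + h
          ≈⟨ +-congʳ (≈-trans (avg-+ (histories n m) _ _) (+-congˡ (≈-trans (avg-* (histories n m) h _) (*-congˡ
               (≈-trans (avg-* (histories n m) growthRate _) (*-congˡ (≈-trans (avg-+ (histories n m) _ _)
                   (+-congˡ (avg-const (histories n m) (0<∣histories∣ m) h))))))))) ⟩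
        (a + h * (growthRate * (a + h))) + h
          ≈⟨ solve 3 (λ a h g → a :+ h :* (g :* (a :+ h)) :+ h := (# 1 :+ h :* g) :* (a :+ h)) ≈-refl a h growthRate ⟩
        1+hA * (a + h)
          ≤⟨ *-monoˡ-≤ _ 0≤1+hA (expectation-potential≤ m (≤-trans (0≤y-x⇒x≤y (≤-trans (0≤* (<⇒≤ 0<2) 0≤h)
              (≤-reflexive (≈-sym (time-suc m))))) t≤T)) ⟩
        1+hA * (1+hA ^ m * (2# * h))
          ≈⟨ *-assoc _ _ _ ⟨
        1+hA ^ suc m * (2# * h) ∎
        where a = expectation m (potential m)

  susceptibility≈mean : ∀ {n} k (G : Graph n) → susceptibility R (suc k) G ≈ Means.mean n (λ v → size G v ^ k)
  susceptibility≈mean {n} k G = ≈-trans (*-comm _ _) (≈-trans (*-congˡ (componentPowerSum≈powerSum k G)) (≈-sym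
      (Means.mean≈ n _)))

  -- Choice of the thresholds and convergence in probability.

  module Convergence (ū : Statistic → Carrier → Carrier) (t : Carrier) (0≤t : 0# ≤ t)
    (ū-init : ∀ i → ū i 0# ≈ 1#)
    (ode : ∀ i → HasDerivativeOn [ 0# , t ] (ū i) (λ s → drift-field i (λ j → ū j s)))
    (rounds : ℕ → ℕ) (floor : ∀ n → IsFloorOf (rounds n) (fromℕ n * t * fromℕ 2 ⁻¹)) where

    private
      est : Estimates ū t
      est = estimates ū t 0≤t ode

    open Estimates est
    open Growth est

    -- `X` stands for a susceptibility: it agrees with a coordinate of `state` only up to `≈`, while
    -- the event in the conclusion is decided on `X` itself.
    module _ (i : Statistic) (X : ∀ {n} → Graph n → Carrier) (X≈ : ∀ {n} (G : Graph n) → X G ≈ state G i) where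

      converges : ConvergesInProbability (λ n → histories n (rounds n)) (λ n ω → X (bohmanFrieze ω)) (ū i t)
      converges ε 0<ε ε₂ 0<ε₂ = 2 ℕ.+ (N₁ ℕ.+ N₂) , eventually
        where
        q′ : ∃[ q ] t * growthRate < fromℕ q
        q′ = archimedean (t * growthRate)
        q = proj₁ q′
        -- A deviation by more than ε at time t leaves at least half of ε at the time τ of the last
        -- round, hence (½ ε)² in the squared distance; the cap matches that of the potential.
        ε₁ = cap ((½ * ε) ²)
        0<½ε = *-pos ½ ε 0<½ 0<ε
        0<ε₁ : 0# < ε₁
        0<ε₁ = 0<cap (*-pos _ _ 0<½ε 0<½ε)
        -- The probability will be at most h c: `2# ^ suc q` bounds the growth factor, 2h is the
        -- starting bound, and ε₁ is the threshold in Markov's inequality.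
        c = ε₁ ⁻¹ * (2# ^ suc q * 2#)
        -- The first index makes h c less than ε₂; the second makes 2 B h, the possible motion of
        -- the limit between τ and t, less than half of ε.
        arch₁ : ∃[ k ] c * ε₂ ⁻¹ < fromℕ k
        arch₁ = archimedean (c * ε₂ ⁻¹)
        arch₂ : ∃[ k ] B * 2# * (½ * ε) ⁻¹ < fromℕ k
        arch₂ = archimedean (B * 2# * (½ * ε) ⁻¹)
        N₁ = proj₁ arch₁
        N₂ = proj₁ arch₂

        module _ (n : ℕ) (large : 2 ℕ.+ (N₁ ℕ.+ N₂) ℕ.≤ n) where

          2≤n : 2 ℕ.≤ n
          2≤n = ℕ.≤-trans (ℕ.m≤m+n 2 _) large
          open AtLeastTwo n 2≤n
          open Expectation n 2≤n

          N₁≤n : N₁ ℕ.≤ n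
          N₁≤n = ℕ.≤-trans (ℕ.≤-trans (ℕ.m≤m+n N₁ N₂) (ℕ.m≤n+m _ 2)) large
          N₂≤n : N₂ ℕ.≤ n
          N₂≤n = ℕ.≤-trans (ℕ.≤-trans (ℕ.m≤n+m N₂ N₁) (ℕ.m≤n+m _ 2)) large

          scale : ∀ {x y} → 0# < y → x * y ⁻¹ < ν → h * x < y
          scale {x} {y} 0<y p = <-resp
            (≈-trans (solve 4 (λ y h x i → y :* h :* (x :* i) := i :* y :* (h :* x)) ≈-refl y h x (y ⁻¹))
              (≈-trans (*-congʳ (*-inverseˡ 0<y)) (*-identityˡ _)))
            (≈-trans (*-assoc y h ν) (≈-trans (*-congˡ hν≈1) (*-identityʳ y)))
            (*-monoˡ-< (y * h) (*-pos y h 0<y 0<h) p)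

          m = rounds n
          τ = time est ū-init m

          half-time : fromℕ n * t * ½ * (2# * h) ≈ t
          half-time = begin-equality
            ν * t * ½ * (2# * h)       ≈⟨ solve 4 (λ v t i h → v :* t :* i :* (# 2 :* h) := h :* v :*
                (i :* # 2) :* t) ≈-refl ν t ½ h ⟩
            h * ν * (½ * 2#) * t       ≈⟨ *-congʳ (*-cong hν≈1 (*-inverseˡ 0<2)) ⟩
            1# * 1# * t                ≈⟨ solve 1 (λ t → # 1 :* # 1 :* t := t) ≈-refl t ⟩
            t                          ∎

          0<2h : 0# < 2# * h
          0<2h = *-pos 2# h 0<2 0<h

          τ≤t : τ ≤ t
          τ≤t = ≤-trans (*-monoʳ-≤ _ (<⇒≤ 0<2h) (proj₁ (floor n))) (≤-reflexive half-time)

          -- Rounding down loses at most one round, that is, time 2h.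
          t-τ≤2h : t - τ ≤ 2# * h
          t-τ≤2h = ≤-trans (+-monoˡ-≤ (- τ) (begin
              t                                  ≈⟨ half-time ⟨
              ν * t * ½ * (2# * h)               ≤⟨ *-monoʳ-≤ _ (<⇒≤ 0<2h) (<⇒≤ (proj₂ (floor n))) ⟩
              fromℕ (suc m) * (2# * h)           ∎))
            (≤-reflexive (time-suc est ū-init m))

          ū-close : abs (ū i t - ū i τ) ≤ ½ * ε
          ū-close = begin
            abs (ū i t - ū i τ)     ≤⟨ lipschitz i (0≤time est ū-init m) τ≤t ≤-refl ⟩
            B * (t - τ)             ≤⟨ *-monoˡ-≤ B 0≤B t-τ≤2h ⟩
            B * (2# * h)            ≈⟨ solve 2 (λ b h → b :* (# 2 :* h) := h :* (b :* # 2)) ≈-refl B h ⟩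
            h * (B * 2#)            <⟨ scale 0<½ε (<-≤-trans (proj₂ arch₂) (fromℕ-mono-≤ N₂≤n)) ⟩
            ½ * ε                   ∎

          Deviates : Pred (Vec (Round n) m) 0ℓ
          Deviates ω = ε < abs (X (bohmanFrieze ω) - ū i t)
          deviates? : Decidable Deviates
          deviates? ω = ε <? abs (X (bohmanFrieze ω) - ū i t)

          Y : Vec (Round n) m → Carrier
          Y ω = potential est ū-init m (bohmanFrieze ω)

          far : ∀ ω → Deviates ω → ε₁ ≤ Y ω
          far ω dev = cap-greatest (cap≤1 _) (begin
            ε₁                                       ≤⟨ cap≤ _ ⟩
            (½ * ε) ²                                ≤⟨ ²-mono-≤ (<⇒≤ 0<½ε) ½ε≤ ⟩
            abs (state G i - ū i τ) ²                ≈⟨ abs-² _ ⟩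
            (state G i - ū i τ) ²                    ≤⟨ term≤∑ {f = λ j → (state G j - ū j τ) ²} (λ j → ²-nonneg
                (state G j - ū j τ)) (∈-statistics i) ⟩
            squaredDistance (state G) (at τ)         ≤⟨ a≤a+b (0≤* 0≤h (avg-nonneg (allFin n) (λ v → 0≤^ 6
                (≤-trans 0≤1 (1≤size G v))))) ⟩
            lyapunov (at τ) G                        ∎)
            where
            G = bohmanFrieze ω
            ½ε≤ : ½ * ε ≤ abs (state G i - ū i τ)
            ½ε≤ = begin
              ½ * ε
                ≈⟨ solve 1 (λ e → e := e :+ e :- e) ≈-refl (½ * ε) ⟩
              ½ * ε + ½ * ε - ½ * ε
                ≈⟨ +-congʳ (x≈½x+½x ε) ⟨
              ε - ½ * ε
                ≤⟨ +-mono-≤ (<⇒≤ dev) (neg-mono-≤ ū-close) ⟩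
              abs (X G - ū i t) - abs (ū i t - ū i τ)
                ≈⟨ +-congʳ (abs-cong (≈-trans (+-congʳ (X≈ G)) (solve 3 (λ s t τ → s :- t := (s :- τ) :+ :-
                    (t :- τ)) ≈-refl (state G i) (ū i t) (ū i τ)))) ⟩
              abs ((state G i - ū i τ) + - (ū i t - ū i τ)) - abs (ū i t - ū i τ)
                ≤⟨ +-monoˡ-≤ _ (≤-trans (abs-+ _ _) (+-monoʳ-≤ _ (≤-reflexive (abs-neg _)))) ⟩
              abs (state G i - ū i τ) + abs (ū i t - ū i τ) - abs (ū i t - ū i τ)
                ≈⟨ solve 2 (λ a b → a :+ b :- b := a) ≈-refl _ _ ⟩
              abs (state G i - ū i τ) ∎

          -- `compound≤` divides by its exponent, so the successor of `q` is taken to exclude zero.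
          growth≤ : (1# + h * growthRate) ^ m ≤ 2# ^ suc q
          growth≤ = compound≤ m (suc q) (0≤* 0≤h 0≤growthRate) (begin
            2# * (fromℕ m * (h * growthRate))      ≈⟨ solve 3 (λ m h g → # 2 :* (m :* (h :* g)) := m :*
                (# 2 :* h) :* g) ≈-refl (fromℕ m) h growthRate ⟩
            τ * growthRate                         ≤⟨ *-monoʳ-≤ _ 0≤growthRate τ≤t ⟩
            t * growthRate                         ≤⟨ <⇒≤ (proj₂ q′) ⟩
            fromℕ q                                ≤⟨ fromℕ-mono-≤ (ℕ.n≤1+n q) ⟩
            fromℕ (suc q)                          ∎)

          p = ℙ (histories n m) deviates?

          p≤ : p ≤ h * c
          p≤ = *-cancelˡ-≤ ε₁ 0<ε₁ (begin
            ε₁ * p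
              ≤⟨ markov (histories n m) deviates? Y (λ ω → cap-greatest 0≤1 (0≤lyapunov est ū-init (at τ)
                  (bohmanFrieze ω))) far ⟩
            expectation m (potential est ū-init m)
              ≤⟨ a≤a+b 0≤h ⟩
            expectation m (potential est ū-init m) + h
              ≤⟨ expectation-potential≤ est ū-init m τ≤t ⟩
            (1# + h * growthRate) ^ m * (2# * h)
              ≤⟨ *-monoʳ-≤ _ (<⇒≤ 0<2h) growth≤ ⟩
            2# ^ suc q * (2# * h)
              ≈⟨ *-identityˡ _ ⟨
            1# * (2# ^ suc q * (2# * h))
              ≈⟨ *-congʳ (*-inverseˡ 0<ε₁) ⟨
            ε₁ ⁻¹ * ε₁ * (2# ^ suc q * (2# * h))
              ≈⟨ solve 4 (λ e i x h → i :* e :* (x :* (# 2 :* h)) := e :* (h :* (i :* (x :* # 2)))) ≈-refl ε₁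
                  (ε₁ ⁻¹) (2# ^ suc q) h ⟩
            ε₁ * (h * c) ∎)

        eventually : ∀ n → 2 ℕ.+ (N₁ ℕ.+ N₂) ℕ.≤ n → abs (ℙ (histories n (rounds n)) (λ ω → ε <? abs (X
            (bohmanFrieze ω) - ū i t)) - 0#) < ε₂
        eventually n large = begin-strict
          abs (p n large - 0#)    ≈⟨ abs-cong (solve 1 (λ p → p :- # 0 := p) ≈-refl (p n large)) ⟩
          abs (p n large)         ≈⟨ abs-nonneg (0≤ℙ (histories n (rounds n)) (deviates? n large)) ⟩
          p n large               ≤⟨ p≤ n large ⟩
          h * c                   <⟨ scale n large 0<ε₂ (<-≤-trans (proj₂ arch₁) (fromℕ-mono-≤ (N₁≤n n large))) ⟩
          ε₂                      ∎
          where open AtLeastTwo n (2≤n n large)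

theorem3p2 :
    ExcludedMiddle 0ℓ →
    (R : RealNumbers) (S : BFSystem R) →
    let open RealNumbers R
        open BFSystem S
    in
    (t : Carrier) → 0# ≤ t → t < t-c →
    (rounds : ℕ → ℕ) → (∀ n → IsFloorOf (rounds n) (fromℕ n * t * fromℕ 2 ⁻¹)) →
    SusceptibilityConverges R rounds 2 (s̄₂ t) ×
    SusceptibilityConverges R rounds 3 (s̄₃ t) ×
    SusceptibilityConverges R rounds 4 (s̄₄ t)
theorem3p2 em R S t 0≤t t<t-c rounds floor =
  converges second (susceptibility R 2) (susceptibility≈mean 1) ,
  converges third  (susceptibility R 3) (susceptibility≈mean 2) ,
  converges fourth (susceptibility R 4) (susceptibility≈mean 3)
  where
  open OrderedField R
  open Analysis em R
  open Trajectory em R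
  open Main em R
  open BFSystem S
  ū : Statistic → Carrier → Carrier
  ū isolates = x̄
  ū second   = s̄₂
  ū third    = s̄₃
  ū fourth   = s̄₄
  ū-init : ∀ i → ū i 0# ≈ 1#
  ū-init isolates = x̄-init
  ū-init second   = s̄₂-init
  ū-init third    = s̄₃-init
  ū-init fourth   = s̄₄-init
  -- A smaller domain only removes comparison points. On the closed interval up to t the trajectory
  -- is bounded, whereas `s̄₂` is unbounded on the full domain of its equation.
  restrict : ∀ {D f F} → (∀ s → [ 0# , t ] s → D s) → HasDerivativeOn D f F → HasDerivativeOn [ 0# , t ] f F
  restrict ⊆D f′ s s∈ ε 0<ε with f′ s (⊆D s s∈) ε 0<ε
  ... | δ , 0<δ , near = δ , 0<δ , λ y y∈ → near y (⊆D y y∈)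
  before-t-c : ∀ s → [ 0# , t ] s → 0# ≤ s × s < t-c
  before-t-c s (0≤s , s≤t) = 0≤s , ≤-<-trans s≤t t<t-c
  ode : ∀ i → HasDerivativeOn [ 0# , t ] (ū i) (λ s → drift-field i (λ j → ū j s))
  ode isolates = restrict {F = λ s → drift-field isolates (λ j → ū j s)} (λ _ → proj₁) x̄-ode
  ode second   = restrict {F = λ s → drift-field second (λ j → ū j s)} before-t-c s̄₂-ode
  ode third    = restrict {F = λ s → drift-field third (λ j → ū j s)} before-t-c s̄₃-ode
  ode fourth   = restrict {F = λ s → drift-field fourth (λ j → ū j s)} before-t-c s̄₄-ode
  open Convergence ū t 0≤t ū-init ode rounds floor
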